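{- Let $k\geq 0$ be an integer and let $\ell$ be a prime with $\ell\equiv 3 \pmod{5}$. Then for every nonnegative integer $n$ with $\left(\frac{ -n}{\ell}\right)=-1$, \[ \overline{p}(4^k\cdot 5\ell^2 n)\equiv 0 \pmod{5}. \]
   Context: An overpartition of a nonnegative integer $n$ is a partition of $n$ in which the first occurrence of each distinct part may be overlined. $\overline{p}(n)$ denotes the number of overpartitions of $n$, with $\overline{p}(0)=1$; equivalently $\sum_{n\ge0}\overline{p}(n)q^n=\prod_{k\ge1}\frac{1+q^k}{1-q^k}$. $\left(\frac{\cdot}{\ell}\right)$ is the Legendre symbol. -}

module Defs where

open import Data.Bool using (Bool; true; false)
open import Data.Fin using (Fin; toℕ)
open import Data.Fin.Properties using (any?)
open import Data.Integer as ℤ using (ℤ; +_; -1ℤ; 0ℤ; 1ℤ)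
open import Data.Integer.Divisibility.Signed using () renaming (_∣_ to _∣ℤ_; _∣?_ to _∣ℤ?_)
open import Data.List using (List; []; _∷_; [_]; map; concatMap; filter; length)
open import Data.List.Membership.Propositional using (_∈_; lose; find)
open import Data.List.Membership.Propositional.Properties
  using (∈-concatMap⁺; ∈-concatMap⁻; ∈-filter⁺; ∈-filter⁻)
open import Data.List.Relation.Unary.All as All using (All; []; _∷_)
open import Data.List.Relation.Unary.Any using (here; there)
open import Data.List.Relation.Unary.Linked using (Linked; linked?)
open import Data.List.Relation.Unary.Unique.Propositional using (Unique; []; _∷_)
import Data.List.Relation.Unary.Unique.Propositional.Properties as Unique
open import Data.Nat using (ℕ; zero; suc; _+_; _<_; _≤_; s≤s; z≤n; _<?_; _≤?_)
open import Data.Nat.ListAction using (sum)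
open import Data.Nat.Properties using (suc-injective)
open import Data.Product using (∃-syntax; _×_; _,_)
open import Function.Bundles using (_⇔_; mk⇔)
open import Relation.Binary.Definitions using () renaming (Decidable to Decidable₂)
open import Relation.Binary.PropositionalEquality using (_≡_; refl; sym; trans; cong)
open import Relation.Nullary using (Dec; yes; no)

------------------------------------------------------------------------
-- Overpartitions

record Part : Set where
  constructor part
  field
    size      : ℕ
    overlined : Bool
open Part public

-- `p ▷ q`: q may directly follow p.  Sizes are weakly decreasing, and an
-- overlined part must be the first of its size, hence strictly smaller than
-- its predecessor.
_▷_ : Part → Part → Set
p ▷ part b false = b ≤ size p
p ▷ part b true  = b < size p

_▷?_ : Decidable₂ _▷_
p ▷? part b false = b ≤? size p
p ▷? part b true  = b <? size p

record IsOverpartition (n : ℕ) (ps : List Part) : Set where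
  constructor isOverpartition
  field
    positive : All (λ p → 0 < size p) ps
    total    : sum (map size ps) ≡ n
    ordered  : Linked _▷_ ps

-- Adds 1 to the total, either by enlarging the first part or by prepending a
-- new part of size 1.
grow : List Part → List (List Part)
grow []                = (part 1 false ∷ []) ∷ (part 1 true ∷ []) ∷ []
grow (part a b ∷ ps) =
  (part 1 false ∷ part a b ∷ ps) ∷ (part 1 true ∷ part a b ∷ ps) ∷
  (part (suc a) b ∷ ps) ∷ []

-- All sequences of positive, possibly overlined parts with sum n, in any order.
compositions : ℕ → List (List Part)
compositions zero    = [ [] ]
compositions (suc n) = concatMap grow (compositions n)

overpartitions : ℕ → List (List Part)
overpartitions n = filter (linked? _▷?_) (compositions n)

-- The lemmas `∈-overpartitions` and `overpartitions-unique` below show that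
-- this counts each overpartition of n exactly once.
p̄ : ℕ → ℕ
p̄ n = length (overpartitions n)

------------------------------------------------------------------------
-- Correctness of the enumeration

Composition : ℕ → List Part → Set
Composition n ps = All (λ p → 0 < size p) ps × sum (map size ps) ≡ n

grow-sound : ∀ {n} ps {qs} → Composition n ps → qs ∈ grow ps → Composition (suc n) qs
grow-sound []       (pos , eq) (here refl)         = s≤s z≤n ∷ pos , cong suc eq
grow-sound []       (pos , eq) (there (here refl)) = s≤s z≤n ∷ pos , cong suc eq
grow-sound (_ ∷ _)  (pos , eq) (here refl)         = s≤s z≤n ∷ pos , cong suc eq
grow-sound (_ ∷ _)  (pos , eq) (there (here refl)) = s≤s z≤n ∷ pos , cong suc eq
grow-sound (_ ∷ _)  (_ ∷ pos , eq) (there (there (here refl))) =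
  s≤s z≤n ∷ pos , cong suc eq

grow-complete : ∀ {n} qs → Composition (suc n) qs →
                ∃[ ps ] Composition n ps × qs ∈ grow ps
grow-complete (part zero          _ ∷ _) (() ∷ _ , _)
grow-complete (part (suc zero) false ∷ [])     (_ ∷ pos , eq) = _ , (pos , suc-injective eq) , here refl
grow-complete (part (suc zero) true  ∷ [])     (_ ∷ pos , eq) = _ , (pos , suc-injective eq) , there (here refl)
grow-complete (part (suc zero) false ∷ _ ∷ _)  (_ ∷ pos , eq) = _ , (pos , suc-injective eq) , here refl
grow-complete (part (suc zero) true  ∷ _ ∷ _)  (_ ∷ pos , eq) = _ , (pos , suc-injective eq) , there (here refl)
grow-complete (part (suc (suc a)) b ∷ qs) (_ ∷ pos , eq) =
  part (suc a) b ∷ qs , (s≤s z≤n ∷ pos , suc-injective eq) , there (there (here refl))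

compositions-sound : ∀ n {qs} → qs ∈ compositions n → Composition n qs
compositions-sound zero    (here refl) = [] , refl
compositions-sound (suc n) qs∈
  with ps , ps∈ , qs∈′ ← find (∈-concatMap⁻ grow {xs = compositions n} qs∈)
  = grow-sound ps (compositions-sound n ps∈) qs∈′

compositions-complete : ∀ n {qs} → Composition n qs → qs ∈ compositions n
compositions-complete zero    {[]}               _             = here refl
compositions-complete zero    {part zero _ ∷ _}    (() ∷ _ , _)
compositions-complete zero    {part (suc _) _ ∷ _} (_ , ())
compositions-complete (suc n) {qs} c
  with ps , c′ , qs∈ ← grow-complete qs c
  = ∈-concatMap⁺ grow (lose (compositions-complete n c′) qs∈)

shrink : List Part → List Part
shrink (part (suc (suc a)) b ∷ ps) = part (suc a) b ∷ ps
shrink (_                    ∷ ps) = ps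
shrink []                          = []

shrink-grow : ∀ {n} ps {qs} → Composition n ps → qs ∈ grow ps → shrink qs ≡ ps
shrink-grow []      _ (here refl)         = refl
shrink-grow []      _ (there (here refl)) = refl
shrink-grow (_ ∷ _) _ (here refl)         = refl
shrink-grow (_ ∷ _) _ (there (here refl)) = refl
shrink-grow (part zero    _ ∷ _) (() ∷ _ , _) _
shrink-grow (part (suc _) _ ∷ _) _ (there (there (here refl))) = refl

grow-unique : ∀ {n} ps → Composition n ps → Unique (grow ps)
grow-unique [] _ = ((λ ()) ∷ []) ∷ [] ∷ []
grow-unique (part zero    _ ∷ _) (() ∷ _ , _)
grow-unique (part (suc _) _ ∷ _) _ =
  ((λ ()) ∷ (λ ()) ∷ []) ∷ ((λ ()) ∷ []) ∷ [] ∷ []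

concatMap-grow-unique : ∀ {n} pss → All (Composition n) pss → Unique pss →
                        Unique (concatMap grow pss)
concatMap-grow-unique []         _        _         = []
concatMap-grow-unique (ps ∷ pss) (c ∷ cs) (ps∉ ∷ u) =
  Unique.++⁺ (grow-unique ps c) (concatMap-grow-unique pss cs u) disjoint
  where
  disjoint : ∀ {qs} → qs ∈ grow ps × qs ∈ concatMap grow pss → _
  disjoint (qs∈ , qs∈′)
    with ps′ , ps′∈ , qs∈″ ← find (∈-concatMap⁻ grow {xs = pss} qs∈′)
    = All.lookup ps∉ ps′∈
        (trans (sym (shrink-grow ps c qs∈)) (shrink-grow ps′ (All.lookup cs ps′∈) qs∈″))

compositions-unique : ∀ n → Unique (compositions n)
compositions-unique zero    = [] ∷ []
compositions-unique (suc n) =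
  concatMap-grow-unique (compositions n)
    (All.tabulate (compositions-sound n)) (compositions-unique n)

∈-overpartitions : ∀ n {ps} → ps ∈ overpartitions n ⇔ IsOverpartition n ps
∈-overpartitions n = mk⇔ to from
  where
  to : ∀ {ps} → ps ∈ overpartitions n → IsOverpartition n ps
  to ps∈ with c∈ , ord ← ∈-filter⁻ (linked? _▷?_) {xs = compositions n} ps∈
         with pos , eq ← compositions-sound n c∈ = isOverpartition pos eq ord
  from : ∀ {ps} → IsOverpartition n ps → ps ∈ overpartitions n
  from (isOverpartition pos eq ord) =
    ∈-filter⁺ (linked? _▷?_) (compositions-complete n (pos , eq)) ord

overpartitions-unique : ∀ n → Unique (overpartitions n)
overpartitions-unique n = Unique.filter⁺ (linked? _▷?_) (compositions-unique n)

------------------------------------------------------------------------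
-- Legendre symbol

IsSquareMod : ℕ → ℤ → Set
IsSquareMod ℓ a = ∃[ x ] + ℓ ∣ℤ (+ toℕ {ℓ} x ℤ.* + toℕ x ℤ.- a)

isSquareMod? : ∀ ℓ a → Dec (IsSquareMod ℓ a)
isSquareMod? ℓ a = any? λ x → + ℓ ∣ℤ? (+ toℕ x ℤ.* + toℕ x ℤ.- a)

-- Meaningful for an odd prime ℓ.
legendre : ℤ → ℕ → ℤ
legendre a ℓ with + ℓ ∣ℤ? a | isSquareMod? ℓ a
... | yes _ | _     = 0ℤ
... | no  _ | yes _ = 1ℤ
... | no  _ | no  _ = -1ℤ

{-# OPTIONS --safe #-}
-- Let φ(q) = ∑ q^(j²) and P(q) = ∑ p̄(n) qⁿ.  Gauss's identity P(q) φ(-q) = 1 and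
-- φ(-q)⁵ ≡ φ(-q⁵) give P(q) φ(-q⁵) ≡ φ(-q)⁴ modulo 5.  Since r₄(5n) ≡ r₄(n), extracting
-- the exponents divisible by 5 yields p̄(5n) ≡ (-1)ⁿ r₃(n) modulo 5.  It remains to see
-- that r₃(4n) = r₃(n) and that r₃(ℓ²n) = (ℓ + 2) r₃(n) when -n is not a square modulo ℓ.
--
-- The facts on r₃ and r₄ come from the Lipschitz quaternions.  By Lagrange's descent each
-- α with ℓ ∣ N(α) and ℓ ∤ α admits exactly 8 elements β of norm ℓ with ᾱβ ≡ 0 modulo ℓ.
-- Counting pairs against the ℓ + 1 isotropic lines of a left ideal modulo ℓ gives
-- r₄(ℓ) = 8 (ℓ + 1).  Counting pairs (β , y) with y of norm ℓn gives r₄(ℓn) ≡ r₄(n) modulo ℓ,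
-- and counting pairs with y = β x β̄ pure of norm ℓ²n gives the relation for r₃: such a y is
-- never divisible by ℓ, as β would then be an eigenvector of y/ℓ, whose square is -n.
module Submission where

open import Defs
open import Algebra.Bundles using (CommutativeRing)
open import Algebra.Solver.Ring.AlmostCommutativeRing using (AlmostCommutativeRing; fromCommutativeRing; _-Raw-AlmostCommutative⟶_)
open import Data.Bool using (true; false)
open import Data.Empty using (⊥)
open import Data.Fin as Fin using (Fin; toℕ; fromℕ<; splitAt)
import Data.Fin.Properties as Fin
open import Data.Integer as ℤ using (ℤ; +_; -[1+_]; 0ℤ; 1ℤ)
import Data.Integer.Base as ℤ-ops
import Data.Integer.DivMod as ℤ
open import Data.Integer.Divisibility.Signed as ℤ∣ using () renaming (_∣_ to _∣ℤ_; _∣?_ to _∣ℤ?_)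
import Data.Integer.Properties as ℤ
open import Data.Integer.Tactic.RingSolver using (solve-∀)
open import Algebra.Properties.AbelianGroup ℤ.+-0-abelianGroup using () renaming (∙-cancelˡ to +-cancelˡ)
open import Data.List using (List; []; _∷_; map; filter; length; cartesianProduct; upTo; _++_)
open import Data.List.Membership.Propositional using (_∈_)
open import Data.List.Membership.Propositional.Properties
  using (∈-map⁺; ∈-map⁻; ∈-++⁺ˡ; ∈-++⁺ʳ; ∈-++⁻; ∈-cartesianProduct⁺; ∈-cartesianProduct⁻; ∈-filter⁺; ∈-filter⁻; ∈-upTo⁺; ∈-upTo⁻)
open import Data.List.Membership.Propositional.Properties.WithK using (unique∧set⇒bag)
open import Data.List.Properties using (length-map; length-++; length-upTo; filter-all; filter-none)
open import Data.List.Relation.Binary.BagAndSetEquality using (∼bag⇒↭)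
open import Data.List.Relation.Binary.Permutation.Propositional.Properties using (↭-length)
open import Data.List.Relation.Unary.All as All using ([]; _∷_)
open import Data.List.Relation.Unary.Any using (here; there)
open import Data.List.Relation.Unary.Linked using (Linked; []; [-]; _∷_)
open import Data.List.Relation.Unary.Unique.Propositional using (Unique; []; _∷_)
import Data.List.Relation.Unary.Unique.Propositional.Properties as Unique
open import Data.Maybe using (Maybe; just; nothing)
open import Data.Nat as ℕ using (ℕ; zero; suc; _≤_; _<_; NonZero; z≤n; s≤s)
open import Data.Nat.Coprimality using (Coprime; coprime-Bézout)
open import Data.Nat.DivMod using (%-distribˡ-+)
import Data.Nat.Divisibility as ℕ∣
open import Data.Nat.GCD using (module Bézout)
open import Data.Nat.Induction using (<-rec)
open import Data.Nat.ListAction using (sum)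
open import Data.Nat.Primality using (Prime; euclidsLemma; prime[2]; prime?; prime⇒irreducible; prime⇒nonTrivial; prime⇒nonZero)
import Data.Nat.Properties as ℕ
import Data.Nat.Tactic.RingSolver as ℕ-solver
open import Data.Product using (∃-syntax; ∃₂; _×_; _,_; proj₁; proj₂)
open import Data.Sum as Sum using (_⊎_; inj₁; inj₂; [_,_]′)
open import Data.Unit using (⊤; tt)
open import Function using (_∘_; id)
open import Function.Bundles using (mk⇔; Equivalence)
open import Level using (0ℓ)
open import Relation.Binary.Definitions using () renaming (Decidable to Decidable₂)
open import Relation.Binary.PropositionalEquality
import Relation.Binary.Reasoning.Setoid as SetoidReasoning
open import Relation.Nullary using (Dec; yes; no; ¬_; contradiction; ¬?; _×-dec_)
open import Relation.Nullary.Decidable using (map′; toWitness)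
open import Relation.Unary using (Decidable)

-- Lipschitz quaternions

-- Quaternions are taken with integer coordinates so that `r₄` and `r₃` count elements and pure
-- elements of a given norm directly. The price is an order that is not Euclidean: for an even
-- modulus a centred remainder may have full norm. At an odd prime ℓ this does no harm. Even
-- multiples are halved with 1 + i, 1 + j or 1 + k, so the descent only divides by odd numbers, and
-- modulo ℓ the ring is that of 2 × 2 matrices, where a nonzero element of norm 0 has rank one. The
-- matrix model is never built; the nondegenerate trace form replaces it. The relation for `r₃` is
-- the case (-n/ℓ) = -1 of r₃(ℓ²n) = (ℓ + 1 - (-n/ℓ)) r₃(n) - ℓ r₃(n/ℓ²). The factor ℓ + 2 is
-- divisible by 5 precisely for ℓ ≡ 3 modulo 5. Infinite products are avoided: Gauss's identity is
-- obtained as the limit of a polynomial-times-series identity for overpartitions with bounded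
-- parts. Series are compared modulo 5 throughout, which suffices for the conclusion and makes fifth
-- powers additive.

record ℍ : Set where
  constructor ⟨_,_,_,_⟩
  field
    re im₁ im₂ im₃ : ℤ

≡-ℍ : ∀ {a a′ b b′ c c′ d d′ : ℤ} → a ≡ a′ → b ≡ b′ → c ≡ c′ → d ≡ d′ →
      ⟨ a , b , c , d ⟩ ≡ ⟨ a′ , b′ , c′ , d′ ⟩
≡-ℍ refl refl refl refl = refl

infixl 6 _+ₕ_
infixl 7 _*ₕ_
infixr 7 _·_

opaque

  _+ₕ_ : ℍ → ℍ → ℍ
  ⟨ a , b , c , d ⟩ +ₕ ⟨ e , f , g , h ⟩ = ⟨ a ℤ.+ e , b ℤ.+ f , c ℤ.+ g , d ℤ.+ h ⟩

  _*ₕ_ : ℍ → ℍ → ℍ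
  ⟨ a , b , c , d ⟩ *ₕ ⟨ e , f , g , h ⟩ = ⟨
    a ℤ.* e ℤ.- b ℤ.* f ℤ.- c ℤ.* g ℤ.- d ℤ.* h ,
    a ℤ.* f ℤ.+ b ℤ.* e ℤ.+ c ℤ.* h ℤ.- d ℤ.* g ,
    a ℤ.* g ℤ.- b ℤ.* h ℤ.+ c ℤ.* e ℤ.+ d ℤ.* f ,
    a ℤ.* h ℤ.+ b ℤ.* g ℤ.- c ℤ.* f ℤ.+ d ℤ.* e ⟩

  _·_ : ℤ → ℍ → ℍ
  m · ⟨ a , b , c , d ⟩ = ⟨ m ℤ.* a , m ℤ.* b , m ℤ.* c , m ℤ.* d ⟩

  conj : ℍ → ℍ
  conj ⟨ a , b , c , d ⟩ = ⟨ a , ℤ.- b , ℤ.- c , ℤ.- d ⟩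

  N : ℍ → ℤ
  N ⟨ a , b , c , d ⟩ = a ℤ.* a ℤ.+ b ℤ.* b ℤ.+ c ℤ.* c ℤ.+ d ℤ.* d

  tr : ℍ → ℤ
  tr ⟨ a , _ , _ , _ ⟩ = a ℤ.+ a

  1ₕ : ℍ
  1ₕ = ⟨ 1ℤ , 0ℤ , 0ℤ , 0ℤ ⟩

  +ₕ-assoc : ∀ x y z → (x +ₕ y) +ₕ z ≡ x +ₕ (y +ₕ z)
  +ₕ-assoc ⟨ a , b , c , d ⟩ ⟨ e , f , g , h ⟩ ⟨ i , j , k , l ⟩ =
    ≡-ℍ (ℤ.+-assoc a e i) (ℤ.+-assoc b f j) (ℤ.+-assoc c g k) (ℤ.+-assoc d h l)

  +ₕ-comm : ∀ x y → x +ₕ y ≡ y +ₕ x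
  +ₕ-comm ⟨ a , b , c , d ⟩ ⟨ e , f , g , h ⟩ =
    ≡-ℍ (ℤ.+-comm a e) (ℤ.+-comm b f) (ℤ.+-comm c g) (ℤ.+-comm d h)

  *ₕ-identityʳ : ∀ x → x *ₕ 1ₕ ≡ x
  *ₕ-identityʳ ⟨ a , b , c , d ⟩ = ≡-ℍ (c₀ a b c d) (c₁ a b c d) (c₂ a b c d) (c₃ a b c d)
    where
    open ℤ-ops using (_+_; _*_; _-_; -_; -1ℤ)
    c₀ : ∀ a b c d → a * 1ℤ - b * 0ℤ - c * 0ℤ - d * 0ℤ ≡ a
    c₀ = solve-∀
    c₁ : ∀ a b c d → a * 0ℤ + b * 1ℤ + c * 0ℤ - d * 0ℤ ≡ b
    c₁ = solve-∀
    c₂ : ∀ a b c d → a * 0ℤ - b * 0ℤ + c * 1ℤ + d * 0ℤ ≡ c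
    c₂ = solve-∀
    c₃ : ∀ a b c d → a * 0ℤ + b * 0ℤ - c * 0ℤ + d * 1ℤ ≡ d
    c₃ = solve-∀

  *ₕ-assoc : ∀ x y z → (x *ₕ y) *ₕ z ≡ x *ₕ (y *ₕ z)
  *ₕ-assoc ⟨ a , b , c , d ⟩ ⟨ e , f , g , h ⟩ ⟨ x , y , z , w ⟩ = ≡-ℍ
    (c₀ a b c d e f g h x y z w) (c₁ a b c d e f g h x y z w)
    (c₂ a b c d e f g h x y z w) (c₃ a b c d e f g h x y z w)
    where
    open ℤ-ops using (_+_; _*_; _-_; -_; -1ℤ)
    c₀ : ∀ a b c d e f g h x y z w →
      (a * e - b * f - c * g - d * h) * x - (a * f + b * e + c * h - d * g) * y
        - (a * g - b * h + c * e + d * f) * z - (a * h + b * g - c * f + d * e) * w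
      ≡ a * (e * x - f * y - g * z - h * w) - b * (e * y + f * x + g * w - h * z)
        - c * (e * z - f * w + g * x + h * y) - d * (e * w + f * z - g * y + h * x)
    c₀ = solve-∀
    c₁ : ∀ a b c d e f g h x y z w →
      (a * e - b * f - c * g - d * h) * y + (a * f + b * e + c * h - d * g) * x
        + (a * g - b * h + c * e + d * f) * w - (a * h + b * g - c * f + d * e) * z
      ≡ a * (e * y + f * x + g * w - h * z) + b * (e * x - f * y - g * z - h * w)
        + c * (e * w + f * z - g * y + h * x) - d * (e * z - f * w + g * x + h * y)
    c₁ = solve-∀
    c₂ : ∀ a b c d e f g h x y z w →
      (a * e - b * f - c * g - d * h) * z - (a * f + b * e + c * h - d * g) * w
        + (a * g - b * h + c * e + d * f) * x + (a * h + b * g - c * f + d * e) * y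
      ≡ a * (e * z - f * w + g * x + h * y) - b * (e * w + f * z - g * y + h * x)
        + c * (e * x - f * y - g * z - h * w) + d * (e * y + f * x + g * w - h * z)
    c₂ = solve-∀
    c₃ : ∀ a b c d e f g h x y z w →
      (a * e - b * f - c * g - d * h) * w + (a * f + b * e + c * h - d * g) * z
        - (a * g - b * h + c * e + d * f) * y + (a * h + b * g - c * f + d * e) * x
      ≡ a * (e * w + f * z - g * y + h * x) + b * (e * z - f * w + g * x + h * y)
        - c * (e * y + f * x + g * w - h * z) + d * (e * x - f * y - g * z - h * w)
    c₃ = solve-∀

  N-* : ∀ x y → N (x *ₕ y) ≡ N x ℤ.* N y
  N-* ⟨ a , b , c , d ⟩ ⟨ e , f , g , h ⟩ = lem a b c d e f g h
    where
    open ℤ-ops using (_+_; _*_; _-_; -_; -1ℤ)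
    lem : ∀ a b c d e f g h →
      (a * e - b * f - c * g - d * h) * (a * e - b * f - c * g - d * h)
      + (a * f + b * e + c * h - d * g) * (a * f + b * e + c * h - d * g)
      + (a * g - b * h + c * e + d * f) * (a * g - b * h + c * e + d * f)
      + (a * h + b * g - c * f + d * e) * (a * h + b * g - c * f + d * e)
      ≡ (a * a + b * b + c * c + d * d) * (e * e + f * f + g * g + h * h)
    lem = solve-∀

  N-conj : ∀ x → N (conj x) ≡ N x
  N-conj ⟨ a , b , c , d ⟩ = lem a b c d
    where
    open ℤ-ops using (_+_; _*_; _-_; -_; -1ℤ)
    lem : ∀ a b c d → a * a + (- b) * (- b) + (- c) * (- c) + (- d) * (- d)
                      ≡ a * a + b * b + c * c + d * d
    lem = solve-∀

  N-· : ∀ m x → N (m · x) ≡ m ℤ.* m ℤ.* N x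
  N-· m ⟨ a , b , c , d ⟩ = lem m a b c d
    where
    open ℤ-ops using (_+_; _*_; _-_; -_; -1ℤ)
    lem : ∀ m a b c d → (m * a) * (m * a) + (m * b) * (m * b) + (m * c) * (m * c) + (m * d) * (m * d)
                        ≡ m * m * (a * a + b * b + c * c + d * d)
    lem = solve-∀

  conj-* : ∀ x y → conj (x *ₕ y) ≡ conj y *ₕ conj x
  conj-* ⟨ a , b , c , d ⟩ ⟨ e , f , g , h ⟩ = ≡-ℍ
    (c₀ a b c d e f g h) (c₁ a b c d e f g h) (c₂ a b c d e f g h) (c₃ a b c d e f g h)
    where
    open ℤ-ops using (_+_; _*_; _-_; -_; -1ℤ)
    c₀ : ∀ a b c d e f g h → a * e - b * f - c * g - d * h
       ≡ e * a - (- f) * (- b) - (- g) * (- c) - (- h) * (- d)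
    c₀ = solve-∀
    c₁ : ∀ a b c d e f g h → - (a * f + b * e + c * h - d * g)
       ≡ e * (- b) + (- f) * a + (- g) * (- d) - (- h) * (- c)
    c₁ = solve-∀
    c₂ : ∀ a b c d e f g h → - (a * g - b * h + c * e + d * f)
       ≡ e * (- c) - (- f) * (- d) + (- g) * a + (- h) * (- b)
    c₂ = solve-∀
    c₃ : ∀ a b c d e f g h → - (a * h + b * g - c * f + d * e)
       ≡ e * (- d) + (- f) * (- c) - (- g) * (- b) + (- h) * a
    c₃ = solve-∀

  conj-involutive : ∀ x → conj (conj x) ≡ x
  conj-involutive ⟨ a , b , c , d ⟩ =
    ≡-ℍ refl (ℤ.neg-involutive b) (ℤ.neg-involutive c) (ℤ.neg-involutive d)

  conj-+ : ∀ x y → conj (x +ₕ y) ≡ conj x +ₕ conj y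
  conj-+ ⟨ a , b , c , d ⟩ ⟨ e , f , g , h ⟩ =
    ≡-ℍ refl (ℤ.neg-distrib-+ b f) (ℤ.neg-distrib-+ c g) (ℤ.neg-distrib-+ d h)

  conj-· : ∀ m x → conj (m · x) ≡ m · conj x
  conj-· m ⟨ a , b , c , d ⟩ =
    ≡-ℍ refl (ℤ.neg-distribʳ-* m b) (ℤ.neg-distribʳ-* m c) (ℤ.neg-distribʳ-* m d)

  conj-*ˡ : ∀ x y → conj x *ₕ (x *ₕ y) ≡ N x · y
  conj-*ˡ ⟨ a , b , c , d ⟩ ⟨ e , f , g , h ⟩ = ≡-ℍ
    (c₀ a b c d e f g h) (c₁ a b c d e f g h) (c₂ a b c d e f g h) (c₃ a b c d e f g h)
    where
    open ℤ-ops using (_+_; _*_; _-_; -_; -1ℤ)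
    c₀ : ∀ a b c d e f g h →
      a * (a * e - b * f - c * g - d * h) - (- b) * (a * f + b * e + c * h - d * g)
        - (- c) * (a * g - b * h + c * e + d * f) - (- d) * (a * h + b * g - c * f + d * e)
      ≡ (a * a + b * b + c * c + d * d) * e
    c₀ = solve-∀
    c₁ : ∀ a b c d e f g h →
      a * (a * f + b * e + c * h - d * g) + (- b) * (a * e - b * f - c * g - d * h)
        + (- c) * (a * h + b * g - c * f + d * e) - (- d) * (a * g - b * h + c * e + d * f)
      ≡ (a * a + b * b + c * c + d * d) * f
    c₁ = solve-∀
    c₂ : ∀ a b c d e f g h →
      a * (a * g - b * h + c * e + d * f) - (- b) * (a * h + b * g - c * f + d * e)
        + (- c) * (a * e - b * f - c * g - d * h) + (- d) * (a * f + b * e + c * h - d * g)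
      ≡ (a * a + b * b + c * c + d * d) * g
    c₂ = solve-∀
    c₃ : ∀ a b c d e f g h →
      a * (a * h + b * g - c * f + d * e) + (- b) * (a * g - b * h + c * e + d * f)
        - (- c) * (a * f + b * e + c * h - d * g) + (- d) * (a * e - b * f - c * g - d * h)
      ≡ (a * a + b * b + c * c + d * d) * h
    c₃ = solve-∀

  *-conjˡ : ∀ x y → x *ₕ (conj x *ₕ y) ≡ N x · y
  *-conjˡ x y = begin
    x *ₕ (conj x *ₕ y)               ≡⟨ cong (_*ₕ (conj x *ₕ y)) (conj-involutive x) ⟨
    conj (conj x) *ₕ (conj x *ₕ y)   ≡⟨ conj-*ˡ (conj x) y ⟩
    N (conj x) · y                   ≡⟨ cong (_· y) (N-conj x) ⟩
    N x · y                          ∎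
    where open ≡-Reasoning

  *-conjʳ : ∀ x y → (x *ₕ y) *ₕ conj y ≡ N y · x
  *-conjʳ x y = begin
    (x *ₕ y) *ₕ conj y                 ≡⟨ conj-involutive _ ⟨
    conj (conj ((x *ₕ y) *ₕ conj y))   ≡⟨ cong conj (conj-* (x *ₕ y) (conj y)) ⟩
    conj (conj (conj y) *ₕ conj (x *ₕ y))
      ≡⟨ cong conj (cong₂ _*ₕ_ (conj-involutive y) (conj-* x y)) ⟩
    conj (y *ₕ (conj y *ₕ conj x))     ≡⟨ cong conj (*-conjˡ y (conj x)) ⟩
    conj (N y · conj x)                ≡⟨ conj-· (N y) (conj x) ⟩
    N y · conj (conj x)                ≡⟨ cong (N y ·_) (conj-involutive x) ⟩
    N y · x                            ∎
    where open ≡-Reasoning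

  conj-*ʳ : ∀ x y → (x *ₕ conj y) *ₕ y ≡ N y · x
  conj-*ʳ x y = begin
    (x *ₕ conj y) *ₕ y               ≡⟨ cong ((x *ₕ conj y) *ₕ_) (conj-involutive y) ⟨
    (x *ₕ conj y) *ₕ conj (conj y)   ≡⟨ *-conjʳ x (conj y) ⟩
    N (conj y) · x                   ≡⟨ cong (_· x) (N-conj y) ⟩
    N y · x                          ∎
    where open ≡-Reasoning

  *-distribʳ : ∀ x y z → (x +ₕ y) *ₕ z ≡ x *ₕ z +ₕ y *ₕ z
  *-distribʳ ⟨ a , b , c , d ⟩ ⟨ e , f , g , h ⟩ ⟨ x , y , z , w ⟩ = ≡-ℍ
    (c₀ a b c d e f g h x y z w) (c₁ a b c d e f g h x y z w)
    (c₂ a b c d e f g h x y z w) (c₃ a b c d e f g h x y z w)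
    where
    open ℤ-ops using (_+_; _*_; _-_; -_; -1ℤ)
    c₀ : ∀ a b c d e f g h x y z w →
      (a + e) * x - (b + f) * y - (c + g) * z - (d + h) * w
      ≡ a * x - b * y - c * z - d * w + (e * x - f * y - g * z - h * w)
    c₀ = solve-∀
    c₁ : ∀ a b c d e f g h x y z w →
      (a + e) * y + (b + f) * x + (c + g) * w - (d + h) * z
      ≡ a * y + b * x + c * w - d * z + (e * y + f * x + g * w - h * z)
    c₁ = solve-∀
    c₂ : ∀ a b c d e f g h x y z w →
      (a + e) * z - (b + f) * w + (c + g) * x + (d + h) * y
      ≡ a * z - b * w + c * x + d * y + (e * z - f * w + g * x + h * y)
    c₂ = solve-∀
    c₃ : ∀ a b c d e f g h x y z w →
      (a + e) * w + (b + f) * z - (c + g) * y + (d + h) * x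
      ≡ a * w + b * z - c * y + d * x + (e * w + f * z - g * y + h * x)
    c₃ = solve-∀

  ·-*ˡ : ∀ m x y → (m · x) *ₕ y ≡ m · (x *ₕ y)
  ·-*ˡ m ⟨ a , b , c , d ⟩ ⟨ e , f , g , h ⟩ = ≡-ℍ
    (c₀ m a b c d e f g h) (c₁ m a b c d e f g h) (c₂ m a b c d e f g h) (c₃ m a b c d e f g h)
    where
    open ℤ-ops using (_+_; _*_; _-_; -_; -1ℤ)
    c₀ : ∀ m a b c d e f g h → m * a * e - m * b * f - m * c * g - m * d * h
         ≡ m * (a * e - b * f - c * g - d * h)
    c₀ = solve-∀
    c₁ : ∀ m a b c d e f g h → m * a * f + m * b * e + m * c * h - m * d * g
         ≡ m * (a * f + b * e + c * h - d * g)
    c₁ = solve-∀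
    c₂ : ∀ m a b c d e f g h → m * a * g - m * b * h + m * c * e + m * d * f
         ≡ m * (a * g - b * h + c * e + d * f)
    c₂ = solve-∀
    c₃ : ∀ m a b c d e f g h → m * a * h + m * b * g - m * c * f + m * d * e
         ≡ m * (a * h + b * g - c * f + d * e)
    c₃ = solve-∀

  ·-*ʳ : ∀ m x y → x *ₕ (m · y) ≡ m · (x *ₕ y)
  ·-*ʳ m x y = begin
    x *ₕ (m · y)                  ≡⟨ conj-involutive _ ⟨
    conj (conj (x *ₕ (m · y)))    ≡⟨ cong conj (conj-* x (m · y)) ⟩
    conj (conj (m · y) *ₕ conj x) ≡⟨ cong (λ z → conj (z *ₕ conj x)) (conj-· m y) ⟩
    conj ((m · conj y) *ₕ conj x) ≡⟨ cong conj (·-*ˡ m (conj y) (conj x)) ⟩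
    conj (m · (conj y *ₕ conj x)) ≡⟨ conj-· m _ ⟩
    m · conj (conj y *ₕ conj x)   ≡⟨ cong (λ z → m · conj z) (conj-* x y) ⟨
    m · conj (conj (x *ₕ y))      ≡⟨ cong (m ·_) (conj-involutive _) ⟩
    m · (x *ₕ y)                  ∎
    where open ≡-Reasoning

  ·-assoc : ∀ m n x → m · (n · x) ≡ (m ℤ.* n) · x
  ·-assoc m n ⟨ a , b , c , d ⟩ = sym
    (≡-ℍ (ℤ.*-assoc m n a) (ℤ.*-assoc m n b) (ℤ.*-assoc m n c) (ℤ.*-assoc m n d))

  ·-distribʳ : ∀ m n x → (m ℤ.+ n) · x ≡ m · x +ₕ n · x
  ·-distribʳ m n ⟨ a , b , c , d ⟩ = ≡-ℍ
    (ℤ.*-distribʳ-+ a m n) (ℤ.*-distribʳ-+ b m n) (ℤ.*-distribʳ-+ c m n) (ℤ.*-distribʳ-+ d m n)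

  ·-distribˡ : ∀ m x y → m · (x +ₕ y) ≡ m · x +ₕ m · y
  ·-distribˡ m ⟨ a , b , c , d ⟩ ⟨ e , f , g , h ⟩ = ≡-ℍ
    (ℤ.*-distribˡ-+ m a e) (ℤ.*-distribˡ-+ m b f) (ℤ.*-distribˡ-+ m c g) (ℤ.*-distribˡ-+ m d h)

  ·-comm : ∀ m n x → m · (n · x) ≡ n · (m · x)
  ·-comm m n x = trans (·-assoc m n x) (trans (cong (_· x) (ℤ.*-comm m n)) (sym (·-assoc n m x)))

  ·-cancelˡ : ∀ m .{{_ : ℤ.NonZero m}} x y → m · x ≡ m · y → x ≡ y
  ·-cancelˡ m ⟨ a , b , c , d ⟩ ⟨ e , f , g , h ⟩ eq = ≡-ℍ
    (ℤ.*-cancelˡ-≡ m a e (cong (λ { ⟨ z , _ , _ , _ ⟩ → z }) eq))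
    (ℤ.*-cancelˡ-≡ m b f (cong (λ { ⟨ _ , z , _ , _ ⟩ → z }) eq))
    (ℤ.*-cancelˡ-≡ m c g (cong (λ { ⟨ _ , _ , z , _ ⟩ → z }) eq))
    (ℤ.*-cancelˡ-≡ m d h (cong (λ { ⟨ _ , _ , _ , z ⟩ → z }) eq))

  -- `tr z` acts as `z +ₕ conj z`, and `conj` reverses products. When `conj x *ₕ y` vanishes modulo
  -- a prime the second summand drops out, so a scalar multiple of `y` lies in the right ideal of
  -- `x`; `pivot` supplies a `δ` for which that scalar is invertible.
  trace-identity : ∀ x δ y → tr (x *ₕ δ) · y ≡ x *ₕ (δ *ₕ y) +ₕ conj δ *ₕ (conj x *ₕ y)
  trace-identity x δ y = begin
    tr (x *ₕ δ) · y                                  ≡⟨ lem (x *ₕ δ) y ⟩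
    (x *ₕ δ) *ₕ y +ₕ conj (x *ₕ δ) *ₕ y
      ≡⟨ cong (λ z → (x *ₕ δ) *ₕ y +ₕ z *ₕ y) (conj-* x δ) ⟩
    (x *ₕ δ) *ₕ y +ₕ (conj δ *ₕ conj x) *ₕ y
      ≡⟨ cong₂ _+ₕ_ (*ₕ-assoc x δ y) (*ₕ-assoc (conj δ) (conj x) y) ⟩
    x *ₕ (δ *ₕ y) +ₕ conj δ *ₕ (conj x *ₕ y)         ∎
    where
    open ≡-Reasoning
    open ℤ-ops using (_+_; _*_; _-_; -_; -1ℤ)
    c₀ : ∀ a b c d e f g h → (a + a) * e
      ≡ a * e - b * f - c * g - d * h + (a * e - (- b) * f - (- c) * g - (- d) * h)
    c₀ = solve-∀
    c₁ : ∀ a b c d e f g h → (a + a) * f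
      ≡ a * f + b * e + c * h - d * g + (a * f + (- b) * e + (- c) * h - (- d) * g)
    c₁ = solve-∀
    c₂ : ∀ a b c d e f g h → (a + a) * g
      ≡ a * g - b * h + c * e + d * f + (a * g - (- b) * h + (- c) * e + (- d) * f)
    c₂ = solve-∀
    c₃ : ∀ a b c d e f g h → (a + a) * h
      ≡ a * h + b * g - c * f + d * e + (a * h + (- b) * g - (- c) * f + (- d) * e)
    c₃ = solve-∀
    lem : ∀ x y → tr x · y ≡ x *ₕ y +ₕ conj x *ₕ y
    lem ⟨ a , b , c , d ⟩ ⟨ e , f , g , h ⟩ = ≡-ℍ
      (c₀ a b c d e f g h) (c₁ a b c d e f g h) (c₂ a b c d e f g h) (c₃ a b c d e f g h)

  tr-comm : ∀ x y → tr (x *ₕ y) ≡ tr (y *ₕ x)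
  tr-comm ⟨ a , b , c , d ⟩ ⟨ e , f , g , h ⟩ = lem a b c d e f g h
    where
    open ℤ-ops using (_+_; _*_; _-_; -_; -1ℤ)
    lem : ∀ a b c d e f g h →
      a * e - b * f - c * g - d * h + (a * e - b * f - c * g - d * h)
      ≡ e * a - f * b - g * c - h * d + (e * a - f * b - g * c - h * d)
    lem = solve-∀

conj-*-self : ∀ x → conj x *ₕ x ≡ N x · 1ₕ
conj-*-self x = trans (cong (conj x *ₕ_) (sym (*ₕ-identityʳ x))) (conj-*ˡ x 1ₕ)

*-conj-self : ∀ x → x *ₕ conj x ≡ N x · 1ₕ
*-conj-self x = trans (cong (x *ₕ_) (sym (*ₕ-identityʳ (conj x)))) (*-conjˡ x 1ₕ)

-- Divisibility and congruence of quaternions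

infix 4 _∣ₕ_ _∣ₕ?_

record _∣ₕ_ (m : ℤ) (x : ℍ) : Set where
  constructor divides
  field
    quotient : ℍ
    equality : x ≡ m · quotient

opaque
  unfolding _·_

  ∣ₕ-components : ∀ {m a b c d} → m ∣ℤ a → m ∣ℤ b → m ∣ℤ c → m ∣ℤ d → m ∣ₕ ⟨ a , b , c , d ⟩
  ∣ₕ-components {m} (ℤ∣.divides p a) (ℤ∣.divides q b) (ℤ∣.divides r c) (ℤ∣.divides s d) =
    divides ⟨ p , q , r , s ⟩
      (≡-ℍ (trans a (ℤ.*-comm p m)) (trans b (ℤ.*-comm q m))
           (trans c (ℤ.*-comm r m)) (trans d (ℤ.*-comm s m)))

  ∣ₕ-components⁻ : ∀ {m a b c d} → m ∣ₕ ⟨ a , b , c , d ⟩ → m ∣ℤ a × m ∣ℤ b × m ∣ℤ c × m ∣ℤ d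
  ∣ₕ-components⁻ {m} (divides ⟨ p , q , r , s ⟩ refl) = go p , go q , go r , go s
    where
    go : ∀ a → m ∣ℤ m ℤ.* a
    go a = ℤ∣.divides a (ℤ.*-comm m a)

  _∣ₕ?_ : ∀ m x → Dec (m ∣ₕ x)
  m ∣ₕ? ⟨ a , b , c , d ⟩ =
    map′ (λ (p , q , r , s) → ∣ₕ-components p q r s) ∣ₕ-components⁻
      ((m ∣ℤ? a) ×-dec (m ∣ℤ? b) ×-dec (m ∣ℤ? c) ×-dec (m ∣ℤ? d))

module _ {m : ℤ} where

  ∣ₕ-multiple : ∀ y → m ∣ₕ m · y
  ∣ₕ-multiple y = divides y refl

  ∣ₕ-+ : ∀ {x y} → m ∣ₕ x → m ∣ₕ y → m ∣ₕ x +ₕ y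
  ∣ₕ-+ (divides x refl) (divides y refl) = divides (x +ₕ y) (sym (·-distribˡ m x y))

  ∣ₕ-· : ∀ n {x} → m ∣ₕ x → m ∣ₕ n · x
  ∣ₕ-· n (divides x refl) = divides (n · x) (·-comm n m x)

  ∣ₕ-scalar : ∀ {n} x → m ∣ℤ n → m ∣ₕ n · x
  ∣ₕ-scalar x (ℤ∣.divides q refl) =
    divides (q · x) (trans (cong (_· x) (ℤ.*-comm q m)) (sym (·-assoc m q x)))

  ∣ₕ-*ˡ : ∀ x {y} → m ∣ₕ y → m ∣ₕ x *ₕ y
  ∣ₕ-*ˡ x (divides y refl) = divides (x *ₕ y) (·-*ʳ m x y)

  ∣ₕ-*ʳ : ∀ {x} y → m ∣ₕ x → m ∣ₕ x *ₕ y
  ∣ₕ-*ʳ y (divides x refl) = divides (x *ₕ y) (·-*ˡ m x y)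

  ∣ₕ-conj : ∀ {x} → m ∣ₕ x → m ∣ₕ conj x
  ∣ₕ-conj (divides x refl) = divides (conj x) (conj-· m x)

module Congruence (m : ℤ) where

  infix 4 _≋_

  record _≋_ (x y : ℍ) : Set where
    constructor congruent
    field
      quotient : ℍ
      equality : x ≡ y +ₕ m · quotient

  opaque
    unfolding _·_

    ·-inverse : ∀ n x y → (x +ₕ n · y) +ₕ n · (ℤ.-1ℤ · y) ≡ x
    ·-inverse n ⟨ a , b , c , d ⟩ ⟨ e , f , g , h ⟩ = ≡-ℍ (lem n a e) (lem n b f) (lem n c g) (lem n d h)
      where
      open ℤ-ops using (_+_; _*_; _-_; -_; -1ℤ)
      lem : ∀ n a e → a + n * e + n * (-1ℤ * e) ≡ a
      lem = solve-∀

    ·-zero : ∀ n x y → x +ₕ n · (0ℤ · y) ≡ x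
    ·-zero n ⟨ a , b , c , d ⟩ ⟨ e , f , g , h ⟩ = ≡-ℍ (lem n a e) (lem n b f) (lem n c g) (lem n d h)
      where
      open ℤ-ops using (_+_; _*_; _-_; -_; -1ℤ)
      lem : ∀ n a e → a + n * (0ℤ * e) ≡ a
      lem = solve-∀

  +ₕ-≋ : ∀ x {y} → m ∣ₕ y → x +ₕ y ≋ x
  +ₕ-≋ x (divides q refl) = congruent q refl

  ≋-reflexive : ∀ {x y} → x ≡ y → x ≋ y
  ≋-reflexive {x} refl = congruent (0ℤ · x) (sym (·-zero m x x))

  ≋-sym : ∀ {x y} → x ≋ y → y ≋ x
  ≋-sym {y = y} (congruent k refl) = congruent (ℤ.-1ℤ · k) (sym (·-inverse m y k))

  ≋-trans : ∀ {x y z} → x ≋ y → y ≋ z → x ≋ z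
  ≋-trans {z = z} (congruent k refl) (congruent l refl) = congruent (l +ₕ k)
    (trans (+ₕ-assoc z (m · l) (m · k)) (cong (z +ₕ_) (sym (·-distribˡ m l k))))

  ∣ₕ-resp-≋ : ∀ {x y} → y ≋ x → m ∣ₕ x → m ∣ₕ y
  ∣ₕ-resp-≋ (congruent k refl) m∣x = ∣ₕ-+ m∣x (∣ₕ-multiple k)

  +-congʳ : ∀ {x y} z → x ≋ y → x +ₕ z ≋ y +ₕ z
  +-congʳ {y = y} z (congruent k refl) = congruent k
    (trans (+ₕ-assoc y (m · k) z) (trans (cong (y +ₕ_) (+ₕ-comm (m · k) z)) (sym (+ₕ-assoc y z (m · k)))))

  ·-cong : ∀ n {x y} → x ≋ y → n · x ≋ n · y
  ·-cong n {y = y} (congruent k refl) = congruent (n · k)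
    (trans (·-distribˡ n y (m · k)) (cong (n · y +ₕ_) (·-comm n m k)))

  *ₕ-congʳ : ∀ {x y} z → x ≋ y → x *ₕ z ≋ y *ₕ z
  *ₕ-congʳ {y = y} z (congruent k refl) = congruent (k *ₕ z)
    (trans (*-distribʳ y (m · k) z) (cong (y *ₕ z +ₕ_) (·-*ˡ m k z)))

  conj-cong : ∀ {x y} → x ≋ y → conj x ≋ conj y
  conj-cong {y = y} (congruent k refl) = congruent (conj k)
    (trans (conj-+ y (m · k)) (cong (conj y +ₕ_) (conj-· m k)))

  *ₕ-congˡ : ∀ x {y z} → y ≋ z → x *ₕ y ≋ x *ₕ z
  *ₕ-congˡ x {y} {z} y≋z = subst₂ _≋_ (eq y) (eq z) (conj-cong (*ₕ-congʳ (conj x) (conj-cong y≋z)))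
    where
    eq : ∀ y → conj (conj y *ₕ conj x) ≡ x *ₕ y
    eq y = trans (cong conj (sym (conj-* x y))) (conj-involutive (x *ₕ y))

  opaque
    unfolding _·_

    N-cong : ∀ {x y} → x ≋ y → ∃[ t ] N x ≡ N y ℤ.+ m ℤ.* t
    N-cong {y = ⟨ a , b , c , d ⟩} (congruent ⟨ e , f , g , h ⟩ refl) = _ , lem m a b c d e f g h
      where
      open ℤ-ops using (_+_; _*_; _-_; -_; -1ℤ)
      lem : ∀ m a b c d e f g h →
        (a + m * e) * (a + m * e) + (b + m * f) * (b + m * f)
        + (c + m * g) * (c + m * g) + (d + m * h) * (d + m * h)
        ≡ (a * a + b * b + c * c + d * d)
          + m * (e * (a + (a + m * e)) + f * (b + (b + m * f))
                 + g * (c + (c + m * g)) + h * (d + (d + m * h)))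
      lem = solve-∀

-- Quaternions modulo an odd prime

euclidsLemmaℤ : ∀ {p} → Prime p → ∀ a b → + p ∣ℤ a ℤ.* b → + p ∣ℤ a ⊎ + p ∣ℤ b
euclidsLemmaℤ {p} pr a b p∣ab = Sum.map ℤ∣.∣ᵤ⇒∣ ℤ∣.∣ᵤ⇒∣
  (euclidsLemma ℤ.∣ a ∣ ℤ.∣ b ∣ pr (subst (p ℕ∣.∣_) (ℤ.abs-* a b) (ℤ∣.∣⇒∣ᵤ p∣ab)))

module ModPrime {p : ℕ} (pr : Prime p) (odd : p ≢ 2) where

  P : ℤ
  P = + p

  open Congruence P public

  ∣-split : ∀ a b → P ∣ℤ a ℤ.* b → P ∣ℤ a ⊎ P ∣ℤ b
  ∣-split = euclidsLemmaℤ pr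

  ∤-< : ∀ {n} → 0 < n → n < p → ¬ P ∣ℤ + n
  ∤-< {suc n} _ n<p p∣n = ℕ∣.>⇒∤ n<p (ℤ∣.∣⇒∣ᵤ p∣n)

  2<p : 2 < p
  2<p = ℕ.≤∧≢⇒< (ℕ.nonTrivial⇒n>1 p {{prime⇒nonTrivial pr}}) (odd ∘ sym)

  instance
    nonZero-p : NonZero p
    nonZero-p = ℕ.>-nonZero (ℕ.<-trans (s≤s z≤n) 2<p)
    nonZero-P : ℤ.NonZero P
    nonZero-P = nonZero-p

  ∤-double : ∀ {a} → ¬ P ∣ℤ a → ¬ P ∣ℤ a ℤ.+ a
  ∤-double {a} p∤a p∣2a with ∣-split (+ 2) a (subst (P ∣ℤ_) (lem a) p∣2a)
    where
    open ℤ-ops using (_+_; _*_; _-_; -_; -1ℤ; ∣_∣)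
    lem : ∀ a → a + a ≡ + 2 * a
    lem = solve-∀
  ... | inj₁ p∣2 = ∤-< (s≤s z≤n) 2<p p∣2
  ... | inj₂ p∣a = p∤a p∣a

  ∣-cancel : ∀ {t} → ¬ P ∣ℤ t → ∀ a → P ∣ℤ t ℤ.* a → P ∣ℤ a
  ∣-cancel {t} p∤t a p∣ta with ∣-split t a p∣ta
  ... | inj₁ p∣t = contradiction p∣t p∤t
  ... | inj₂ p∣a = p∣a

  opaque
    unfolding _·_

    ∣ₕ-cancel : ∀ {t} → ¬ P ∣ℤ t → ∀ x → P ∣ₕ t · x → P ∣ₕ x
    ∣ₕ-cancel p∤t ⟨ a , b , c , d ⟩ p∣tx with p , q , r , s ← ∣ₕ-components⁻ p∣tx =
      ∣ₕ-components (∣-cancel p∤t a p) (∣-cancel p∤t b q) (∣-cancel p∤t c r) (∣-cancel p∤t d s)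

    -- The trace form (x , δ) ↦ tr (x *ₕ δ) is nondegenerate modulo p.
    pivot : ∀ x → ¬ P ∣ₕ x → ∃[ δ ] ¬ P ∣ℤ tr (x *ₕ δ)
    pivot ⟨ a , b , c , d ⟩ p∤x with P ∣ℤ? a | P ∣ℤ? b | P ∣ℤ? c | P ∣ℤ? d
    ... | no p∤a | _ | _ | _ = ⟨ 1ℤ , 0ℤ , 0ℤ , 0ℤ ⟩ , ∤-double p∤a ∘ subst (λ z → P ∣ℤ z ℤ.+ z) (lem a b c d)
      where
      open ℤ-ops using (_+_; _*_; _-_; -_; -1ℤ; ∣_∣)
      lem : ∀ a b c d → a * 1ℤ - b * 0ℤ - c * 0ℤ - d * 0ℤ ≡ a
      lem = solve-∀
    ... | yes _ | no p∤b | _ | _ = ⟨ 0ℤ , ℤ.-1ℤ , 0ℤ , 0ℤ ⟩ , ∤-double p∤b ∘ subst (λ z → P ∣ℤ z ℤ.+ z) (lem a b c d)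
      where
      open ℤ-ops using (_+_; _*_; _-_; -_; -1ℤ; ∣_∣)
      lem : ∀ a b c d → a * 0ℤ - b * -1ℤ - c * 0ℤ - d * 0ℤ ≡ b
      lem = solve-∀
    ... | yes _ | yes _ | no p∤c | _ = ⟨ 0ℤ , 0ℤ , ℤ.-1ℤ , 0ℤ ⟩ , ∤-double p∤c ∘ subst (λ z → P ∣ℤ z ℤ.+ z) (lem a b c d)
      where
      open ℤ-ops using (_+_; _*_; _-_; -_; -1ℤ; ∣_∣)
      lem : ∀ a b c d → a * 0ℤ - b * 0ℤ - c * -1ℤ - d * 0ℤ ≡ c
      lem = solve-∀
    ... | yes _ | yes _ | yes _ | no p∤d = ⟨ 0ℤ , 0ℤ , 0ℤ , ℤ.-1ℤ ⟩ , ∤-double p∤d ∘ subst (λ z → P ∣ℤ z ℤ.+ z) (lem a b c d)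
      where
      open ℤ-ops using (_+_; _*_; _-_; -_; -1ℤ; ∣_∣)
      lem : ∀ a b c d → a * 0ℤ - b * 0ℤ - c * 0ℤ - d * -1ℤ ≡ d
      lem = solve-∀
    ... | yes p∣a | yes p∣b | yes p∣c | yes p∣d = contradiction (∣ₕ-components p∣a p∣b p∣c p∣d) p∤x

  -- Modulo `P`, `tr (α *ₕ δ) · β` equals `α *ₕ (δ *ₕ β)`. Up to an invertible scalar `conj β`
  -- therefore ends in the factor `conj α`, which annihilates `γ`. This is what makes two solutions
  -- of norm p for the same `α` differ by a unit only.
  annihilated-orthogonal : ∀ α β γ → ¬ P ∣ₕ α →
    P ∣ₕ conj α *ₕ β → P ∣ₕ conj α *ₕ γ → P ∣ₕ conj β *ₕ γ
  annihilated-orthogonal α β γ p∤α αβ αγ with δ , p∤t ← pivot α p∤α =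
    ∣ₕ-cancel p∤t _ (subst (P ∣ₕ_) eq (∣ₕ-+
      (∣ₕ-*ˡ (conj (δ *ₕ β)) αγ) (∣ₕ-*ʳ γ (∣ₕ-conj (∣ₕ-*ˡ (conj δ) αβ)))))
    where
    open ≡-Reasoning
    t = tr (α *ₕ δ)
    eq : conj (δ *ₕ β) *ₕ (conj α *ₕ γ) +ₕ conj (conj δ *ₕ (conj α *ₕ β)) *ₕ γ
         ≡ t · (conj β *ₕ γ)
    eq = begin
      conj (δ *ₕ β) *ₕ (conj α *ₕ γ) +ₕ conj (conj δ *ₕ (conj α *ₕ β)) *ₕ γ
        ≡⟨ cong (_+ₕ conj (conj δ *ₕ (conj α *ₕ β)) *ₕ γ) (*ₕ-assoc (conj (δ *ₕ β)) (conj α) γ) ⟨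
      (conj (δ *ₕ β) *ₕ conj α) *ₕ γ +ₕ conj (conj δ *ₕ (conj α *ₕ β)) *ₕ γ
        ≡⟨ *-distribʳ _ _ γ ⟨
      (conj (δ *ₕ β) *ₕ conj α +ₕ conj (conj δ *ₕ (conj α *ₕ β))) *ₕ γ
        ≡⟨ cong (λ z → (z +ₕ conj (conj δ *ₕ (conj α *ₕ β))) *ₕ γ) (conj-* α (δ *ₕ β)) ⟨
      (conj (α *ₕ (δ *ₕ β)) +ₕ conj (conj δ *ₕ (conj α *ₕ β))) *ₕ γ
        ≡⟨ cong (_*ₕ γ) (conj-+ (α *ₕ (δ *ₕ β)) _) ⟨
      conj (α *ₕ (δ *ₕ β) +ₕ conj δ *ₕ (conj α *ₕ β)) *ₕ γ
        ≡⟨ cong (λ z → conj z *ₕ γ) (trace-identity α δ β) ⟨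
      conj (t · β) *ₕ γ
        ≡⟨ cong (_*ₕ γ) (conj-· t β) ⟩
      (t · conj β) *ₕ γ
        ≡⟨ ·-*ˡ t (conj β) γ ⟩
      t · (conj β *ₕ γ) ∎

  -- Modulo p, ℍ is the ring of 2 × 2 matrices and x has rank at most one.
  rank-one : ∀ x z → P ∣ℤ N x → x *ₕ (z *ₕ x) ≋ tr (x *ₕ z) · x
  rank-one x z p∣Nx = ≋-sym (≋-trans (≋-reflexive (trace-identity x z x))
    (+ₕ-≋ _ (∣ₕ-*ˡ (conj z) (subst (P ∣ₕ_) (sym (conj-*-self x)) (∣ₕ-scalar 1ₕ p∣Nx)))))

  -- In 2 × 2 matrices modulo p, conj γ * ℍ * β is at most one-dimensional.
  sandwich : ∀ γ z β → P ∣ℤ N γ → P ∣ℤ N β → ¬ P ∣ₕ conj γ *ₕ β →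
    ∃₂ λ s t → ¬ P ∣ℤ t × t · (conj γ *ₕ (z *ₕ β)) ≋ s · (conj γ *ₕ β)
  sandwich γ z β p∣Nγ p∣Nβ p∤γβ with δ , p∤t ← pivot (conj γ *ₕ β) p∤γβ =
    -- `rank-one` for `β` replaces `t · β` by `β *ₕ ((δ *ₕ conj γ) *ₕ β)`, which brings a second
    -- `conj γ` into the product. `rank-one` for `conj γ` then contracts everything between the two
    -- copies to the scalar `s`.
    tr (conj γ *ₕ w) , tr (β *ₕ (δ *ₕ conj γ)) ,
    p∤t ∘ subst (P ∣ℤ_) tr-eq ,
    ≋-trans (≋-reflexive (sym (trans (cong (conj γ *ₕ_) (·-*ʳ _ z β)) (·-*ʳ _ (conj γ) (z *ₕ β)))))
    (≋-trans (*ₕ-congˡ (conj γ) (*ₕ-congˡ z (≋-sym (rank-one β (δ *ₕ conj γ) p∣Nβ))))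
    (≋-trans (≋-reflexive regroup)
    (≋-trans (*ₕ-congʳ β (rank-one (conj γ) w (subst (P ∣ℤ_) (sym (N-conj γ)) p∣Nγ)))
             (≋-reflexive (·-*ˡ _ (conj γ) β)))))
    where
    w = z *ₕ (β *ₕ δ)
    tr-eq : tr (β *ₕ (δ *ₕ conj γ)) ≡ tr ((conj γ *ₕ β) *ₕ δ)
    tr-eq = trans (cong tr (sym (*ₕ-assoc β δ (conj γ))))
              (trans (tr-comm (β *ₕ δ) (conj γ)) (cong tr (sym (*ₕ-assoc (conj γ) β δ))))
    regroup : conj γ *ₕ (z *ₕ (β *ₕ ((δ *ₕ conj γ) *ₕ β))) ≡ (conj γ *ₕ (w *ₕ conj γ)) *ₕ β
    regroup = begin
      conj γ *ₕ (z *ₕ (β *ₕ ((δ *ₕ conj γ) *ₕ β)))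
        ≡⟨ cong (λ u → conj γ *ₕ (z *ₕ (β *ₕ u))) (*ₕ-assoc δ (conj γ) β) ⟩
      conj γ *ₕ (z *ₕ (β *ₕ (δ *ₕ (conj γ *ₕ β))))
        ≡⟨ cong (λ u → conj γ *ₕ (z *ₕ u)) (*ₕ-assoc β δ (conj γ *ₕ β)) ⟨
      conj γ *ₕ (z *ₕ ((β *ₕ δ) *ₕ (conj γ *ₕ β)))
        ≡⟨ cong (conj γ *ₕ_) (*ₕ-assoc z (β *ₕ δ) (conj γ *ₕ β)) ⟨
      conj γ *ₕ (w *ₕ (conj γ *ₕ β))
        ≡⟨ cong (conj γ *ₕ_) (*ₕ-assoc w (conj γ) β) ⟨
      conj γ *ₕ ((w *ₕ conj γ) *ₕ β)
        ≡⟨ *ₕ-assoc (conj γ) (w *ₕ conj γ) β ⟨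
      (conj γ *ₕ (w *ₕ conj γ)) *ₕ β ∎
      where open ≡-Reasoning

  -- Modulo p, the right annihilator of conj β is β * ℍ.
  eigenvector : ∀ y β → P ∣ℤ N β → ¬ P ∣ₕ β → P ∣ₕ conj β *ₕ (y *ₕ β) →
    ∃₂ λ s t → ¬ P ∣ℤ t × t · (y *ₕ β) ≋ s · β
  eigenvector y β p∣Nβ p∤β p∣βyβ with δ , p∤t ← pivot β p∤β =
    tr (β *ₕ (δ *ₕ y)) , tr (β *ₕ δ) , p∤t ,
    ≋-trans (≋-reflexive (trace-identity β δ (y *ₕ β)))
    (≋-trans (+ₕ-≋ _ (∣ₕ-*ˡ (conj δ) p∣βyβ))
    (≋-trans (≋-reflexive (cong (β *ₕ_) (sym (*ₕ-assoc δ y β))))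
             (rank-one β (δ *ₕ y) p∣Nβ)))

-- Norms as natural numbers, halving and Lagrange's descent

sq : ℤ → ℕ
sq a = ℤ.∣ a ∣ ℕ.* ℤ.∣ a ∣

+-sq : ∀ a → + sq a ≡ a ℤ.* a
+-sq (+ n)       = ℤ.pos-* n n
+-sq (ℤ.-[1+ n ]) = refl

deg : ℍ → ℕ
deg ⟨ a , b , c , d ⟩ = sq a ℕ.+ (sq b ℕ.+ (sq c ℕ.+ sq d))

opaque
  unfolding N

  +-deg : ∀ x → + deg x ≡ N x
  +-deg ⟨ a , b , c , d ⟩ = trans
    (cong₂ ℤ._+_ (+-sq a) (cong₂ ℤ._+_ (+-sq b) (cong₂ ℤ._+_ (+-sq c) (+-sq d))))
    (lem (a ℤ.* a) (b ℤ.* b) (c ℤ.* c) (d ℤ.* d))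
    where
    open ℤ-ops using (_+_; _*_; _-_; -_; -1ℤ; ∣_∣)
    lem : ∀ a b c d → a + (b + (c + d)) ≡ a + b + c + d
    lem = solve-∀

  -- An even norm means an even coordinate sum, so the coordinates fall into two pairs with even
  -- sums. The coordinate paired with `a` decides whether `ε` is 1 + i, 1 + j or 1 + k. The quotient
  -- of `x *ₕ ε` by 2 then has half the norm of `x`, although `x` itself need not be divisible by 2.
  halve : ∀ x → + 2 ∣ℤ N x → ∃[ ε ] deg ε ≡ 2 × + 2 ∣ₕ x *ₕ ε
  halve ⟨ a , b , c , d ⟩ 2∣N = go (+ 2 ∣ℤ? a + b) (+ 2 ∣ℤ? a + c)
    where
    open ℤ-ops using (_+_; _*_; _-_; -_; -1ℤ; ∣_∣)
    square : ∀ a b c d → (a + b + c + d) * (a + b + c + d)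
      ≡ (a * a + b * b + c * c + d * d) + + 2 * (a * b + a * c + a * d + b * c + b * d + c * d)
    square = solve-∀
    2+ : ∀ u v → + 2 ∣ℤ u → + 2 ∣ℤ u + + 2 * v
    2+ u v 2∣u = ℤ∣.∣m∣n⇒∣m+n 2∣u (ℤ∣.∣m⇒∣m*n v ℤ∣.∣-refl)
    2∣s : + 2 ∣ℤ a + b + c + d
    2∣s = [ id , id ]′ (euclidsLemmaℤ prime[2] (a + b + c + d) (a + b + c + d)
      (subst (+ 2 ∣ℤ_) (sym (square a b c d)) (2+ _ _ 2∣N)))
    parity : ∀ u → ¬ + 2 ∣ℤ u → + 2 ∣ℤ u + 1ℤ
    parity u 2∤u with u ℤ.%ℕ 2 | ℤ.n%ℕd<d u 2 | ℤ.a≡a%ℕn+[a/ℕn]*n u 2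
    ... | 0 | _ | eq = contradiction (ℤ∣.divides (u ℤ./ℕ 2) (trans eq (ℤ.+-identityˡ _))) 2∤u
    ... | 1 | _ | eq = ℤ∣.divides (u ℤ./ℕ 2 + 1ℤ) (trans (cong (_+ 1ℤ) eq) (lem (u ℤ./ℕ 2)))
      where
      lem : ∀ q → + 1 + q * + 2 + 1ℤ ≡ (q + 1ℤ) * + 2
      lem = solve-∀
    ... | suc (suc _) | s≤s (s≤s ()) | _
    go : Dec (+ 2 ∣ℤ a + b) → Dec (+ 2 ∣ℤ a + c) →
         ∃[ ε ] deg ε ≡ 2 × + 2 ∣ₕ ⟨ a , b , c , d ⟩ *ₕ ε
    go (yes 2∣a+b) _ = ⟨ 1ℤ , 1ℤ , 0ℤ , 0ℤ ⟩ , refl ,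
      subst (+ 2 ∣ₕ_) (sym (≡-ℍ (e₀ a b c d) (e₁ a b c d) (e₂ a b c d) (e₃ a b c d)))
        (∣ₕ-components (2+ _ _ 2∣a+b) 2∣a+b (2+ _ _ 2∣c+d) (2+ _ _ 2∣c+d))
      where
      2∣c+d : + 2 ∣ℤ (a + b + c + d) + (a + b)
      2∣c+d = ℤ∣.∣m∣n⇒∣m+n 2∣s 2∣a+b
      e₀ : ∀ a b c d → a * 1ℤ - b * 1ℤ - c * 0ℤ - d * 0ℤ ≡ (a + b) + + 2 * (- b)
      e₀ = solve-∀
      e₁ : ∀ a b c d → a * 1ℤ + b * 1ℤ + c * 0ℤ - d * 0ℤ ≡ a + b
      e₁ = solve-∀
      e₂ : ∀ a b c d → a * 0ℤ - b * 0ℤ + c * 1ℤ + d * 1ℤ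
         ≡ (a + b + c + d + (a + b)) + + 2 * (- (a + b))
      e₂ = solve-∀
      e₃ : ∀ a b c d → a * 0ℤ + b * 0ℤ - c * 1ℤ + d * 1ℤ
         ≡ (a + b + c + d + (a + b)) + + 2 * (- (a + b + c))
      e₃ = solve-∀
    go (no _) (yes 2∣a+c) = ⟨ 1ℤ , 0ℤ , 1ℤ , 0ℤ ⟩ , refl ,
      subst (+ 2 ∣ₕ_) (sym (≡-ℍ (e₀ a b c d) (e₁ a b c d) (e₂ a b c d) (e₃ a b c d)))
        (∣ₕ-components (2+ _ _ 2∣a+c) (2+ _ _ 2∣b+d) 2∣a+c (2+ _ _ 2∣b+d))
      where
      2∣b+d : + 2 ∣ℤ (a + b + c + d) + (a + c)
      2∣b+d = ℤ∣.∣m∣n⇒∣m+n 2∣s 2∣a+c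
      e₀ : ∀ a b c d → a * 1ℤ - b * 0ℤ - c * 1ℤ - d * 0ℤ ≡ (a + c) + + 2 * (- c)
      e₀ = solve-∀
      e₁ : ∀ a b c d → a * 0ℤ + b * 1ℤ + c * 0ℤ - d * 1ℤ
         ≡ (a + b + c + d + (a + c)) + + 2 * (- (a + c + d))
      e₁ = solve-∀
      e₂ : ∀ a b c d → a * 1ℤ - b * 0ℤ + c * 1ℤ + d * 0ℤ ≡ a + c
      e₂ = solve-∀
      e₃ : ∀ a b c d → a * 0ℤ + b * 1ℤ - c * 0ℤ + d * 1ℤ
         ≡ (a + b + c + d + (a + c)) + + 2 * (- (a + c))
      e₃ = solve-∀
    go (no 2∤a+b) (no 2∤a+c) = ⟨ 1ℤ , 0ℤ , 0ℤ , 1ℤ ⟩ , refl ,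
      subst (+ 2 ∣ₕ_) (sym (≡-ℍ (e₀ a b c d) (e₁ a b c d) (e₂ a b c d) (e₃ a b c d)))
        (∣ₕ-components (2+ _ _ 2∣a+d) (2+ _ _ 2∣b+c) (2+ _ _ 2∣b+c) (2+ _ _ 2∣a+d))
      where
      2∣b+c : + 2 ∣ℤ (a + b + 1ℤ) + (a + c + 1ℤ)
      2∣b+c = ℤ∣.∣m∣n⇒∣m+n (parity (a + b) 2∤a+b) (parity (a + c) 2∤a+c)
      2∣a+d : + 2 ∣ℤ (a + b + 1ℤ) + (a + c + 1ℤ) + (a + b + c + d)
      2∣a+d = ℤ∣.∣m∣n⇒∣m+n 2∣b+c 2∣s
      e₀ : ∀ a b c d → a * 1ℤ - b * 0ℤ - c * 0ℤ - d * 1ℤ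
         ≡ (a + b + 1ℤ) + (a + c + 1ℤ) + (a + b + c + d) + + 2 * (- a - d - b - c - 1ℤ)
      e₀ = solve-∀
      e₁ : ∀ a b c d → a * 0ℤ + b * 1ℤ + c * 1ℤ - d * 0ℤ
         ≡ (a + b + 1ℤ) + (a + c + 1ℤ) + + 2 * (- a - 1ℤ)
      e₁ = solve-∀
      e₂ : ∀ a b c d → a * 0ℤ - b * 1ℤ + c * 1ℤ + d * 0ℤ
         ≡ (a + b + 1ℤ) + (a + c + 1ℤ) + + 2 * (- a - b - 1ℤ)
      e₂ = solve-∀
      e₃ : ∀ a b c d → a * 1ℤ + b * 0ℤ - c * 0ℤ + d * 1ℤ
         ≡ (a + b + 1ℤ) + (a + c + 1ℤ) + (a + b + c + d) + + 2 * (- a - b - c - 1ℤ)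
      e₃ = solve-∀

deg-* : ∀ x y → deg (x *ₕ y) ≡ deg x ℕ.* deg y
deg-* x y = ℤ.+-injective (begin
  + deg (x *ₕ y)       ≡⟨ +-deg (x *ₕ y) ⟩
  N (x *ₕ y)           ≡⟨ N-* x y ⟩
  N x ℤ.* N y          ≡⟨ cong₂ ℤ._*_ (+-deg x) (+-deg y) ⟨
  + deg x ℤ.* + deg y  ≡⟨ ℤ.pos-* (deg x) (deg y) ⟨
  + (deg x ℕ.* deg y)  ∎)
  where open ≡-Reasoning

deg-conj : ∀ x → deg (conj x) ≡ deg x
deg-conj x = ℤ.+-injective (trans (+-deg (conj x)) (trans (N-conj x) (sym (+-deg x))))

deg-· : ∀ m x → deg (+ m · x) ≡ m ℕ.* m ℕ.* deg x
deg-· m x = ℤ.+-injective (begin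
  + deg (+ m · x)              ≡⟨ +-deg (+ m · x) ⟩
  N (+ m · x)                  ≡⟨ N-· (+ m) x ⟩
  + m ℤ.* + m ℤ.* N x          ≡⟨ cong₂ ℤ._*_ (ℤ.pos-* m m) (+-deg x) ⟨
  + (m ℕ.* m) ℤ.* + deg x      ≡⟨ ℤ.pos-* (m ℕ.* m) (deg x) ⟨
  + (m ℕ.* m ℕ.* deg x)        ∎)
  where open ≡-Reasoning

∣N⇒∣deg : ∀ {m} x → + m ∣ℤ N x → m ℕ∣.∣ deg x
∣N⇒∣deg x = ℤ∣.∣⇒∣ᵤ ∘ subst (_ ∣ℤ_) (sym (+-deg x))

∣deg⇒∣N : ∀ {m} x → m ℕ∣.∣ deg x → + m ∣ℤ N x
∣deg⇒∣N x = subst (_ ∣ℤ_) (+-deg x) ∘ ℤ∣.∣ᵤ⇒∣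

deg≡0⇒∣ : ∀ m x → deg x ≡ 0 → m ∣ₕ x
deg≡0⇒∣ m ⟨ a , b , c , d ⟩ eq = ∣ₕ-components (go a ea) (go b eb) (go c ec) (go d ed)
  where
  ea = ℕ.m+n≡0⇒m≡0 (sq a) eq
  e₁ = ℕ.m+n≡0⇒n≡0 (sq a) eq
  eb = ℕ.m+n≡0⇒m≡0 (sq b) e₁
  e₂ = ℕ.m+n≡0⇒n≡0 (sq b) e₁
  ec = ℕ.m+n≡0⇒m≡0 (sq c) e₂
  ed = ℕ.m+n≡0⇒n≡0 (sq c) e₂
  go : ∀ a → sq a ≡ 0 → m ∣ℤ a
  go a eq = subst (m ∣ℤ_) (sym (ℤ.∣i∣≡0⇒i≡0 ([ id , id ]′ (ℕ.m*n≡0⇒m≡0∨n≡0 ℤ.∣ a ∣ eq))))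
              (ℤ∣.divides 0ℤ refl)

parity : ∀ n → ∃[ h ] (n ≡ 2 ℕ.* h ⊎ n ≡ suc (2 ℕ.* h))
parity zero    = 0 , inj₁ refl
parity (suc n) with parity n
... | h , inj₁ refl = h , inj₂ refl
... | h , inj₂ refl = suc h , inj₁ (lem h)
  where
  lem : ∀ h → suc (suc (2 ℕ.* h)) ≡ 2 ℕ.* suc h
  lem = ℕ-solver.solve-∀

centre : ∀ h a → ∃₂ λ r k → ℤ.∣ r ∣ ≤ h × a ≡ r ℤ.+ + suc (2 ℕ.* h) ℤ.* k
centre h a = go {q = a ℤ./ℕ m} (ℤ.n%ℕd<d a m) (ℤ.a≡a%ℕn+[a/ℕn]*n a m)
  where
  open ℤ-ops using (_+_; _*_; _-_; -_; -1ℤ; ∣_∣)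
  m : ℕ
  m = suc (2 ℕ.* h)
  m∸suc[h]≡h : m ℕ.∸ suc h ≡ h
  m∸suc[h]≡h = trans (cong (ℕ._∸ h) (cong (h ℕ.+_) (ℕ.+-identityʳ h))) (ℕ.m+n∸m≡n h h)
  shift : ∀ s r q → r + q * (s + r) ≡ - s + (s + r) * (q + 1ℤ)
  shift = solve-∀
  go : ∀ {r q} → r < m → a ≡ + r + q * + m → ∃₂ λ r k → ∣ r ∣ ≤ h × a ≡ r + + m * k
  go {r} {q} r<m eq with r ℕ.≤? h
  ... | yes r≤h = + r , q , r≤h , trans eq (cong (λ z → + r + z) (ℤ.*-comm q (+ m)))
  ... | no  r≰h = - + (m ℕ.∸ r) , q + 1ℤ ,
    subst (_≤ h) (sym (ℤ.∣-i∣≡∣i∣ (+ (m ℕ.∸ r))))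
      (ℕ.≤-trans (ℕ.∸-monoʳ-≤ m (ℕ.≰⇒> r≰h)) (ℕ.≤-reflexive m∸suc[h]≡h)) ,
    trans eq (subst (λ m′ → + r + q * + m′ ≡ - + (m ℕ.∸ r) + + m′ * (q + 1ℤ))
      (ℕ.m∸n+n≡m (ℕ.<⇒≤ r<m)) (shift (+ (m ℕ.∸ r)) (+ r) q))

opaque
  unfolding _·_

  centreₕ : ∀ h x → ∃[ y ] deg y ≤ 4 ℕ.* (h ℕ.* h) × Congruence._≋_ (+ suc (2 ℕ.* h)) x y
  centreₕ h ⟨ a , b , c , d ⟩
    with e , k , |e| , ea ← centre h a | f , l , |f| , eb ← centre h b
       | g , m , |g| , ec ← centre h c | i , n , |i| , ed ← centre h d =
    ⟨ e , f , g , i ⟩ ,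
    ℕ.≤-trans (ℕ.+-mono-≤ (ℕ.*-mono-≤ |e| |e|) (ℕ.+-mono-≤ (ℕ.*-mono-≤ |f| |f|)
                (ℕ.+-mono-≤ (ℕ.*-mono-≤ |g| |g|) (ℕ.*-mono-≤ |i| |i|))))
              (ℕ.≤-reflexive (lem (h ℕ.* h))) ,
    Congruence.congruent ⟨ k , l , m , n ⟩ (≡-ℍ ea eb ec ed)
    where
    lem : ∀ s → s ℕ.+ (s ℕ.+ (s ℕ.+ s)) ≡ 4 ℕ.* s
    lem = ℕ-solver.solve-∀

-- The strictness is the point: for an even modulus 2h the remainders are bounded by h as well, the
-- norm can reach the square of the modulus, and the descent would stall. Hence the separate
-- treatment of even multiples.
4h²<m² : ∀ h → 4 ℕ.* (h ℕ.* h) < suc (2 ℕ.* h) ℕ.* suc (2 ℕ.* h)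
4h²<m² h = ℕ.≤-trans (s≤s (ℕ.m≤m+n _ (4 ℕ.* h))) (ℕ.≤-reflexive (lem h))
  where
  lem : ∀ h → suc (4 ℕ.* (h ℕ.* h) ℕ.+ 4 ℕ.* h) ≡ suc (2 ℕ.* h) ℕ.* suc (2 ℕ.* h)
  lem = ℕ-solver.solve-∀

∣-≋-N : ∀ {m} x y → Congruence._≋_ (+ m) x y → + m ∣ℤ N y → + m ∣ℤ N x
∣-≋-N {m} x y x≋y m∣Ny with t , eq ← Congruence.N-cong (+ m) x≋y =
  subst (+ m ∣ℤ_) (sym eq) (ℤ∣.∣m∣n⇒∣m+n m∣Ny (ℤ∣.∣m⇒∣m*n t ℤ∣.∣-refl))

module _ {p : ℕ} (pr : Prime p) (odd : p ≢ 2) where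

  open ModPrime pr odd

  -- Lagrange's descent for sums of four squares, carried out inside the
  -- right ideal of all β with p ∣ conj α * β.
  private
    Descent : ℍ → ℕ → Set
    Descent α m = ∀ β → deg β ≡ m ℕ.* p → 0 < m → m < p → P ∣ₕ conj α *ₕ β →
                  ∃[ β′ ] deg β′ ≡ p × P ∣ₕ conj α *ₕ β′

    -- The descent stays inside the ideal attached to `α` because the number `m` divided out is
    -- prime to p.
    quotient-annihilated : ∀ α β γ q {m} → 0 < m → m < p → P ∣ₕ conj α *ₕ β →
      β *ₕ γ ≡ + m · q → P ∣ₕ conj α *ₕ q
    quotient-annihilated α β γ q {m} 0<m m<p αβ eq = ∣ₕ-cancel (∤-< 0<m m<p) _
      (subst (P ∣ₕ_) (trans (*ₕ-assoc (conj α) β γ) (trans (cong (conj α *ₕ_) eq) (·-*ʳ (+ m) (conj α) q)))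
        (∣ₕ-*ʳ γ αβ))

    2*-swap : ∀ h n → 2 ℕ.* h ℕ.* n ≡ h ℕ.* n ℕ.* 2
    2*-swap = ℕ-solver.solve-∀

    even-step : ∀ α h → (∀ {k} → k < 2 ℕ.* h → Descent α k) → Descent α (2 ℕ.* h)
    even-step α (suc h) rec β deg-β 0<m m<p αβ
      with ε , deg-ε , divides q βε≡2q ← halve β (∣deg⇒∣N β (ℕ∣.divides (suc h ℕ.* p)
             (trans deg-β (2*-swap (suc h) p)))) =
      rec h<2h q deg-q (s≤s z≤n) (ℕ.<-trans h<2h m<p)
        (quotient-annihilated α β ε q (s≤s z≤n) 2<p αβ βε≡2q)
      where
      h<2h : suc h < 2 ℕ.* suc h
      h<2h = ℕ.m<m+n (suc h) (s≤s z≤n)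
      deg-q : deg q ≡ suc h ℕ.* p
      deg-q = ℕ.*-cancelˡ-≡ _ _ 4 (begin
        4 ℕ.* deg q                    ≡⟨ deg-· 2 q ⟨
        deg (+ 2 · q)                  ≡⟨ cong deg βε≡2q ⟨
        deg (β *ₕ ε)                   ≡⟨ deg-* β ε ⟩
        deg β ℕ.* deg ε                ≡⟨ cong₂ ℕ._*_ deg-β deg-ε ⟩
        2 ℕ.* suc h ℕ.* p ℕ.* 2        ≡⟨ lem₄ (suc h) p ⟩
        4 ℕ.* (suc h ℕ.* p)            ∎)
        where
        open ≡-Reasoning
        lem₄ : ∀ h p → 2 ℕ.* h ℕ.* p ℕ.* 2 ≡ 4 ℕ.* (h ℕ.* p)
        lem₄ = ℕ-solver.solve-∀

    -- With m = 2h + 1 and `y` the centred remainder of `β`, the norm of `y` is r m with r < m, and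
    -- `β *ₕ conj y` is congruent to `β *ₕ conj β`, hence divisible by m. The quotient has norm r p.
    -- The multiplier m = 1 ends the descent.
    odd-step : ∀ α h → (∀ {k} → k < suc (2 ℕ.* h) → Descent α k) → Descent α (suc (2 ℕ.* h))
    odd-step α zero     rec β deg-β 0<m m<p αβ = β , trans deg-β (ℕ.+-identityʳ p) , αβ
    odd-step α h@(suc _) rec β deg-β 0<m m<p αβ
      with y , y-small , β≋y ← centreₕ h β
      with ℕ∣.divides r deg-y ← ∣N⇒∣deg y (∣-≋-N y β (Congruence.≋-sym (+ suc (2 ℕ.* h)) β≋y)
             (∣deg⇒∣N β (ℕ∣.divides p (trans deg-β (ℕ.*-comm (suc (2 ℕ.* h)) p)))))
      with divides q βȳ≡mq ← Congruence.∣ₕ-resp-≋ (+ suc (2 ℕ.* h))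
             (Congruence.*ₕ-congˡ (+ suc (2 ℕ.* h)) β
               (Congruence.conj-cong (+ suc (2 ℕ.* h)) (Congruence.≋-sym (+ suc (2 ℕ.* h)) β≋y)))
             (subst (+ suc (2 ℕ.* h) ∣ₕ_) (sym (*-conj-self β)) (∣ₕ-scalar 1ₕ
               (∣deg⇒∣N β (ℕ∣.divides p (trans deg-β (ℕ.*-comm (suc (2 ℕ.* h)) p)))))) =
      rec r<m q deg-q 0<r (ℕ.<-trans r<m m<p)
        (quotient-annihilated α β (conj y) q 0<m m<p αβ βȳ≡mq)
      where
      open ≡-Reasoning
      m = suc (2 ℕ.* h)
      r<m : r < m
      r<m = ℕ.*-cancelʳ-< m r m (subst (_< m ℕ.* m) deg-y (ℕ.≤-<-trans y-small (4h²<m² h)))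
      deg-q : deg q ≡ r ℕ.* p
      deg-q = ℕ.*-cancelˡ-≡ _ _ (m ℕ.* m) (begin
        m ℕ.* m ℕ.* deg q              ≡⟨ deg-· m q ⟨
        deg (+ m · q)                  ≡⟨ cong deg βȳ≡mq ⟨
        deg (β *ₕ conj y)              ≡⟨ deg-* β (conj y) ⟩
        deg β ℕ.* deg (conj y)         ≡⟨ cong₂ ℕ._*_ deg-β (trans (deg-conj y) deg-y) ⟩
        m ℕ.* p ℕ.* (r ℕ.* m)          ≡⟨ lem m p r ⟩
        m ℕ.* m ℕ.* (r ℕ.* p)          ∎)
        where
        lem : ∀ m p r → m ℕ.* p ℕ.* (r ℕ.* m) ≡ m ℕ.* m ℕ.* (r ℕ.* p)
        lem = ℕ-solver.solve-∀
      r≢0 : r ≢ 0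
      -- A vanishing remainder would make `β` a multiple of m, so m² would divide m p and m would
      -- divide p, which 1 < m < p excludes.
      r≢0 refl with divides z β≡mz ← Congruence.∣ₕ-resp-≋ (+ m) β≋y (deg≡0⇒∣ (+ m) y deg-y)
        with prime⇒irreducible pr {m} (ℕ∣.divides (deg z) (ℕ.*-cancelˡ-≡ _ _ m (begin
               m ℕ.* p              ≡⟨ deg-β ⟨
               deg β                ≡⟨ cong deg β≡mz ⟩
               deg (+ m · z)        ≡⟨ deg-· m z ⟩
               m ℕ.* m ℕ.* deg z    ≡⟨ ℕ.*-assoc m m (deg z) ⟩
               m ℕ.* (m ℕ.* deg z)  ≡⟨ cong (m ℕ.*_) (ℕ.*-comm m (deg z)) ⟩
               m ℕ.* (deg z ℕ.* m)  ∎)))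
      ... | inj₁ ()
      ... | inj₂ m≡p = ℕ.<⇒≢ m<p m≡p
      0<r : 0 < r
      0<r = ℕ.n≢0⇒n>0 r≢0

    descent : ∀ α m → Descent α m
    descent α = <-rec (Descent α) step
      where
      step : ∀ m → (∀ {k} → k < m → Descent α k) → Descent α m
      step m rec with parity m
      ... | h , inj₁ refl = even-step α h rec
      ... | h , inj₂ refl = odd-step α h rec

  odd-half : ∃[ h ] p ≡ suc (2 ℕ.* h)
  odd-half with parity p
  ... | h , inj₂ eq = h , eq
  ... | h , inj₁ eq with prime⇒irreducible pr {2} (ℕ∣.divides h (trans eq (ℕ.*-comm 2 h)))
  ...   | inj₂ 2≡p = contradiction (sym 2≡p) odd

  -- The descent starts from the centred residue of `α` modulo p: it lies in the required ideal
  -- because `conj α *ₕ α` is the norm, its norm is m p with m < p, and m is not 0 because p does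
  -- not divide `α`.
  norm-p-associate : ∀ α → ¬ P ∣ₕ α → P ∣ℤ N α → ∃[ β ] deg β ≡ p × P ∣ₕ conj α *ₕ β
  norm-p-associate α p∤α p∣Nα with h , p≡ ← odd-half
    with y , y-small , α≋y′ ← centreₕ h α
    with α≋y ← subst (λ p → Congruence._≋_ (+ p) α y) (sym p≡) α≋y′
    with ℕ∣.divides m deg-y ← ∣N⇒∣deg y (∣-≋-N y α (≋-sym α≋y) p∣Nα) =
    descent α m y deg-y (ℕ.n≢0⇒n>0 m≢0)
      (ℕ.*-cancelʳ-< p m p (subst (_< p ℕ.* p) deg-y (ℕ.≤-<-trans y-small
        (subst (λ p → 4 ℕ.* (h ℕ.* h) < p ℕ.* p) (sym p≡) (4h²<m² h)))))
      (∣ₕ-resp-≋ (*ₕ-congˡ (conj α) (≋-sym α≋y))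
        (subst (P ∣ₕ_) (sym (conj-*-self α)) (∣ₕ-scalar 1ₕ p∣Nα)))
    where
    m≢0 : m ≢ 0
    m≢0 refl = p∤α (∣ₕ-resp-≋ α≋y (deg≡0⇒∣ P y deg-y))

-- Counting with duplicate-free lists

length-bijection : ∀ {A B : Set} {xs : List A} {ys : List B} (f : A → B) →
  (∀ {x y} → f x ≡ f y → x ≡ y) → Unique xs → Unique ys →
  (∀ {x} → x ∈ xs → f x ∈ ys) → (∀ {y} → y ∈ ys → ∃[ x ] x ∈ xs × y ≡ f x) →
  length xs ≡ length ys
length-bijection {xs = xs} {ys} f f-inj uxs uys into onto = trans (sym (length-map f xs))
  (↭-length (∼bag⇒↭ (unique∧set⇒bag (Unique.map⁺ f-inj uxs) uys (mk⇔ to from))))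
  where
  to : ∀ {y} → y ∈ map f xs → y ∈ ys
  to y∈ with x , x∈ , refl ← ∈-map⁻ f y∈ = into x∈
  from : ∀ {y} → y ∈ ys → y ∈ map f xs
  from y∈ with x , x∈ , refl ← onto y∈ = ∈-map⁺ f x∈

count : ∀ {A : Set} {P : A → Set} → Decidable P → List A → ℕ
count P? xs = length (filter P? xs)

module _ {A : Set} {P : A → Set} (P? : Decidable P) where

  count-∷-yes : ∀ {x} xs → P x → count P? (x ∷ xs) ≡ suc (count P? xs)
  count-∷-yes {x} xs px with P? x
  ... | yes _  = refl
  ... | no ¬px = contradiction px ¬px

  count-∷-no : ∀ {x} xs → ¬ P x → count P? (x ∷ xs) ≡ count P? xs
  count-∷-no {x} xs ¬px with P? x
  ... | yes px = contradiction px ¬px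
  ... | no _   = refl

  count-split : ∀ xs → count P? xs ℕ.+ count (¬? ∘ P?) xs ≡ length xs
  count-split []       = refl
  count-split (x ∷ xs) with P? x
  ... | yes _ = cong suc (count-split xs)
  ... | no  _ = trans (ℕ.+-suc _ _) (cong suc (count-split xs))

  count-unique : ∀ {xs x} → Unique xs → x ∈ xs → P x → (∀ {y} → y ∈ xs → P y → y ≡ x) → count P? xs ≡ 1
  count-unique {x ∷ xs} (x∉ ∷ _) (here refl) px only = trans (count-∷-yes xs px)
    (cong suc (cong length (filter-none P? (All.tabulate λ y∈ py →
      All.lookup x∉ y∈ (sym (only (there y∈) py))))))
  count-unique {y ∷ xs} (y∉ ∷ u) (there x∈) px only = trans
    (count-∷-no xs (λ py → All.lookup y∉ x∈ (only (here refl) py)))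
    (count-unique u x∈ px (only ∘ there))

module _ {A B : Set} {R : A → B → Set} (R? : Decidable₂ R) where

  private
    sum-+ : ∀ {C : Set} (f g : C → ℕ) zs →
      sum (map (λ z → f z ℕ.+ g z) zs) ≡ sum (map f zs) ℕ.+ sum (map g zs)
    sum-+ f g []       = refl
    sum-+ f g (z ∷ zs) = trans (cong (ℕ._+_ (f z ℕ.+ g z)) (sum-+ f g zs))
      (ℕ-+-interchange (f z) (g z) (sum (map f zs)) (sum (map g zs)))
      where
      ℕ-+-interchange : ∀ a b c d → (a ℕ.+ b) ℕ.+ (c ℕ.+ d) ≡ (a ℕ.+ c) ℕ.+ (b ℕ.+ d)
      ℕ-+-interchange a b c d = trans (ℕ.+-assoc a b (c ℕ.+ d)) (trans
        (cong (ℕ._+_ a) (trans (sym (ℕ.+-assoc b c d)) (trans (cong (ℕ._+ d) (ℕ.+-comm b c)) (ℕ.+-assoc c b d))))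
        (sym (ℕ.+-assoc a c (b ℕ.+ d))))

    sum-zero : ∀ (ys : List B) → sum (map (λ y → count (λ x → R? x y) []) ys) ≡ 0
    sum-zero []       = refl
    sum-zero (y ∷ ys) = sum-zero ys

    indicator : A → B → ℕ
    indicator x y = count (λ x → R? x y) (x ∷ [])

    sum-indicator : ∀ x ys → sum (map (indicator x) ys) ≡ count (R? x) ys
    sum-indicator x []       = refl
    sum-indicator x (y ∷ ys) with R? x y
    ... | yes _ = cong suc (sum-indicator x ys)
    ... | no  _ = sum-indicator x ys

    count-∷ : ∀ x xs y → count (λ x → R? x y) (x ∷ xs) ≡ indicator x y ℕ.+ count (λ x → R? x y) xs
    count-∷ x xs y with R? x y
    ... | yes _ = refl
    ... | no  _ = refl

    map-cong : ∀ {C : Set} {f g : C → ℕ} → (∀ z → f z ≡ g z) → ∀ zs → sum (map f zs) ≡ sum (map g zs)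
    map-cong eq []       = refl
    map-cong eq (z ∷ zs) = cong₂ ℕ._+_ (eq z) (map-cong eq zs)

    swap : ∀ xs ys → sum (map (λ x → count (R? x) ys) xs)
                   ≡ sum (map (λ y → count (λ x → R? x y) xs) ys)
    swap []       ys = sym (sum-zero ys)
    swap (x ∷ xs) ys = sym (trans (map-cong (count-∷ x xs) ys)
      (trans (sum-+ (indicator x) (λ y → count (λ x → R? x y) xs) ys)
             (cong₂ ℕ._+_ (sum-indicator x ys) (sym (swap xs ys)))))

    sum-const : ∀ {C : Set} (f : C → ℕ) {k} zs → (∀ {z} → z ∈ zs → f z ≡ k) → sum (map f zs) ≡ length zs ℕ.* k
    sum-const f []       eq = refl
    sum-const f (z ∷ zs) eq = cong₂ ℕ._+_ (eq (here refl)) (sum-const f zs (eq ∘ there))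

  double-count : ∀ xs ys {k l} → (∀ {x} → x ∈ xs → count (R? x) ys ≡ k) →
    (∀ {y} → y ∈ ys → count (λ x → R? x y) xs ≡ l) → length xs ℕ.* k ≡ length ys ℕ.* l
  double-count xs ys rows columns =
    trans (sym (sum-const _ xs rows)) (trans (swap xs ys) (sum-const _ ys columns))

-- A set with finite fibres over ℕ, that is, a combinatorial model of the generating series of its
-- fibre sizes. `_⊗_` models the product of series, so the same triples and quadruples serve the
-- quaternion bijections and the powers of the theta series.
record Graded : Set₁ where
  field
    Carrier  : Set
    degree   : Carrier → ℕ
    fibre    : ℕ → List Carrier
    sound    : ∀ {n x} → x ∈ fibre n → degree x ≡ n
    complete : ∀ x → x ∈ fibre (degree x)
    unique   : ∀ n → Unique (fibre n)

  disjoint : ∀ {i j x} → x ∈ fibre i → x ∈ fibre j → i ≡ j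
  disjoint p q = trans (sym (sound p)) (sound q)

module _ {A B : Set} where

  -- Unfolds by the same recursion as the Cauchy product `_*ₛ_`, which makes `length-conv` a direct
  -- induction.
  conv : (ℕ → List A) → (ℕ → List B) → ℕ → List (A × B)
  conv F G zero    = cartesianProduct (F 0) (G 0)
  conv F G (suc n) = cartesianProduct (F 0) (G (suc n)) ++ conv (F ∘ suc) G n

  ∈-conv⁺ : ∀ F G i {j x y} → x ∈ F i → y ∈ G j → (x , y) ∈ conv F G (i ℕ.+ j)
  ∈-conv⁺ F G zero {zero}  x∈ y∈ = ∈-cartesianProduct⁺ x∈ y∈
  ∈-conv⁺ F G zero {suc j} x∈ y∈ = ∈-++⁺ˡ (∈-cartesianProduct⁺ x∈ y∈)
  ∈-conv⁺ F G (suc i)      x∈ y∈ = ∈-++⁺ʳ _ (∈-conv⁺ (F ∘ suc) G i x∈ y∈)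

  ∈-conv⁻ : ∀ F G n {x y} → (x , y) ∈ conv F G n → ∃₂ λ i j → i ℕ.+ j ≡ n × x ∈ F i × y ∈ G j
  ∈-conv⁻ F G zero xy∈ = 0 , 0 , refl , ∈-cartesianProduct⁻ (F 0) (G 0) xy∈
  ∈-conv⁻ F G (suc n) xy∈ with ∈-++⁻ (cartesianProduct (F 0) (G (suc n))) xy∈
  ... | inj₁ xy∈ˡ = 0 , suc n , refl , ∈-cartesianProduct⁻ (F 0) (G (suc n)) xy∈ˡ
  ... | inj₂ xy∈ʳ with i , j , eq , x∈ , y∈ ← ∈-conv⁻ (F ∘ suc) G n xy∈ʳ =
    suc i , j , cong suc eq , x∈ , y∈

  conv-unique : ∀ F G → (∀ i → Unique (F i)) → (∀ i → Unique (G i)) →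
    (∀ {i j x} → x ∈ F i → x ∈ F j → i ≡ j) → ∀ n → Unique (conv F G n)
  conv-unique F G uF uG dF zero    = Unique.cartesianProduct⁺ (uF 0) (uG 0)
  conv-unique F G uF uG dF (suc n) = Unique.++⁺ (Unique.cartesianProduct⁺ (uF 0) (uG (suc n)))
    (conv-unique (F ∘ suc) G (uF ∘ suc) uG (λ p q → ℕ.suc-injective (dF p q)) n) disj
    where
    disj : ∀ {xy} → xy ∈ cartesianProduct (F 0) (G (suc n)) × xy ∈ conv (F ∘ suc) G n → _
    disj {x , y} (p , q)
      with x∈ , _ ← ∈-cartesianProduct⁻ (F 0) (G (suc n)) p
         | i , _ , _ , x∈′ , _ ← ∈-conv⁻ (F ∘ suc) G n q = ℕ.0≢1+n (dF x∈ x∈′)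

infixr 7 _⊗_

_⊗_ : Graded → Graded → Graded
F ⊗ G = record
  { Carrier  = F.Carrier × G.Carrier
  ; degree   = λ (x , y) → F.degree x ℕ.+ G.degree y
  ; fibre    = conv F.fibre G.fibre
  ; sound    = λ {n} xy∈ → let i , j , eq , x∈ , y∈ = ∈-conv⁻ F.fibre G.fibre n xy∈ in
                 trans (cong₂ ℕ._+_ (F.sound x∈) (G.sound y∈)) eq
  ; complete = λ (x , y) → ∈-conv⁺ F.fibre G.fibre (F.degree x) (F.complete x) (G.complete y)
  ; unique   = conv-unique F.fibre G.fibre F.unique G.unique F.disjoint
  }
  where
  module F = Graded F
  module G = Graded G

-- Representations as sums of three and four squares

-- Raising the bound by one adds exactly the two square roots of (n + 1)², matching the growth of
-- `partialTheta`.
interval : ℕ → List ℤ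
interval zero    = 0ℤ ∷ []
interval (suc n) = + suc n ∷ -[1+ n ] ∷ interval n

∈-interval⁻ : ∀ n {a} → a ∈ interval n → ℤ.∣ a ∣ ≤ n
∈-interval⁻ zero    (here refl)          = z≤n
∈-interval⁻ (suc n) (here refl)          = ℕ.≤-refl
∈-interval⁻ (suc n) (there (here refl))  = ℕ.≤-refl
∈-interval⁻ (suc n) (there (there a∈))   = ℕ.m≤n⇒m≤1+n (∈-interval⁻ n a∈)

∈-interval⁺ : ∀ n a → ℤ.∣ a ∣ ≤ n → a ∈ interval n
∈-interval⁺ zero    (+ zero)  _ = here refl
∈-interval⁺ (suc n) a |a|≤ with ℕ.m≤n⇒m<n∨m≡n |a|≤
∈-interval⁺ (suc n) a           _ | inj₁ (s≤s |a|≤n) = there (there (∈-interval⁺ n a |a|≤n))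
∈-interval⁺ (suc n) (+ suc .n)  _ | inj₂ refl = here refl
∈-interval⁺ (suc n) -[1+ .n ]   _ | inj₂ refl = there (here refl)

interval-unique : ∀ n → Unique (interval n)
interval-unique zero    = [] ∷ []
interval-unique (suc n) =
  ((λ ()) ∷ All.tabulate (λ a∈ → λ { refl → ℕ.1+n≰n (∈-interval⁻ n a∈) })) ∷
  All.tabulate (λ a∈ → λ { refl → ℕ.1+n≰n (∈-interval⁻ n a∈) }) ∷
  interval-unique n

squares : Graded
squares = record
  { Carrier  = ℤ
  ; degree   = sq
  ; fibre    = λ n → filter (λ a → sq a ℕ.≟ n) (interval n)
  ; sound    = λ {n} a∈ → proj₂ (∈-filter⁻ (λ a → sq a ℕ.≟ n) {xs = interval n} a∈)
  ; complete = λ a → ∈-filter⁺ (λ b → sq b ℕ.≟ sq a) (∈-interval⁺ (sq a) a (m≤m² ℤ.∣ a ∣)) refl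
  ; unique   = λ n → Unique.filter⁺ _ (interval-unique n)
  }
  where
  m≤m² : ∀ m → m ≤ m ℕ.* m
  m≤m² zero    = z≤n
  m≤m² (suc m) = ℕ.m≤m+n (suc m) _

squares³ squares⁴ : Graded
squares³ = squares ⊗ squares ⊗ squares
squares⁴ = squares ⊗ squares ⊗ squares ⊗ squares

r₃ r₄ : ℕ → ℕ
r₃ n = length (Graded.fibre squares³ n)
r₄ n = length (Graded.fibre squares⁴ n)

toℍ : ℤ × ℤ × ℤ × ℤ → ℍ
toℍ (a , b , c , d) = ⟨ a , b , c , d ⟩

toPure : ℤ × ℤ × ℤ → ℍ
toPure (a , b , c) = ⟨ 0ℤ , a , b , c ⟩

quaternions : ℕ → List ℍ
quaternions n = map toℍ (Graded.fibre squares⁴ n)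

∈-quaternions⁺ : ∀ {n} x → deg x ≡ n → x ∈ quaternions n
∈-quaternions⁺ ⟨ a , b , c , d ⟩ refl = ∈-map⁺ toℍ (Graded.complete squares⁴ (a , b , c , d))

∈-quaternions⁻ : ∀ {n x} → x ∈ quaternions n → deg x ≡ n
∈-quaternions⁻ x∈ with _ , y∈ , refl ← ∈-map⁻ toℍ x∈ = Graded.sound squares⁴ y∈

quaternions-unique : ∀ n → Unique (quaternions n)
quaternions-unique n = Unique.map⁺ (λ { refl → refl }) (Graded.unique squares⁴ n)

length-quaternions : ∀ n → length (quaternions n) ≡ r₄ n
length-quaternions n = length-map toℍ (Graded.fibre squares⁴ n)

-- The units ±1, ±i, ±j, ±k, the origin of the factor 8 in all counts of quaternions of norm p.
length-units : length (quaternions 1) ≡ 8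
length-units = refl

-- Stated through `conj` so that purity of products and quotients follows from the rules for
-- conjugation, without coordinates; `isPure⇒re≡0` returns to coordinates for counting.
IsPure : ℍ → Set
IsPure x = conj x ≡ ℤ.-1ℤ · x

opaque
  unfolding _·_

  toPure-isPure : ∀ x → IsPure (toPure x)
  toPure-isPure (a , b , c) = ≡-ℍ refl (sym (ℤ.-1*i≡-i a)) (sym (ℤ.-1*i≡-i b)) (sym (ℤ.-1*i≡-i c))

  isPure⇒re≡0 : ∀ x → IsPure x → ℍ.re x ≡ 0ℤ
  isPure⇒re≡0 ⟨ a , b , c , d ⟩ eq = self-neg a (trans (cong ℍ.re eq) (ℤ.-1*i≡-i a))
    where
    self-neg : ∀ a → a ≡ ℤ.- a → a ≡ 0ℤ
    self-neg (+ zero) _ = refl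

pures : ℕ → List ℍ
pures n = map toPure (Graded.fibre squares³ n)

∈-pures⁺ : ∀ {n} x → IsPure x → deg x ≡ n → x ∈ pures n
∈-pures⁺ x@(⟨ a , b , c , d ⟩) pure deg-x with refl ← isPure⇒re≡0 x pure | refl ← deg-x =
  ∈-map⁺ toPure (Graded.complete squares³ (b , c , d))

∈-pures⁻ : ∀ {n x} → x ∈ pures n → IsPure x × deg x ≡ n
∈-pures⁻ x∈ with y , y∈ , refl ← ∈-map⁻ toPure x∈ = toPure-isPure y , Graded.sound squares³ y∈

pures-unique : ∀ n → Unique (pures n)
pures-unique n = Unique.map⁺ (λ { refl → refl }) (Graded.unique squares³ n)

length-pures : ∀ n → length (pures n) ≡ r₃ n
length-pures n = length-map toPure (Graded.fibre squares³ n)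

deg≢0-cancelˡ : ∀ β {x y} .{{_ : ℕ.NonZero (deg β)}} → β *ₕ x ≡ β *ₕ y → x ≡ y
deg≢0-cancelˡ β {x} {y} eq = ·-cancelˡ (+ deg β) x y (trans (norm x) (trans (cong (conj β *ₕ_) eq) (sym (norm y))))
  where
  norm : ∀ x → + deg β · x ≡ conj β *ₕ (β *ₕ x)
  norm x = trans (cong (_· x) (+-deg β)) (sym (conj-*ˡ β x))

deg≢0-cancelʳ : ∀ β {x y} .{{_ : ℕ.NonZero (deg β)}} → x *ₕ β ≡ y *ₕ β → x ≡ y
deg≢0-cancelʳ β {x} {y} eq = ·-cancelˡ (+ deg β) x y (trans (norm x) (trans (cong (_*ₕ conj β) eq) (sym (norm y))))
  where
  norm : ∀ x → + deg β · x ≡ (x *ₕ β) *ₕ conj β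
  norm x = trans (cong (_· x) (+-deg β)) (sym (*-conjʳ x β))

conj-conj-* : ∀ x y → conj (conj x *ₕ y) ≡ conj y *ₕ x
conj-conj-* x y = trans (conj-* (conj x) y) (cong (conj y *ₕ_) (conj-involutive x))

opaque
  unfolding _·_

  ·-identity : ∀ x → 1ℤ · x ≡ x
  ·-identity ⟨ a , b , c , d ⟩ =
    ≡-ℍ (ℤ.*-identityˡ a) (ℤ.*-identityˡ b) (ℤ.*-identityˡ c) (ℤ.*-identityˡ d)

  +-cancel : ∀ x {y z} → x +ₕ y ≡ x +ₕ z → y ≡ z
  +-cancel ⟨ a , b , c , d ⟩ eq = ≡-ℍ
    (+-cancelˡ a _ _ (cong ℍ.re eq)) (+-cancelˡ b _ _ (cong ℍ.im₁ eq))
    (+-cancelˡ c _ _ (cong ℍ.im₂ eq)) (+-cancelˡ d _ _ (cong ℍ.im₃ eq))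

-- Left divisors of norm p

module Counting {p : ℕ} (pr : Prime p) (odd : p ≢ 2) where

  open ModPrime pr odd public

  assoc? : ∀ (α β : ℍ) → Dec (P ∣ₕ conj α *ₕ β)
  assoc? α β = P ∣ₕ? conj α *ₕ β

  N≡P : ∀ {β} → deg β ≡ p → N β ≡ P
  N≡P {β} eq = trans (sym (+-deg β)) (cong +_ eq)

  P∣N : ∀ {β} → deg β ≡ p → P ∣ℤ N β
  P∣N eq = ℤ∣.∣-reflexive (sym (N≡P eq))

  deg-nonZero : ∀ {β} → deg β ≡ p → ℕ.NonZero (deg β)
  deg-nonZero eq = subst ℕ.NonZero (sym eq) nonZero-p

  P∤norm-p : ∀ {β} → deg β ≡ p → ¬ P ∣ₕ β
  P∤norm-p {β} deg-β (divides x refl) with ℕ∣.∣1⇒≡1 (ℕ∣.divides (deg x) (sym (ℕ.*-cancelˡ-≡ _ _ p (begin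
      p ℕ.* (deg x ℕ.* p)  ≡⟨ lem p (deg x) ⟩
      p ℕ.* p ℕ.* deg x    ≡⟨ deg-· p x ⟨
      deg (P · x)          ≡⟨ deg-β ⟩
      p                    ≡⟨ ℕ.*-identityʳ p ⟨
      p ℕ.* 1              ∎))))
    where
    open ≡-Reasoning
    lem : ∀ p d → p ℕ.* (d ℕ.* p) ≡ p ℕ.* p ℕ.* d
    lem = ℕ-solver.solve-∀
  ... | p≡1 = ℕ.<⇒≢ (ℕ.<-trans (s≤s (s≤s z≤n)) 2<p) (sym p≡1)

  -- One solution `β` comes from the descent. For any other solution `γ`, `annihilated-orthogonal`
  -- gives `conj β *ₕ γ ≡ P · u`; comparing norms shows that `u` is a unit, and multiplying by `β`
  -- gives `γ ≡ β *ₕ u`. The solutions thus form one orbit of the unit group.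
  associates : ∀ α → ¬ P ∣ₕ α → P ∣ℤ N α → count (assoc? α) (quaternions p) ≡ 8
  associates α p∤α p∣Nα with β , deg-β , αβ ← norm-p-associate pr odd α p∤α p∣Nα =
    trans (sym (length-bijection (β *ₕ_) (deg≢0-cancelˡ β {{deg-nonZero {β} deg-β}})
      (quaternions-unique 1) (Unique.filter⁺ (assoc? α) (quaternions-unique p)) into onto)) length-units
    where
    open ≡-Reasoning
    into : ∀ {u} → u ∈ quaternions 1 → β *ₕ u ∈ filter (assoc? α) (quaternions p)
    into {u} u∈ = ∈-filter⁺ (assoc? α)
      (∈-quaternions⁺ (β *ₕ u) (trans (deg-* β u)
        (trans (cong₂ ℕ._*_ deg-β (∈-quaternions⁻ u∈)) (ℕ.*-identityʳ p))))
      (subst (P ∣ₕ_) (*ₕ-assoc (conj α) β u) (∣ₕ-*ʳ u αβ))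
    onto : ∀ {γ} → γ ∈ filter (assoc? α) (quaternions p) → ∃[ u ] u ∈ quaternions 1 × γ ≡ β *ₕ u
    onto {γ} γ∈ with γ∈p , αγ ← ∈-filter⁻ (assoc? α) {xs = quaternions p} γ∈
      with divides u eq ← annihilated-orthogonal α β γ p∤α αβ αγ =
      u , ∈-quaternions⁺ u (ℕ.*-cancelˡ-≡ _ _ (p ℕ.* p) {{ℕ.m*n≢0 p p}} (begin
        p ℕ.* p ℕ.* deg u         ≡⟨ deg-· p u ⟨
        deg (P · u)               ≡⟨ cong deg eq ⟨
        deg (conj β *ₕ γ)         ≡⟨ deg-* (conj β) γ ⟩
        deg (conj β) ℕ.* deg γ    ≡⟨ cong₂ ℕ._*_ (trans (deg-conj β) deg-β) (∈-quaternions⁻ γ∈p) ⟩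
        p ℕ.* p                   ≡⟨ ℕ.*-identityʳ (p ℕ.* p) ⟨
        p ℕ.* p ℕ.* 1             ∎)) ,
      ·-cancelˡ P γ (β *ₕ u) (begin
        P · γ                     ≡⟨ cong (_· γ) (N≡P deg-β) ⟨
        N β · γ                   ≡⟨ *-conjˡ β γ ⟨
        β *ₕ (conj β *ₕ γ)        ≡⟨ cong (β *ₕ_) eq ⟩
        β *ₕ (P · u)              ≡⟨ ·-*ʳ P β u ⟩
        P · (β *ₕ u)              ∎)

  count-filter : ∀ {Q R : ℍ → Set} (Q? : ∀ x → Dec (Q x)) (R? : ∀ x → Dec (R x)) xs →
    (∀ {x} → R x → Q x) →
    count Q? (filter (¬? ∘ R?) xs) ℕ.+ count R? xs ≡ count Q? xs
  count-filter Q? R? [] R⊆Q = refl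
  count-filter Q? R? (x ∷ xs) R⊆Q with R? x
  ... | yes rx = trans (ℕ.+-suc _ _) (trans (cong suc (count-filter Q? R? xs R⊆Q)) (sym (count-∷-yes Q? xs (R⊆Q rx))))
  ... | no ¬rx with Q? x
  ...   | yes _ = cong suc (count-filter Q? R? xs R⊆Q)
  ...   | no  _ = count-filter Q? R? xs R⊆Q

  -- For `β` of norm p the condition `P ∣ₕ conj y *ₕ β` says precisely that `β` divides `y` on the
  -- left: conjugating and multiplying by `β` cancels the `P`.
  multiples : ∀ {n β} → deg β ≡ p →
    count (λ y → assoc? y β) (quaternions (p ℕ.* n)) ≡ r₄ n
  multiples {n} {β} deg-β = trans (sym (length-bijection (β *ₕ_) (deg≢0-cancelˡ β {{deg-nonZero {β} deg-β}})
      (quaternions-unique n) (Unique.filter⁺ (λ y → assoc? y β) (quaternions-unique (p ℕ.* n))) into onto))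
      (length-quaternions n)
    where
    open ≡-Reasoning
    into : ∀ {x} → x ∈ quaternions n → β *ₕ x ∈ filter (λ y → assoc? y β) (quaternions (p ℕ.* n))
    into {x} x∈ = ∈-filter⁺ (λ y → assoc? y β)
      (∈-quaternions⁺ (β *ₕ x) (trans (deg-* β x) (cong₂ ℕ._*_ deg-β (∈-quaternions⁻ x∈))))
      (divides (conj x) (begin
        conj (β *ₕ x) *ₕ β          ≡⟨ cong (_*ₕ β) (conj-* β x) ⟩
        (conj x *ₕ conj β) *ₕ β     ≡⟨ conj-*ʳ (conj x) β ⟩
        N β · conj x                ≡⟨ cong (_· conj x) (N≡P deg-β) ⟩
        P · conj x                  ∎))
    onto : ∀ {y} → y ∈ filter (λ y → assoc? y β) (quaternions (p ℕ.* n)) →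
           ∃[ x ] x ∈ quaternions n × y ≡ β *ₕ x
    onto {y} y∈ with y∈pn , yβ ← ∈-filter⁻ (λ y → assoc? y β) {xs = quaternions (p ℕ.* n)} y∈
      with divides x eq ← subst (P ∣ₕ_) (conj-conj-* y β) (∣ₕ-conj yβ) =
      x , ∈-quaternions⁺ x (ℕ.*-cancelˡ-≡ _ _ p (ℕ.*-cancelˡ-≡ _ _ p (begin
        p ℕ.* (p ℕ.* deg x)       ≡⟨ ℕ.*-assoc p p (deg x) ⟨
        p ℕ.* p ℕ.* deg x         ≡⟨ deg-· p x ⟨
        deg (P · x)               ≡⟨ cong deg eq ⟨
        deg (conj β *ₕ y)         ≡⟨ deg-* (conj β) y ⟩
        deg (conj β) ℕ.* deg y    ≡⟨ cong₂ ℕ._*_ (trans (deg-conj β) deg-β) (∈-quaternions⁻ y∈pn) ⟩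
        p ℕ.* (p ℕ.* n)           ∎))) ,
      ·-cancelˡ P y (β *ₕ x) (begin
        P · y                     ≡⟨ cong (_· y) (N≡P deg-β) ⟨
        N β · y                   ≡⟨ *-conjˡ β y ⟨
        β *ₕ (conj β *ₕ y)        ≡⟨ cong (β *ₕ_) eq ⟩
        β *ₕ (P · x)              ≡⟨ ·-*ʳ P β x ⟩
        P · (β *ₕ x)              ∎)

  inverse : ∀ t → ¬ P ∣ℤ t → ∃₂ λ u k → t ℤ.* u ≡ 1ℤ ℤ.+ P ℤ.* k
  inverse t p∤t = go t (coprime-Bézout (prime-coprime (λ p∣t → p∤t (ℤ∣.∣ᵤ⇒∣ p∣t))))
    where
    prime-coprime : ∀ {n} → ¬ p ℕ∣.∣ n → Coprime p n
    prime-coprime p∤n (d∣p , d∣n) with prime⇒irreducible pr d∣p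
    ... | inj₁ d≡1  = d≡1
    ... | inj₂ refl = contradiction d∣n p∤n
    open ℤ-ops using (_+_; _*_; -_; ∣_∣)
    cast : ∀ a b c d → 1 ℕ.+ a ℕ.* b ≡ c ℕ.* d → 1ℤ + + a * + b ≡ + c * + d
    cast a b c d eq = trans (cong (λ z → 1ℤ + z) (sym (ℤ.pos-* a b))) (trans (cong +_ eq) (ℤ.pos-* c d))
    lem₁ : ∀ x y p t → 1ℤ + y * t ≡ x * p → t * (- y) ≡ 1ℤ + p * (- x)
    lem₁ x y p t eq = trans (e t y) (trans (cong (λ z → 1ℤ + - z) eq) (e′ x p))
      where
      e : ∀ t y → t * (- y) ≡ 1ℤ + - (1ℤ + y * t)
      e = solve-∀
      e′ : ∀ x p → 1ℤ + - (x * p) ≡ 1ℤ + p * (- x)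
      e′ = solve-∀
    lem₂ : ∀ x y p t → 1ℤ + x * p ≡ y * t → t * y ≡ 1ℤ + p * x
    lem₂ x y p t eq = trans (ℤ.*-comm t y) (trans (sym eq) (cong (λ z → 1ℤ + z) (ℤ.*-comm x p)))
    abs : ∀ s → ∃₂ (λ u k → + ∣ s ∣ * u ≡ 1ℤ + P * k) → ∃₂ λ u k → s * u ≡ 1ℤ + P * k
    abs s (u , k , eq) with ℤ.+∣i∣≡i⊎+∣i∣≡-i s
    ... | inj₁ +s≡s  = u , k , trans (cong (_* u) (sym +s≡s)) eq
    ... | inj₂ +s≡-s = - u , k , trans (neg s u) (trans (cong (_* u) (sym +s≡-s)) eq)
      where
      neg : ∀ s u → s * (- u) ≡ (- s) * u
      neg = solve-∀
    go : ∀ t → Bézout.Identity 1 p ∣ t ∣ → ∃₂ λ u k → t * u ≡ 1ℤ + P * k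
    go t (Bézout.+- x y eq) = abs t (_ , _ , lem₁ (+ x) (+ y) P (+ ∣ t ∣) (cast y ∣ t ∣ x p eq))
    go t (Bézout.-+ x y eq) = abs t (_ , _ , lem₂ (+ x) (+ y) P (+ ∣ t ∣) (cast x p y ∣ t ∣ eq))

  reduce : ∀ a → ∃₂ λ r k → r < p × a ≡ + r ℤ.+ P ℤ.* k
  reduce a = a ℤ.%ℕ p , a ℤ./ℕ p , ℤ.n%ℕd<d a p ,
    trans (ℤ.a≡a%ℕn+[a/ℕn]*n a p) (cong (ℤ._+_ (+ (a ℤ.%ℕ p))) (ℤ.*-comm (a ℤ./ℕ p) P))

  ·-reduce : ∀ {s r} k → s ≡ r ℤ.+ P ℤ.* k → ∀ x → s · x ≋ r · x
  ·-reduce {s} {r} k refl x = congruent (k · x)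
    (trans (·-distribʳ r (P ℤ.* k) x) (cong (r · x +ₕ_) (sym (·-assoc P k x))))

  scalar-solve : ∀ {s t x y} → ¬ P ∣ℤ t → t · y ≋ s · x → ∃[ r ] r < p × y ≋ + r · x
  scalar-solve {s} {t} {x} {y} p∤t ty≋sx with u , k , tu≡ ← inverse t p∤t
    with r , l , r<p , us≡ ← reduce (u ℤ.* s) =
    r , r<p ,
    ≋-trans (≋-reflexive (sym (·-identity y)))
    (≋-trans (≋-sym (·-reduce k tu≡ y))
    (≋-trans (≋-reflexive (trans (cong (_· y) (ℤ.*-comm t u)) (sym (·-assoc u t y))))
    (≋-trans (·-cong u ty≋sx)
    (≋-trans (≋-reflexive (·-assoc u s x)) (·-reduce l us≡ x)))))

  residue-unique : ∀ {r s} → r < p → s < p → P ∣ℤ + r ℤ.- + s → r ≡ s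
  residue-unique {r} {s} r<p s<p P∣diff = ℤ.+-injective (ℤ.i-j≡0⇒i≡j (+ r) (+ s) diff≡0)
    where
    open ℤ-ops using (_-_; ∣_∣)
    bound : ∣ + r - + s ∣ < p
    bound = subst (_< p) (sym (cong ∣_∣ (ℤ.m-n≡m⊖n r s)))
      (ℕ.≤-<-trans (ℤ.∣m⊝n∣≤m⊔n r s) (ℕ.⊔-pres-<m r<p s<p))
    diff≡0 : + r - + s ≡ 0ℤ
    diff≡0 with ∣ + r - + s ∣ in eq
    ... | zero  = ℤ.∣i∣≡0⇒i≡0 eq
    ... | suc d = contradiction (subst (p ℕ∣.∣_) eq (ℤ∣.∣⇒∣ᵤ P∣diff)) (ℕ∣.>⇒∤ (subst (_< p) eq bound))

  ·-injective-mod : ∀ {r s x} → ¬ P ∣ₕ x → r < p → s < p → + r · x ≋ + s · x → r ≡ s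
  ·-injective-mod {r} {s} {x} p∤x r<p s<p (congruent k eq) = residue-unique r<p s<p P∣diff
    where
    open ℤ-ops using (_+_; _*_; _-_)
    diff-· : (+ r - + s) · x ≡ P · k
    diff-· = +-cancel (+ s · x) (trans (sym (·-distribʳ (+ s) (+ r - + s) x))
               (trans (cong (_· x) (lem (+ r) (+ s))) eq))
      where
      lem : ∀ r s → s + (r - s) ≡ r
      lem = solve-∀
    P∣diff : P ∣ℤ + r - + s
    P∣diff with P ∣ℤ? + r - + s
    ... | yes p∣ = p∣
    ... | no  p∤ = contradiction (∣ₕ-cancel p∤ x (divides k diff-·)) p∤x

-- Isotropic lines and the value of r₄(p)

count-map : ∀ {A B : Set} {Q : B → Set} (Q? : Decidable Q) (f : A → B) xs →
            count Q? (map f xs) ≡ count (Q? ∘ f) xs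
count-map Q? f []       = refl
count-map Q? f (x ∷ xs) with Q? (f x)
... | yes _ = cong suc (count-map Q? f xs)
... | no  _ = count-map Q? f xs

iₕ : ℍ
iₕ = ⟨ 0ℤ , 1ℤ , 0ℤ , 0ℤ ⟩

γ[_,_] : ℤ → ℤ → ℍ
γ[ a , b ] = ⟨ 1ℤ , 0ℤ , a , b ⟩

line : ℤ → ℤ → ℕ → ℍ
line a b s = ⟨ + s , 1ℤ , 0ℤ , 0ℤ ⟩ *ₕ γ[ a , b ]

opaque
  unfolding _·_

  N-γ : ∀ a b → N γ[ a , b ] ≡ 1ℤ ℤ.+ a ℤ.* a ℤ.+ b ℤ.* b
  N-γ a b = lem a b
    where
    open ℤ-ops using (_+_; _*_)
    lem : ∀ a b → 1ℤ * 1ℤ + 0ℤ * 0ℤ + a * a + b * b ≡ 1ℤ + a * a + b * b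
    lem = solve-∀

  -- i anticommutes with j and k, so only the real part 1 of `conj γ[ a , b ]` survives. It excludes
  -- that a quaternion of norm p is attached both to γ and to some (s + i)γ.
  iₕ-anticommutator : ∀ a b x → iₕ *ₕ (conj γ[ a , b ] *ₕ x) +ₕ conj γ[ a , b ] *ₕ (iₕ *ₕ x) ≡ + 2 · (iₕ *ₕ x)
  iₕ-anticommutator a b ⟨ e , f , g , h ⟩ =
    ≡-ℍ (c₀ a b e f g h) (c₁ a b e f g h) (c₂ a b e f g h) (c₃ a b e f g h)
    where
    open ℤ-ops using (_+_; _*_; _-_; -_)
    c₀ : ∀ a b e f g h →
      0ℤ * (1ℤ * e - (- 0ℤ) * f - (- a) * g - (- b) * h) - 1ℤ * (1ℤ * f + (- 0ℤ) * e + (- a) * h - (- b) * g)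
        - 0ℤ * (1ℤ * g - (- 0ℤ) * h + (- a) * e + (- b) * f) - 0ℤ * (1ℤ * h + (- 0ℤ) * g - (- a) * f + (- b) * e)
      + (1ℤ * (0ℤ * e - 1ℤ * f - 0ℤ * g - 0ℤ * h) - (- 0ℤ) * (0ℤ * f + 1ℤ * e + 0ℤ * h - 0ℤ * g)
        - (- a) * (0ℤ * g - 1ℤ * h + 0ℤ * e + 0ℤ * f) - (- b) * (0ℤ * h + 1ℤ * g - 0ℤ * f + 0ℤ * e))
      ≡ + 2 * (0ℤ * e - 1ℤ * f - 0ℤ * g - 0ℤ * h)
    c₀ = solve-∀
    c₁ : ∀ a b e f g h →
      0ℤ * (1ℤ * f + (- 0ℤ) * e + (- a) * h - (- b) * g) + 1ℤ * (1ℤ * e - (- 0ℤ) * f - (- a) * g - (- b) * h)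
        + 0ℤ * (1ℤ * h + (- 0ℤ) * g - (- a) * f + (- b) * e) - 0ℤ * (1ℤ * g - (- 0ℤ) * h + (- a) * e + (- b) * f)
      + (1ℤ * (0ℤ * f + 1ℤ * e + 0ℤ * h - 0ℤ * g) + (- 0ℤ) * (0ℤ * e - 1ℤ * f - 0ℤ * g - 0ℤ * h)
        + (- a) * (0ℤ * h + 1ℤ * g - 0ℤ * f + 0ℤ * e) - (- b) * (0ℤ * g - 1ℤ * h + 0ℤ * e + 0ℤ * f))
      ≡ + 2 * (0ℤ * f + 1ℤ * e + 0ℤ * h - 0ℤ * g)
    c₁ = solve-∀
    c₂ : ∀ a b e f g h →
      0ℤ * (1ℤ * g - (- 0ℤ) * h + (- a) * e + (- b) * f) - 1ℤ * (1ℤ * h + (- 0ℤ) * g - (- a) * f + (- b) * e)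
        + 0ℤ * (1ℤ * e - (- 0ℤ) * f - (- a) * g - (- b) * h) + 0ℤ * (1ℤ * f + (- 0ℤ) * e + (- a) * h - (- b) * g)
      + (1ℤ * (0ℤ * g - 1ℤ * h + 0ℤ * e + 0ℤ * f) - (- 0ℤ) * (0ℤ * h + 1ℤ * g - 0ℤ * f + 0ℤ * e)
        + (- a) * (0ℤ * e - 1ℤ * f - 0ℤ * g - 0ℤ * h) + (- b) * (0ℤ * f + 1ℤ * e + 0ℤ * h - 0ℤ * g))
      ≡ + 2 * (0ℤ * g - 1ℤ * h + 0ℤ * e + 0ℤ * f)
    c₂ = solve-∀
    c₃ : ∀ a b e f g h →
      0ℤ * (1ℤ * h + (- 0ℤ) * g - (- a) * f + (- b) * e) + 1ℤ * (1ℤ * g - (- 0ℤ) * h + (- a) * e + (- b) * f)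
        - 0ℤ * (1ℤ * f + (- 0ℤ) * e + (- a) * h - (- b) * g) + 0ℤ * (1ℤ * e - (- 0ℤ) * f - (- a) * g - (- b) * h)
      + (1ℤ * (0ℤ * h + 1ℤ * g - 0ℤ * f + 0ℤ * e) + (- 0ℤ) * (0ℤ * g - 1ℤ * h + 0ℤ * e + 0ℤ * f)
        - (- a) * (0ℤ * f + 1ℤ * e + 0ℤ * h - 0ℤ * g) + (- b) * (0ℤ * e - 1ℤ * f - 0ℤ * g - 0ℤ * h))
      ≡ + 2 * (0ℤ * h + 1ℤ * g - 0ℤ * f + 0ℤ * e)
    c₃ = solve-∀

  -- A coordinate equal to 1 certifies that no line representative is divisible by p.
  line-im₁ : ∀ a b s → ℍ.im₁ (line a b s) ≡ 1ℤ
  line-im₁ a b s = lem a b (+ s)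
    where
    open ℤ-ops using (_+_; _*_; _-_)
    lem : ∀ a b s → s * 0ℤ + 1ℤ * 1ℤ + 0ℤ * b - 0ℤ * a ≡ 1ℤ
    lem = solve-∀

  line-conj : ∀ s x → conj ⟨ + s , 1ℤ , 0ℤ , 0ℤ ⟩ *ₕ x +ₕ iₕ *ₕ x ≡ + s · x
  line-conj s ⟨ e , f , g , h ⟩ =
    ≡-ℍ (c₀ (+ s) e f g h) (c₁ (+ s) e f g h) (c₂ (+ s) e f g h) (c₃ (+ s) e f g h)
    where
    open ℤ-ops using (_+_; _*_; _-_; -_)
    c₀ : ∀ s e f g h → s * e - (- 1ℤ) * f - (- 0ℤ) * g - (- 0ℤ) * h + (0ℤ * e - 1ℤ * f - 0ℤ * g - 0ℤ * h) ≡ s * e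
    c₀ = solve-∀
    c₁ : ∀ s e f g h → s * f + (- 1ℤ) * e + (- 0ℤ) * h - (- 0ℤ) * g + (0ℤ * f + 1ℤ * e + 0ℤ * h - 0ℤ * g) ≡ s * f
    c₁ = solve-∀
    c₂ : ∀ s e f g h → s * g - (- 1ℤ) * h + (- 0ℤ) * e + (- 0ℤ) * f + (0ℤ * g - 1ℤ * h + 0ℤ * e + 0ℤ * f) ≡ s * g
    c₂ = solve-∀
    c₃ : ∀ s e f g h → s * h + (- 1ℤ) * g - (- 0ℤ) * f + (- 0ℤ) * e + (0ℤ * h + 1ℤ * g - 0ℤ * f + 0ℤ * e) ≡ s * h
    c₃ = solve-∀

*-distribˡ : ∀ x y z → x *ₕ (y +ₕ z) ≡ x *ₕ y +ₕ x *ₕ z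
*-distribˡ x y z = begin
  x *ₕ (y +ₕ z)                                ≡⟨ conj-involutive _ ⟨
  conj (conj (x *ₕ (y +ₕ z)))                  ≡⟨ cong conj (trans (conj-* x (y +ₕ z)) (cong (_*ₕ conj x) (conj-+ y z))) ⟩
  conj ((conj y +ₕ conj z) *ₕ conj x)          ≡⟨ cong conj (*-distribʳ (conj y) (conj z) (conj x)) ⟩
  conj (conj y *ₕ conj x +ₕ conj z *ₕ conj x)  ≡⟨ conj-+ _ _ ⟩
  conj (conj y *ₕ conj x) +ₕ conj (conj z *ₕ conj x) ≡⟨ cong₂ _+ₕ_ (back y) (back z) ⟩
  x *ₕ y +ₕ x *ₕ z ∎
  where
  open ≡-Reasoning
  back : ∀ y → conj (conj y *ₕ conj x) ≡ x *ₕ y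
  back y = trans (cong conj (sym (conj-* x y))) (conj-involutive _)

module Lines {p : ℕ} (pr : Prime p) (odd : p ≢ 2) where

  open Counting pr odd

  -- The p + 1 elements γ and (s + i)γ, with γ = 1 + aj + bk of norm
  -- divisible by p, represent the lines of the left ideal of γ modulo p; each
  -- right ideal meets that left ideal in exactly one of them.
  module _ (a b : ℤ) (isotropic : P ∣ℤ 1ℤ ℤ.+ a ℤ.* a ℤ.+ b ℤ.* b) where

    γ : ℍ
    γ = γ[ a , b ]

    P∤1 : ¬ P ∣ℤ 1ℤ
    P∤1 = ∤-< (s≤s z≤n) (ℕ.<-trans (s≤s (s≤s z≤n)) 2<p)

    P∣Nγ : P ∣ℤ N γ
    P∣Nγ = subst (P ∣ℤ_) (sym (N-γ a b)) isotropic

    P∣ₕ⇒P∣im₁ : ∀ {x} → P ∣ₕ x → P ∣ℤ ℍ.im₁ x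
    P∣ₕ⇒P∣im₁ p∣x = proj₁ (proj₂ (∣ₕ-components⁻ p∣x))

    lines : List ℍ
    lines = γ ∷ map (line a b) (upTo p)

    line-associates : ∀ {α} → α ∈ lines → count (assoc? α) (quaternions p) ≡ 8
    line-associates (here refl) = associates γ (P∤1 ∘ proj₁ ∘ ∣ₕ-components⁻) P∣Nγ
    line-associates (there α∈) with s , _ , refl ← ∈-map⁻ (line a b) α∈ = associates (line a b s)
      (P∤1 ∘ subst (P ∣ℤ_) (line-im₁ a b s) ∘ P∣ₕ⇒P∣im₁)
      (subst (P ∣ℤ_) (sym (N-* _ γ)) (ℤ∣.∣n⇒∣m*n (N ⟨ + s , 1ℤ , 0ℤ , 0ℤ ⟩) P∣Nγ))

    -- The conjugate of (s + i)γ is `conj γ` times s - i. Hence `β` is attached to the line of index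
    -- `s` exactly when `conj γ *ₕ (iₕ *ₕ β)` is `s` times `conj γ *ₕ β` modulo `P`: finding the
    -- line amounts to finding an eigenvalue.
    line-eq : ∀ s β → conj (line a b s) *ₕ β +ₕ conj γ *ₕ (iₕ *ₕ β) ≡ + s · (conj γ *ₕ β)
    line-eq s β = begin
      conj (s+i *ₕ γ) *ₕ β +ₕ conj γ *ₕ (iₕ *ₕ β)
        ≡⟨ cong (λ z → z *ₕ β +ₕ conj γ *ₕ (iₕ *ₕ β)) (conj-* s+i γ) ⟩
      (conj γ *ₕ conj s+i) *ₕ β +ₕ conj γ *ₕ (iₕ *ₕ β)
        ≡⟨ cong (_+ₕ conj γ *ₕ (iₕ *ₕ β)) (*ₕ-assoc (conj γ) (conj s+i) β) ⟩
      conj γ *ₕ (conj s+i *ₕ β) +ₕ conj γ *ₕ (iₕ *ₕ β)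
        ≡⟨ *-distribˡ (conj γ) _ _ ⟨
      conj γ *ₕ (conj s+i *ₕ β +ₕ iₕ *ₕ β)
        ≡⟨ cong (conj γ *ₕ_) (line-conj s β) ⟩
      conj γ *ₕ (+ s · β)
        ≡⟨ ·-*ʳ (+ s) (conj γ) β ⟩
      + s · (conj γ *ₕ β) ∎
      where
      open ≡-Reasoning
      s+i : ℍ
      s+i = ⟨ + s , 1ℤ , 0ℤ , 0ℤ ⟩

    assoc⇒≋ : ∀ {s β} → P ∣ₕ conj (line a b s) *ₕ β → conj γ *ₕ (iₕ *ₕ β) ≋ + s · (conj γ *ₕ β)
    assoc⇒≋ {s} {β} p∣ = ≋-sym (≋-trans (≋-reflexive (trans (sym (line-eq s β)) (+ₕ-comm _ _))) (+ₕ-≋ _ p∣))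

    ≋⇒assoc : ∀ {s β} → conj γ *ₕ (iₕ *ₕ β) ≋ + s · (conj γ *ₕ β) → P ∣ₕ conj (line a b s) *ₕ β
    ≋⇒assoc {s} {β} (congruent k eq) = divides (ℤ.-1ℤ · k) (lem (conj (line a b s) *ₕ β) k
      (line-eq s β) eq)
      where
      lem : ∀ x {q r} k → x +ₕ q ≡ r → q ≡ r +ₕ P · k → x ≡ P · (ℤ.-1ℤ · k)
      lem x {q} {r} k x+q≡r q≡r+k = +-cancel q (trans (+ₕ-comm q x) (trans x+q≡r
        (trans (sym (·-inverse P r k)) (cong (_+ₕ P · (ℤ.-1ℤ · k)) (sym q≡r+k)))))

    P∣iβ⇒P∣β : ∀ {β} → P ∣ₕ iₕ *ₕ β → P ∣ₕ β
    P∣iβ⇒P∣β {β} p∣iβ = subst (P ∣ₕ_) (trans (conj-*ˡ iₕ β) (trans (cong (_· β) N-iₕ) (·-identity β))) (∣ₕ-*ˡ (conj iₕ) p∣iβ)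
      where
      N-iₕ : N iₕ ≡ 1ℤ
      N-iₕ = sym (+-deg iₕ)

    -- If `conj γ *ₕ β` is nonzero modulo `P`, `sandwich` makes `conj γ *ₕ (iₕ *ₕ β)` a multiple of
    -- it, and the multiplier is the one index `s`. If it vanishes, γ is the line; a further line
    -- would make `conj γ *ₕ (iₕ *ₕ β)` vanish too, and the anticommutator would then force
    -- `P ∣ₕ β`, impossible for norm p.
    unique-line : ∀ {β} → β ∈ quaternions p → count (λ α → assoc? α β) lines ≡ 1
    unique-line {β} β∈ with assoc? γ β
    ... | yes p∣γβ = cong suc (trans (count-map (λ α → assoc? α β) (line a b) (upTo p))
      (cong length (filter-none (λ s → assoc? (line a b s) β) {upTo p} (All.tabulate λ _ p∣ →
        P∤norm-p deg-β (P∣iβ⇒P∣β (∣ₕ-cancel (∤-< (s≤s z≤n) 2<p) (iₕ *ₕ β)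
          (subst (P ∣ₕ_) (iₕ-anticommutator a b β) (∣ₕ-+ (∣ₕ-*ˡ iₕ p∣γβ)
            (∣ₕ-resp-≋ (assoc⇒≋ p∣) (∣ₕ-· _ p∣γβ))))))))))
      where
      deg-β : deg β ≡ p
      deg-β = ∈-quaternions⁻ β∈
    ... | no p∤γβ with s , t , p∤t , tq≋sp ← sandwich γ iₕ β P∣Nγ (P∣N (∈-quaternions⁻ β∈)) p∤γβ
      with r , r<p , q≋rp ← scalar-solve p∤t tq≋sp =
      trans (count-map (λ α → assoc? α β) (line a b) (upTo p))
        (count-unique (λ s → assoc? (line a b s) β) (Unique.upTo⁺ p) (∈-upTo⁺ r<p) (≋⇒assoc q≋rp)
          (λ s∈ p∣ → ·-injective-mod p∤γβ (∈-upTo⁻ s∈) r<p (≋-trans (≋-sym (assoc⇒≋ p∣)) q≋rp)))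

    r₄-prime-isotropic : r₄ p ≡ suc p ℕ.* 8
    r₄-prime-isotropic = begin
      r₄ p                           ≡⟨ length-quaternions p ⟨
      length (quaternions p)         ≡⟨ ℕ.*-identityʳ _ ⟨
      length (quaternions p) ℕ.* 1
        ≡⟨ double-count assoc? lines (quaternions p) line-associates unique-line ⟨
      length lines ℕ.* 8
        ≡⟨ cong (λ n → suc n ℕ.* 8) (trans (length-map (line a b) (upTo p)) (length-upTo p)) ⟩
      suc p ℕ.* 8                    ∎
      where open ≡-Reasoning

-- Four squares: existence of an isotropic vector and r₄(pn) modulo p

module FourSquares {p : ℕ} (pr : Prime p) (odd : p ≢ 2) where

  open Lines pr odd
  open Counting pr odd

  residue : ℤ → Fin p
  residue a = fromℕ< (ℤ.n%ℕd<d a p)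

  residue-∣ : ∀ a b → residue a ≡ residue b → P ∣ℤ a ℤ.- b
  residue-∣ a b eq = ℤ∣.divides (a ℤ./ℕ p - b ℤ./ℕ p) (begin
    a - b                                            ≡⟨ cong₂ _-_ (ℤ.a≡a%ℕn+[a/ℕn]*n a p) (ℤ.a≡a%ℕn+[a/ℕn]*n b p) ⟩
    (+ (a ℤ.%ℕ p) + a ℤ./ℕ p * P) - (+ (b ℤ.%ℕ p) + b ℤ./ℕ p * P)
      ≡⟨ cong (λ r → (+ (a ℤ.%ℕ p) + a ℤ./ℕ p * P) - (+ r + b ℤ./ℕ p * P)) (sym r≡) ⟩
    (+ (a ℤ.%ℕ p) + a ℤ./ℕ p * P) - (+ (a ℤ.%ℕ p) + b ℤ./ℕ p * P)
      ≡⟨ lem (+ (a ℤ.%ℕ p)) (a ℤ./ℕ p) (b ℤ./ℕ p) P ⟩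
    (a ℤ./ℕ p - b ℤ./ℕ p) * P                        ∎)
    where
    open ≡-Reasoning
    open ℤ-ops using (_+_; _*_; _-_)
    lem : ∀ r q s p → (r + q * p) - (r + s * p) ≡ (q - s) * p
    lem = solve-∀
    r≡ : a ℤ.%ℕ p ≡ b ℤ.%ℕ p
    r≡ = trans (sym (Fin.toℕ-fromℕ< _)) (trans (cong toℕ eq) (Fin.toℕ-fromℕ< _))

  -- The (p + 1)/2 squares and the (p + 1)/2 values -1 - y² cannot all be
  -- distinct modulo p.
  isotropic-vector : ∃₂ λ a b → P ∣ℤ 1ℤ ℤ.+ a ℤ.* a ℤ.+ b ℤ.* b
  isotropic-vector =
    let h , p≡ = odd-half pr odd
        i , j , i<j , eq = Fin.pigeonhole (p<2h+2 h p≡) (value h)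
    in collide h p≡ (splitAt (suc h) i) (splitAt (suc h) j)
         (λ si≡sj → ℕ.<⇒≢ i<j (cong toℕ (splitAt-injective h i j si≡sj))) eq
    where
    open ℤ-ops using (_+_; _*_; _-_; -_; -1ℤ)
    half-value : ∀ {h} → Fin (suc h) ⊎ Fin (suc h) → ℤ
    half-value (inj₁ x) = + toℕ x * + toℕ x
    half-value (inj₂ y) = -1ℤ - + toℕ y * + toℕ y
    value : ∀ h → Fin (suc h ℕ.+ suc h) → Fin p
    value h i = residue (half-value (splitAt (suc h) i))
    p<2h+2 : ∀ h → p ≡ suc (2 ℕ.* h) → p < suc h ℕ.+ suc h
    p<2h+2 h refl = s≤s (ℕ.≤-reflexive (lem h))
      where
      lem : ∀ h → suc (2 ℕ.* h) ≡ h ℕ.+ suc h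
      lem = ℕ-solver.solve-∀
    splitAt-injective : ∀ h i j → splitAt (suc h) {suc h} i ≡ splitAt (suc h) j → i ≡ j
    splitAt-injective h i j eq = trans (sym (Fin.join-splitAt (suc h) (suc h) i))
      (trans (cong (Fin.join (suc h) (suc h)) eq) (Fin.join-splitAt (suc h) (suc h) j))
    factor : ∀ x y → x * x - y * y ≡ (x - y) * (x + y)
    factor = solve-∀
    -- Both entries are at most h, so their sum is at most 2h < p and can be divisible by p only if
    -- both are 0.
    square-injective : ∀ h → p ≡ suc (2 ℕ.* h) → (x y : Fin (suc h)) →
      P ∣ℤ + toℕ x * + toℕ x - + toℕ y * + toℕ y → x ≡ y
    square-injective h p≡ x y p∣
      with ∣-split (+ toℕ x - + toℕ y) (+ toℕ x + + toℕ y) (subst (P ∣ℤ_) (factor (+ toℕ x) (+ toℕ y)) p∣)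
    ... | inj₁ p∣x-y = Fin.toℕ-injective (residue-unique (small x) (small y) p∣x-y)
      where
      small : ∀ (x : Fin (suc h)) → toℕ x < p
      small x = ℕ.<-≤-trans (Fin.toℕ<n x) (ℕ.≤-trans (s≤s (ℕ.m≤m+n h _)) (ℕ.≤-reflexive (sym p≡)))
    ... | inj₂ p∣x+y with toℕ x ℕ.+ toℕ y in eq
    ...   | zero  = Fin.toℕ-injective (trans (ℕ.m+n≡0⇒m≡0 (toℕ x) eq) (sym (ℕ.m+n≡0⇒n≡0 (toℕ x) eq)))
    ...   | suc n = contradiction (ℤ∣.∣⇒∣ᵤ p∣x+y) (ℕ∣.>⇒∤ (subst (_< p) eq
              (ℕ.≤-<-trans (ℕ.+-mono-≤ (ℕ.s≤s⁻¹ (Fin.toℕ<n x)) (ℕ.s≤s⁻¹ (Fin.toℕ<n y)))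
                (ℕ.≤-reflexive (trans (cong (λ z → suc (h ℕ.+ z)) (sym (ℕ.+-identityʳ h))) (sym p≡))))))
    collide : ∀ h → p ≡ suc (2 ℕ.* h) → (u v : Fin (suc h) ⊎ Fin (suc h)) → u ≢ v →
      residue (half-value u) ≡ residue (half-value v) → ∃₂ λ a b → P ∣ℤ 1ℤ + a * a + b * b
    collide h p≡ (inj₁ x) (inj₁ y) u≢v eq =
      contradiction (cong inj₁ (square-injective h p≡ x y (residue-∣ (half-value {h} (inj₁ x)) (half-value {h} (inj₁ y)) eq))) u≢v
    collide h p≡ (inj₂ x) (inj₂ y) u≢v eq =
      contradiction (cong inj₂ (sym (square-injective h p≡ y x
        (subst (P ∣ℤ_) (lem (+ toℕ x) (+ toℕ y)) (residue-∣ (-1ℤ - + toℕ x * + toℕ x) (-1ℤ - + toℕ y * + toℕ y) eq))))) u≢v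
      where
      lem : ∀ x y → (-1ℤ - x * x) - (-1ℤ - y * y) ≡ y * y - x * x
      lem = solve-∀
    collide h p≡ (inj₁ x) (inj₂ y) u≢v eq = + toℕ x , + toℕ y ,
      subst (P ∣ℤ_) (lem (+ toℕ x) (+ toℕ y)) (residue-∣ (+ toℕ x * + toℕ x) (-1ℤ - + toℕ y * + toℕ y) eq)
      where
      lem : ∀ x y → x * x - (-1ℤ - y * y) ≡ 1ℤ + x * x + y * y
      lem = solve-∀
    collide h p≡ (inj₂ y) (inj₁ x) u≢v eq = + toℕ x , + toℕ y ,
      subst (P ∣ℤ_) (lem (+ toℕ x) (+ toℕ y)) (ℤ∣.∣m⇒∣-m (residue-∣ (-1ℤ - + toℕ y * + toℕ y) (+ toℕ x * + toℕ x) eq))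
      where
      lem : ∀ x y → - ((-1ℤ - y * y) - x * x) ≡ 1ℤ + x * x + y * y
      lem = solve-∀

  r₄-prime : r₄ p ≡ suc p ℕ.* 8
  r₄-prime with a , b , isotropic ← isotropic-vector = r₄-prime-isotropic a b isotropic

  -- Let `e` count the `y` of norm pn that are divisible by p. Each of the 8 (p + 1) elements `β` of
  -- norm p divides r₄(n) of the `y`, among them all `e` divisible ones; each remaining `y` has 8
  -- such divisors. Hence (p + 1) k elements remain, with k = r₄(n) - e, and the total (p + 1) k + e
  -- equals r₄(n) + p k.
  r₄-multiple : ∀ n → ∃[ k ] r₄ (p ℕ.* n) ≡ r₄ n ℕ.+ p ℕ.* k
  r₄-multiple n = k , (begin
    r₄ (p ℕ.* n)             ≡⟨ total ⟩
    length Y′ ℕ.+ e          ≡⟨ cong (ℕ._+ e) length-Y′ ⟩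
    suc p ℕ.* k ℕ.+ e        ≡⟨ lem p k e ⟩
    k ℕ.+ e ℕ.+ p ℕ.* k      ≡⟨ cong (ℕ._+ p ℕ.* k) split ⟨
    r₄ n ℕ.+ p ℕ.* k         ∎)
    where
    open ≡-Reasoning
    lem : ∀ p k e → suc p ℕ.* k ℕ.+ e ≡ k ℕ.+ e ℕ.+ p ℕ.* k
    lem = ℕ-solver.solve-∀
    Y : List ℍ
    Y = quaternions (p ℕ.* n)
    e k : ℕ
    e = count (P ∣ₕ?_) Y
    k = r₄ n ℕ.∸ e
    Y′ : List ℍ
    Y′ = filter (¬? ∘ (P ∣ₕ?_)) Y
    total : r₄ (p ℕ.* n) ≡ length Y′ ℕ.+ e
    total = trans (sym (length-quaternions (p ℕ.* n))) (trans (sym (count-split (P ∣ₕ?_) Y)) (ℕ.+-comm e (length Y′)))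
    row : ∀ {β} → β ∈ quaternions p → count (λ y → assoc? y β) Y′ ℕ.+ e ≡ r₄ n
    row {β} β∈ = trans (count-filter (λ y → assoc? y β) (P ∣ₕ?_) Y (λ p∣y → ∣ₕ-*ʳ β (∣ₕ-conj p∣y)))
      (multiples (∈-quaternions⁻ β∈))
    rows : ∀ {β} → β ∈ quaternions p → count (λ y → assoc? y β) Y′ ≡ k
    rows β∈ = trans (sym (ℕ.m+n∸n≡m _ e)) (cong (ℕ._∸ e) (row β∈))
    columns : ∀ {y} → y ∈ Y′ → count (assoc? y) (quaternions p) ≡ 8
    columns {y} y∈′ with y∈ , p∤y ← ∈-filter⁻ (¬? ∘ (P ∣ₕ?_)) {xs = Y} y∈′ =
      associates y p∤y (∣deg⇒∣N y (ℕ∣.divides n (trans (∈-quaternions⁻ y∈) (ℕ.*-comm p n))))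
    length-Y′ : length Y′ ≡ suc p ℕ.* k
    length-Y′ = ℕ.*-cancelʳ-≡ _ _ 8 (begin
      length Y′ ℕ.* 8              ≡⟨ double-count (λ β y → assoc? y β) (quaternions p) Y′ rows columns ⟨
      length (quaternions p) ℕ.* k ≡⟨ cong (ℕ._* k) (trans (length-quaternions p) r₄-prime) ⟩
      suc p ℕ.* 8 ℕ.* k            ≡⟨ lem₈ (suc p) k ⟩
      suc p ℕ.* k ℕ.* 8            ∎)
      where
      lem₈ : ∀ m k → m ℕ.* 8 ℕ.* k ≡ m ℕ.* k ℕ.* 8
      lem₈ = ℕ-solver.solve-∀
    -- `k` is a truncated difference. That `e` does not exceed `r₄ n` is read off the row of an
    -- actual `β`, which exists because `r₄ p` is positive.
    split : r₄ n ≡ k ℕ.+ e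
    split = go (quaternions p) refl
      where
      go : ∀ βs → quaternions p ≡ βs → r₄ n ≡ k ℕ.+ e
      go []      eq = contradiction (trans (sym r₄-prime) (trans (sym (length-quaternions p)) (cong length eq))) λ ()
      go (β ∷ _) eq = sym (ℕ.m∸n+n≡m (subst (e ≤_) (row (subst (β ∈_) (sym eq) (here refl))) (ℕ.m≤n+m e _)))

-- Three squares: pure quaternions and r₃(p²n)

module ThreeSquares {p : ℕ} (pr : Prime p) (odd : p ≢ 2) where

  open FourSquares pr odd
  open Counting pr odd

  pure-conj : ∀ {x} β → IsPure x → IsPure (β *ₕ (x *ₕ conj β))
  pure-conj {x} β pure = begin
    conj (β *ₕ (x *ₕ conj β))               ≡⟨ conj-* β (x *ₕ conj β) ⟩
    conj (x *ₕ conj β) *ₕ conj β            ≡⟨ cong (_*ₕ conj β) (trans (conj-* x (conj β)) (cong (_*ₕ conj x) (conj-involutive β))) ⟩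
    (β *ₕ conj x) *ₕ conj β                 ≡⟨ *ₕ-assoc β (conj x) (conj β) ⟩
    β *ₕ (conj x *ₕ conj β)                 ≡⟨ cong (λ z → β *ₕ (z *ₕ conj β)) pure ⟩
    β *ₕ ((ℤ.-1ℤ · x) *ₕ conj β)            ≡⟨ cong (β *ₕ_) (·-*ˡ ℤ.-1ℤ x (conj β)) ⟩
    β *ₕ (ℤ.-1ℤ · (x *ₕ conj β))            ≡⟨ ·-*ʳ ℤ.-1ℤ β (x *ₕ conj β) ⟩
    ℤ.-1ℤ · (β *ₕ (x *ₕ conj β))            ∎
    where open ≡-Reasoning

  pure-quotient : ∀ m .{{_ : ℤ.NonZero m}} x → IsPure (m · x) → IsPure x
  pure-quotient m x pure = ·-cancelˡ m (conj x) (ℤ.-1ℤ · x)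
    (trans (sym (conj-· m x)) (trans pure (·-comm ℤ.-1ℤ m x)))

  pure-* : ∀ {y} β → IsPure y → y *ₕ β ≡ ℤ.-1ℤ · (conj y *ₕ β)
  pure-* {y} β pure = begin
    y *ₕ β                                  ≡⟨ ·-identity _ ⟨
    1ℤ · (y *ₕ β)                           ≡⟨ ·-assoc ℤ.-1ℤ ℤ.-1ℤ (y *ₕ β) ⟨
    ℤ.-1ℤ · (ℤ.-1ℤ · (y *ₕ β))              ≡⟨ cong (ℤ.-1ℤ ·_) (·-*ˡ ℤ.-1ℤ y β) ⟨
    ℤ.-1ℤ · ((ℤ.-1ℤ · y) *ₕ β)              ≡⟨ cong (λ z → ℤ.-1ℤ · (z *ₕ β)) pure ⟨
    ℤ.-1ℤ · (conj y *ₕ β)                   ∎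
    where open ≡-Reasoning

  pure-square : ∀ {y} β → IsPure y → y *ₕ (y *ₕ β) ≡ (ℤ.- N y) · β
  pure-square {y} β pure = begin
    y *ₕ (y *ₕ β)                           ≡⟨ pure-* (y *ₕ β) pure ⟩
    ℤ.-1ℤ · (conj y *ₕ (y *ₕ β))            ≡⟨ cong (ℤ.-1ℤ ·_) (conj-*ˡ y β) ⟩
    ℤ.-1ℤ · (N y · β)                       ≡⟨ ·-assoc ℤ.-1ℤ (N y) β ⟩
    (ℤ.-1ℤ ℤ.* N y) · β                     ≡⟨ cong (_· β) (ℤ.-1*i≡-i (N y)) ⟩
    (ℤ.- N y) · β                           ∎
    where open ≡-Reasoning

  module _ (n : ℕ) (nonresidue : ∀ u → ¬ P ∣ℤ u ℤ.* u ℤ.+ + n) where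

    -- The eigenvalue arises as a fraction s/t; multiplying by the square of an inverse of `t`
    -- modulo `P` reduces the claim to `nonresidue`.
    nonresidue-scaled : ∀ s t → ¬ P ∣ℤ t → ¬ P ∣ℤ s ℤ.* s ℤ.+ t ℤ.* t ℤ.* + n
    nonresidue-scaled s t p∤t p∣ with u , k , tu≡ ← inverse t p∤t = nonresidue (s * u)
      (ℤ∣.∣m+n∣n⇒∣m (subst (P ∣ℤ_) eq (ℤ∣.∣n⇒∣m*n (u * u) p∣)) (ℤ∣.∣m⇒∣m*n _ ℤ∣.∣-refl))
      where
      open ℤ-ops using (_+_; _*_)
      lem₁ : ∀ s t u n → u * u * (s * s + t * t * n) ≡ (s * u) * (s * u) + (t * u) * (t * u) * n
      lem₁ = solve-∀
      lem₂ : ∀ q p k n → q + (1ℤ + p * k) * (1ℤ + p * k) * n ≡ q + n + p * ((k + k + k * p * k) * n)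
      lem₂ = solve-∀
      eq : u * u * (s * s + t * t * + n) ≡ s * u * (s * u) + + n + P * ((k + k + k * P * k) * + n)
      eq = trans (lem₁ s t u (+ n)) (trans (cong (λ z → s * u * (s * u) + z * z * + n) tu≡) (lem₂ (s * u * (s * u)) P k (+ n)))

    -- `eigenvector` yields t y β ≡ s β modulo `P`. Applied twice, with y² = -n for pure `y`, this
    -- gives (s² + t² n) β ≡ 0. The coefficient is prime to p because -n is a nonresidue, and an
    -- element of norm p is not divisible by p.
    no-eigenvector : ∀ {y β} → IsPure y → deg y ≡ n → deg β ≡ p → ¬ P ∣ₕ conj β *ₕ (y *ₕ β)
    no-eigenvector {y} {β} pure deg-y deg-β p∣
      with s , t , p∤t , tyβ≋sβ ← eigenvector y β (P∣N deg-β) (P∤norm-p deg-β) p∣ =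
      contradiction (∣ₕ-cancel (nonresidue-scaled s t p∤t) β P∣) (P∤norm-p deg-β)
      where
      open ℤ-ops using (_+_; _*_; -_)
      squared : t · (t · (y *ₕ (y *ₕ β))) ≋ s · (s · β)
      squared = ≋-trans (·-cong t (≋-trans (≋-reflexive (sym (·-*ʳ t y (y *ₕ β))))
          (≋-trans (*ₕ-congˡ y tyβ≋sβ) (≋-reflexive (·-*ʳ s y β)))))
        (≋-trans (≋-reflexive (·-comm t s (y *ₕ β))) (·-cong s tyβ≋sβ))
      -n : N y ≡ + n
      -n = trans (sym (+-deg y)) (cong +_ deg-y)
      squared′ : (t * t * (- + n)) · β ≋ (s * s) · β
      squared′ = ≋-trans (≋-reflexive (sym (trans (cong (λ z → t · (t · z))
            (trans (pure-square β pure) (cong (λ z → (- z) · β) -n)))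
          (trans (·-assoc t t _) (·-assoc (t * t) (- + n) β)))))
        (≋-trans squared (≋-reflexive (·-assoc s s β)))
      collect : ∀ s t n x {y} → y ≡ (s * s) · x → y +ₕ (t * t * n) · x ≡ (s * s + t * t * n) · x
      collect s t n x refl = sym (·-distribʳ (s * s) (t * t * n) x)
      vanish : ∀ t n x → (t * t * (- n)) · x +ₕ (t * t * n) · x ≡ 0ℤ · x
      vanish t n x = trans (sym (·-distribʳ (t * t * (- n)) (t * t * n) x)) (cong (_· x) (lem t n))
        where
        lem : ∀ t n → t * t * (- n) + t * t * n ≡ 0ℤ
        lem = solve-∀
      P∣ : P ∣ₕ (s * s + t * t * + n) · β
      P∣ = ∣ₕ-resp-≋ (≋-trans (≋-reflexive (sym (collect s t (+ n) β refl))) (+-congʳ _ (≋-sym squared′)))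
        (subst (P ∣ₕ_) (sym (vanish t (+ n) β)) (∣ₕ-scalar β (ℤ∣.divides 0ℤ refl)))

    Y Y′ : List ℍ
    Y  = pures (p ℕ.* p ℕ.* n)
    Y′ = filter (¬? ∘ (P ∣ₕ?_)) Y

    imprimitive : count (P ∣ₕ?_) Y ≡ r₃ n
    imprimitive = trans (sym (length-bijection (P ·_) (·-cancelˡ P _ _) (pures-unique n)
        (Unique.filter⁺ (P ∣ₕ?_) (pures-unique (p ℕ.* p ℕ.* n))) into onto)) (length-pures n)
      where
      into : ∀ {x} → x ∈ pures n → P · x ∈ filter (P ∣ₕ?_) Y
      into {x} x∈ with pure , deg-x ← ∈-pures⁻ x∈ = ∈-filter⁺ (P ∣ₕ?_)
        (∈-pures⁺ (P · x) (trans (conj-· P x) (trans (cong (P ·_) pure) (·-comm P ℤ.-1ℤ x)))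
          (trans (deg-· p x) (cong (p ℕ.* p ℕ.*_) deg-x)))
        (∣ₕ-multiple x)
      onto : ∀ {y} → y ∈ filter (P ∣ₕ?_) Y → ∃[ x ] x ∈ pures n × y ≡ P · x
      onto y∈′ with y∈ , divides x refl ← ∈-filter⁻ (P ∣ₕ?_) {xs = Y} y∈′
        with pure , deg-y ← ∈-pures⁻ y∈ =
        x , ∈-pures⁺ x (pure-quotient P x pure)
              (ℕ.*-cancelˡ-≡ _ _ (p ℕ.* p) {{ℕ.m*n≢0 p p}} (trans (sym (deg-· p x)) deg-y)) , refl

    rows : ∀ {β} → β ∈ quaternions p → count (λ y → assoc? y β) Y′ ≡ r₃ n
    rows {β} β∈ = trans (sym (length-bijection rotate rotate-injective (pures-unique n)
        (Unique.filter⁺ (λ y → assoc? y β) (Unique.filter⁺ (¬? ∘ (P ∣ₕ?_)) (pures-unique (p ℕ.* p ℕ.* n))))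
        into onto)) (length-pures n)
      where
      open ≡-Reasoning
      deg-β : deg β ≡ p
      deg-β = ∈-quaternions⁻ β∈
      rotate : ℍ → ℍ
      rotate x = β *ₕ (x *ₕ conj β)
      rotate-injective : ∀ {x y} → rotate x ≡ rotate y → x ≡ y
      rotate-injective eq = deg≢0-cancelʳ (conj β) {{deg-nonZero {conj β} (trans (deg-conj β) deg-β)}}
        (deg≢0-cancelˡ β {{deg-nonZero {β} deg-β}} eq)
      deg-rotate : ∀ x → deg (rotate x) ≡ p ℕ.* p ℕ.* deg x
      deg-rotate x = begin
        deg (β *ₕ (x *ₕ conj β))          ≡⟨ deg-* β (x *ₕ conj β) ⟩
        deg β ℕ.* deg (x *ₕ conj β)       ≡⟨ cong (deg β ℕ.*_) (deg-* x (conj β)) ⟩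
        deg β ℕ.* (deg x ℕ.* deg (conj β)) ≡⟨ cong₂ (λ a b → a ℕ.* (deg x ℕ.* b)) deg-β (trans (deg-conj β) deg-β) ⟩
        p ℕ.* (deg x ℕ.* p)               ≡⟨ lem p (deg x) ⟩
        p ℕ.* p ℕ.* deg x                 ∎
        where
        lem : ∀ p d → p ℕ.* (d ℕ.* p) ≡ p ℕ.* p ℕ.* d
        lem = ℕ-solver.solve-∀
      rotate-* : ∀ x → rotate x *ₕ β ≡ P · (β *ₕ x)
      rotate-* x = begin
        (β *ₕ (x *ₕ conj β)) *ₕ β         ≡⟨ *ₕ-assoc β (x *ₕ conj β) β ⟩
        β *ₕ ((x *ₕ conj β) *ₕ β)         ≡⟨ cong (β *ₕ_) (trans (conj-*ʳ x β) (cong (_· x) (N≡P deg-β))) ⟩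
        β *ₕ (P · x)                      ≡⟨ ·-*ʳ P β x ⟩
        P · (β *ₕ x)                      ∎
      into : ∀ {x} → x ∈ pures n → rotate x ∈ filter (λ y → assoc? y β) Y′
      into {x} x∈ with pure , deg-x ← ∈-pures⁻ x∈ = ∈-filter⁺ (λ y → assoc? y β)
        (∈-filter⁺ (¬? ∘ (P ∣ₕ?_))
          (∈-pures⁺ (rotate x) pure′ deg-y) P∤rotate)
        (subst (P ∣ₕ_) (sym conj-rotate-*) (∣ₕ-· ℤ.-1ℤ (∣ₕ-multiple (β *ₕ x))))
        where
        pure′ : IsPure (rotate x)
        pure′ = pure-conj β pure
        deg-y : deg (rotate x) ≡ p ℕ.* p ℕ.* n
        deg-y = trans (deg-rotate x) (cong (p ℕ.* p ℕ.*_) deg-x)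
        conj-rotate-* : conj (rotate x) *ₕ β ≡ ℤ.-1ℤ · (P · (β *ₕ x))
        conj-rotate-* = trans (cong (_*ₕ β) pure′) (trans (·-*ˡ ℤ.-1ℤ (rotate x) β) (cong (ℤ.-1ℤ ·_) (rotate-* x)))
        P∤rotate : ¬ P ∣ₕ rotate x
        -- From β x β̄ = P y follows y β = β x, hence β̄ y β = P x, so that `β` would be an
        -- eigenvector of `y` modulo p.
        P∤rotate (divides y eq) = no-eigenvector
          (pure-quotient P y (subst IsPure eq pure′))
          (ℕ.*-cancelˡ-≡ _ _ (p ℕ.* p) {{ℕ.m*n≢0 p p}} (trans (sym (deg-· p y)) (trans (cong deg (sym eq)) deg-y)))
          deg-β
          (subst (λ z → P ∣ₕ conj β *ₕ z) (sym yβ≡βx)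
            (subst (P ∣ₕ_) (sym (trans (conj-*ˡ β x) (cong (_· x) (N≡P deg-β)))) (∣ₕ-multiple x)))
          where
          yβ≡βx : y *ₕ β ≡ β *ₕ x
          yβ≡βx = ·-cancelˡ P _ _ (trans (sym (·-*ˡ P y β)) (trans (cong (_*ₕ β) (sym eq)) (rotate-* x)))
      -- This is where p² ∣ N(y) is needed: ȳ y β = p² n β and y β = p w leave a factor p in ȳ w
      -- after cancelling one.
      conj-annihilates : ∀ {y} w → deg y ≡ p ℕ.* p ℕ.* n → y *ₕ β ≡ P · w → P ∣ₕ conj y *ₕ w
      conj-annihilates {y} w deg-y yβ≡ = divides (+ n · β) (·-cancelˡ P _ _ (begin
        P · (conj y *ₕ w)        ≡⟨ ·-*ʳ P (conj y) w ⟨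
        conj y *ₕ (P · w)        ≡⟨ cong (conj y *ₕ_) yβ≡ ⟨
        conj y *ₕ (y *ₕ β)       ≡⟨ conj-*ˡ y β ⟩
        N y · β                  ≡⟨ cong (_· β) (trans (sym (+-deg y)) (trans (cong +_ deg-y)
                                      (trans (ℤ.pos-* (p ℕ.* p) n) (cong (ℤ._* + n) (ℤ.pos-* p p))))) ⟩
        (P ℤ.* P ℤ.* + n) · β    ≡⟨ trans (cong (_· β) (ℤ.*-assoc P P (+ n))) (sym (·-assoc P (P ℤ.* + n) β)) ⟩
        P · ((P ℤ.* + n) · β)    ≡⟨ cong (P ·_) (·-assoc P (+ n) β) ⟨
        P · (P · (+ n · β))      ∎))
      rotate-preimage : ∀ {y} w x → IsPure y → deg y ≡ p ℕ.* p ℕ.* n → y *ₕ β ≡ P · w → conj β *ₕ w ≡ P · x →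
                        x ∈ pures n × y ≡ rotate x
      rotate-preimage {y} w x pure deg-y yβ≡ βw≡ = ∈-pures⁺ x
          (pure-quotient P x (pure-quotient P (P · x) (subst IsPure (sym P²x) pure-β̄yβ)))
          (ℕ.*-cancelˡ-≡ _ _ (p ℕ.* p) {{ℕ.m*n≢0 p p}} (trans (sym (deg-rotate x)) (trans (cong deg (sym y≡)) deg-y))) ,
          y≡
        where
        P²x : P · (P · x) ≡ conj β *ₕ (y *ₕ β)
        P²x = begin
          P · (P · x)              ≡⟨ cong (P ·_) βw≡ ⟨
          P · (conj β *ₕ w)        ≡⟨ ·-*ʳ P (conj β) w ⟨
          conj β *ₕ (P · w)        ≡⟨ cong (conj β *ₕ_) yβ≡ ⟨
          conj β *ₕ (y *ₕ β)       ∎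
        pure-β̄yβ : IsPure (conj β *ₕ (y *ₕ β))
        pure-β̄yβ = subst (λ z → IsPure (conj β *ₕ (y *ₕ z))) (conj-involutive β) (pure-conj (conj β) pure)
        y≡ : y ≡ rotate x
        y≡ = ·-cancelˡ P _ _ (·-cancelˡ P _ _ (sym (begin
          P · (P · (β *ₕ (x *ₕ conj β)))          ≡⟨ cong (P ·_) (·-*ʳ P β _) ⟨
          P · (β *ₕ (P · (x *ₕ conj β)))          ≡⟨ ·-*ʳ P β _ ⟨
          β *ₕ (P · (P · (x *ₕ conj β)))          ≡⟨ cong (λ z → β *ₕ (P · z)) (·-*ˡ P x (conj β)) ⟨
          β *ₕ (P · ((P · x) *ₕ conj β))          ≡⟨ cong (β *ₕ_) (·-*ˡ P (P · x) (conj β)) ⟨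
          β *ₕ ((P · (P · x)) *ₕ conj β)          ≡⟨ cong (λ z → β *ₕ (z *ₕ conj β)) P²x ⟩
          β *ₕ ((conj β *ₕ (y *ₕ β)) *ₕ conj β)   ≡⟨ cong (β *ₕ_) (*ₕ-assoc (conj β) (y *ₕ β) (conj β)) ⟩
          β *ₕ (conj β *ₕ ((y *ₕ β) *ₕ conj β))   ≡⟨ *-conjˡ β _ ⟩
          N β · ((y *ₕ β) *ₕ conj β)              ≡⟨ cong (N β ·_) (*-conjʳ y β) ⟩
          N β · (N β · y)                         ≡⟨ cong (λ z → z · (z · y)) (N≡P deg-β) ⟩
          P · (P · y)                             ∎)))
      onto : ∀ {y} → y ∈ filter (λ y → assoc? y β) Y′ → ∃[ x ] x ∈ pures n × y ≡ rotate x
      onto {y} y∈″ with y∈′ , yβ ← ∈-filter⁻ (λ y → assoc? y β) {xs = Y′} y∈″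
        with y∈ , p∤y ← ∈-filter⁻ (¬? ∘ (P ∣ₕ?_)) {xs = Y} y∈′
        with pure , deg-y ← ∈-pures⁻ y∈
        with divides w yβ≡ ← subst (P ∣ₕ_) (sym (pure-* β pure)) (∣ₕ-· ℤ.-1ℤ yβ)
        -- `β` and `w` are annihilated by the same `conj y` modulo `P`, and `y` is not divisible by
        -- p, so β̄ w = P x. Then β̄ y β = P² x, and enclosing this between β and β̄ recovers y = β
        -- x β̄.
        with divides x βw≡ ← annihilated-orthogonal y β w p∤y yβ (conj-annihilates w deg-y yβ≡) =
        x , rotate-preimage w x pure deg-y yβ≡ βw≡

    columns : ∀ {y} → y ∈ Y′ → count (assoc? y) (quaternions p) ≡ 8
    columns {y} y∈′ with y∈ , p∤y ← ∈-filter⁻ (¬? ∘ (P ∣ₕ?_)) {xs = Y} y∈′ =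
      associates y p∤y (∣deg⇒∣N y (ℕ∣.divides (p ℕ.* n) (trans (proj₂ (∈-pures⁻ y∈))
        (trans (ℕ.*-assoc p p n) (ℕ.*-comm p (p ℕ.* n))))))

    r₃-multiple : r₃ (p ℕ.* p ℕ.* n) ≡ (2 ℕ.+ p) ℕ.* r₃ n
    r₃-multiple = begin
      r₃ (p ℕ.* p ℕ.* n)              ≡⟨ length-pures (p ℕ.* p ℕ.* n) ⟨
      length Y                        ≡⟨ count-split (P ∣ₕ?_) Y ⟨
      count (P ∣ₕ?_) Y ℕ.+ length Y′  ≡⟨ cong₂ ℕ._+_ imprimitive length-Y′ ⟩
      r₃ n ℕ.+ suc p ℕ.* r₃ n         ∎
      where
      open ≡-Reasoning
      length-Y′ : length Y′ ≡ suc p ℕ.* r₃ n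
      length-Y′ = ℕ.*-cancelʳ-≡ _ _ 8 (begin
        length Y′ ℕ.* 8              ≡⟨ double-count (λ β y → assoc? y β) (quaternions p) Y′ rows columns ⟨
        length (quaternions p) ℕ.* r₃ n ≡⟨ cong (ℕ._* r₃ n) (trans (length-quaternions p) r₄-prime) ⟩
        suc p ℕ.* 8 ℕ.* r₃ n         ≡⟨ lem₈ (suc p) (r₃ n) ⟩
        suc p ℕ.* r₃ n ℕ.* 8         ∎)
        where
        lem₈ : ∀ m k → m ℕ.* 8 ℕ.* k ≡ m ℕ.* k ℕ.* 8
        lem₈ = ℕ-solver.solve-∀

-- From the Legendre symbol to nonresidues

legendre≡-1⇒nonsquare : ∀ a ℓ → legendre a ℓ ≡ ℤ.-1ℤ → ¬ IsSquareMod ℓ a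
legendre≡-1⇒nonsquare a ℓ eq with + ℓ ∣ℤ? a | isSquareMod? ℓ a
legendre≡-1⇒nonsquare a ℓ () | yes _ | _
legendre≡-1⇒nonsquare a ℓ () | no _  | yes _
legendre≡-1⇒nonsquare a ℓ _  | no _  | no ¬sq = ¬sq

-- `IsSquareMod` ranges over residues below ℓ only, so an arbitrary `u` is replaced by its
-- remainder.
nonsquare⇒nonresidue : ∀ ℓ .{{_ : ℕ.NonZero ℓ}} n → ¬ IsSquareMod ℓ (ℤ.- (+ n)) →
                       ∀ u → ¬ + ℓ ∣ℤ u ℤ.* u ℤ.+ + n
nonsquare⇒nonresidue ℓ n nonsquare u ℓ∣ = nonsquare (fromℕ< r<ℓ ,
  subst (λ r → + ℓ ∣ℤ + r * + r - (- + n)) (sym (Fin.toℕ-fromℕ< r<ℓ))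
    (ℤ∣.∣m+n∣n⇒∣m {m = + (u ℤ.%ℕ ℓ) * + (u ℤ.%ℕ ℓ) - (- + n)}
      (subst (+ ℓ ∣ℤ_) (trans (cong (λ z → z * z + + n) (ℤ.a≡a%ℕn+[a/ℕn]*n u ℓ))
        (lem (+ (u ℤ.%ℕ ℓ)) (u ℤ./ℕ ℓ) (+ ℓ) (+ n))) ℓ∣)
      (ℤ∣.∣m⇒∣m*n _ ℤ∣.∣-refl)))
  where
  open ℤ-ops using (_+_; _*_; _-_; -_)
  r<ℓ : u ℤ.%ℕ ℓ < ℓ
  r<ℓ = ℤ.n%ℕd<d u ℓ
  lem : ∀ r q p n → (r + q * p) * (r + q * p) + n ≡ (r * r - (- n)) + p * (r * q + r * q + q * q * p)
  lem = solve-∀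

-- Squares modulo 4 and r₃(4n)

sq-mod-4 : ∀ a → ∃[ k ] (sq a ≡ 4 ℕ.* k × + 2 ∣ℤ a ⊎ sq a ≡ 4 ℕ.* k ℕ.+ 1)
sq-mod-4 a with parity ℤ.∣ a ∣
... | h , inj₁ eq = h ℕ.* h , inj₁ (trans (cong (λ m → m ℕ.* m) eq) (lem h) ,
                                    ℤ∣.∣ᵤ⇒∣ (ℕ∣.divides h (trans eq (ℕ.*-comm 2 h))))
  where
  lem : ∀ h → 2 ℕ.* h ℕ.* (2 ℕ.* h) ≡ 4 ℕ.* (h ℕ.* h)
  lem = ℕ-solver.solve-∀
... | h , inj₂ eq = h ℕ.* h ℕ.+ h , inj₂ (trans (cong (λ m → m ℕ.* m) eq) (lem h))
  where
  lem : ∀ h → suc (2 ℕ.* h) ℕ.* suc (2 ℕ.* h) ≡ 4 ℕ.* (h ℕ.* h ℕ.+ h) ℕ.+ 1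
  lem = ℕ-solver.solve-∀

-- Squares are 0 or 1 modulo 4, so the number of odd entries is divisible by 4 and at most 3.
three-squares-mod-4 : ∀ a b c {m} → sq a ℕ.+ (sq b ℕ.+ sq c) ≡ 4 ℕ.* m →
                      + 2 ∣ℤ a × + 2 ∣ℤ b × + 2 ∣ℤ c
three-squares-mod-4 a b c {m} eq with i , ea ← sq-mod-4 a | j , eb ← sq-mod-4 b | k , ec ← sq-mod-4 c = go {i} {j} {k} ea eb ec
  where
  absurd : ∀ {x y z} e f g → sq a ≡ x ℕ.+ e → sq b ≡ y ℕ.+ f → sq c ≡ z ℕ.+ g →
           4 ℕ∣.∣ x → 4 ℕ∣.∣ y → 4 ℕ∣.∣ z → 4 ℕ∣.∣ e ℕ.+ (f ℕ.+ g)
  absurd {x} {y} {z} e f g ea eb ec 4∣x 4∣y 4∣z = ℕ∣.∣m+n∣m⇒∣n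
    (subst (4 ℕ∣.∣_) (trans (sym eq) (trans (cong₂ ℕ._+_ ea (cong₂ ℕ._+_ eb ec)) (lem x y z e f g)))
      (ℕ∣.m∣m*n m))
    (ℕ∣.∣m∣n⇒∣m+n 4∣x (ℕ∣.∣m∣n⇒∣m+n 4∣y 4∣z))
    where
    lem : ∀ x y z e f g → (x ℕ.+ e) ℕ.+ ((y ℕ.+ f) ℕ.+ (z ℕ.+ g)) ≡ (x ℕ.+ (y ℕ.+ z)) ℕ.+ (e ℕ.+ (f ℕ.+ g))
    lem = ℕ-solver.solve-∀
  4∣4* : ∀ k → 4 ℕ∣.∣ 4 ℕ.* k
  4∣4* k = ℕ∣.m∣m*n k
  even : ∀ {n} k → n ≡ 4 ℕ.* k → n ≡ 4 ℕ.* k ℕ.+ 0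
  even k eq = trans eq (sym (ℕ.+-identityʳ (4 ℕ.* k)))
  go : ∀ {i j k} → (sq a ≡ 4 ℕ.* i × + 2 ∣ℤ a ⊎ sq a ≡ 4 ℕ.* i ℕ.+ 1) →
       (sq b ≡ 4 ℕ.* j × + 2 ∣ℤ b ⊎ sq b ≡ 4 ℕ.* j ℕ.+ 1) →
       (sq c ≡ 4 ℕ.* k × + 2 ∣ℤ c ⊎ sq c ≡ 4 ℕ.* k ℕ.+ 1) → + 2 ∣ℤ a × + 2 ∣ℤ b × + 2 ∣ℤ c
  go (inj₁ (_ , 2∣a)) (inj₁ (_ , 2∣b)) (inj₁ (_ , 2∣c)) = 2∣a , 2∣b , 2∣c
  go {i} {j} {k} (inj₁ (ea , _)) (inj₁ (eb , _)) (inj₂ ec) = contradiction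
    (absurd {4 ℕ.* i} {4 ℕ.* j} {4 ℕ.* k} 0 0 1 (even i ea) (even j eb) ec (4∣4* i) (4∣4* j) (4∣4* k)) (ℕ∣.>⇒∤ (s≤s (s≤s z≤n)))
  go {i} {j} {k} (inj₁ (ea , _)) (inj₂ eb) (inj₁ (ec , _)) = contradiction
    (absurd {4 ℕ.* i} {4 ℕ.* j} {4 ℕ.* k} 0 1 0 (even i ea) eb (even k ec) (4∣4* i) (4∣4* j) (4∣4* k)) (ℕ∣.>⇒∤ (s≤s (s≤s z≤n)))
  go {i} {j} {k} (inj₁ (ea , _)) (inj₂ eb) (inj₂ ec) = contradiction
    (absurd {4 ℕ.* i} {4 ℕ.* j} {4 ℕ.* k} 0 1 1 (even i ea) eb ec (4∣4* i) (4∣4* j) (4∣4* k)) (ℕ∣.>⇒∤ (s≤s (s≤s (s≤s z≤n))))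
  go {i} {j} {k} (inj₂ ea) (inj₁ (eb , _)) (inj₁ (ec , _)) = contradiction
    (absurd {4 ℕ.* i} {4 ℕ.* j} {4 ℕ.* k} 1 0 0 ea (even j eb) (even k ec) (4∣4* i) (4∣4* j) (4∣4* k)) (ℕ∣.>⇒∤ (s≤s (s≤s z≤n)))
  go {i} {j} {k} (inj₂ ea) (inj₁ (eb , _)) (inj₂ ec) = contradiction
    (absurd {4 ℕ.* i} {4 ℕ.* j} {4 ℕ.* k} 1 0 1 ea (even j eb) ec (4∣4* i) (4∣4* j) (4∣4* k)) (ℕ∣.>⇒∤ (s≤s (s≤s (s≤s z≤n))))
  go {i} {j} {k} (inj₂ ea) (inj₂ eb) (inj₁ (ec , _)) = contradiction
    (absurd {4 ℕ.* i} {4 ℕ.* j} {4 ℕ.* k} 1 1 0 ea eb (even k ec) (4∣4* i) (4∣4* j) (4∣4* k)) (ℕ∣.>⇒∤ (s≤s (s≤s (s≤s z≤n))))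
  go {i} {j} {k} (inj₂ ea) (inj₂ eb) (inj₂ ec) = contradiction
    (absurd {4 ℕ.* i} {4 ℕ.* j} {4 ℕ.* k} 1 1 1 ea eb ec (4∣4* i) (4∣4* j) (4∣4* k)) (ℕ∣.>⇒∤ (s≤s (s≤s (s≤s (s≤s z≤n)))))

r₃-quadruple : ∀ m → r₃ (4 ℕ.* m) ≡ r₃ m
r₃-quadruple m = sym (length-bijection double double-injective (Graded.unique squares³ m)
    (Graded.unique squares³ (4 ℕ.* m)) (λ {x} → into {x}) (λ {y} → onto {y}))
  where
  double : ℤ × ℤ × ℤ → ℤ × ℤ × ℤ
  double (a , b , c) = a ℤ.* + 2 , b ℤ.* + 2 , c ℤ.* + 2
  halve-≡ : ∀ {a b} → a ℤ.* + 2 ≡ b ℤ.* + 2 → a ≡ b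
  halve-≡ {a} {b} = ℤ.*-cancelʳ-≡ a b (+ 2)
  double-injective : ∀ {x y} → double x ≡ double y → x ≡ y
  double-injective eq = cong₂ _,_ (halve-≡ (cong proj₁ eq))
    (cong₂ _,_ (halve-≡ (cong (proj₁ ∘ proj₂) eq)) (halve-≡ (cong (proj₂ ∘ proj₂) eq)))
  sq-double : ∀ a → sq (a ℤ.* + 2) ≡ 4 ℕ.* sq a
  sq-double a = trans (cong (λ m → m ℕ.* m) (ℤ.abs-* a (+ 2))) (lem ℤ.∣ a ∣)
    where
    lem : ∀ m → m ℕ.* 2 ℕ.* (m ℕ.* 2) ≡ 4 ℕ.* (m ℕ.* m)
    lem = ℕ-solver.solve-∀
  degree-double : ∀ x → Graded.degree squares³ (double x) ≡ 4 ℕ.* Graded.degree squares³ x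
  degree-double (a , b , c) = trans (cong₂ ℕ._+_ (sq-double a) (cong₂ ℕ._+_ (sq-double b) (sq-double c)))
    (lem (sq a) (sq b) (sq c))
    where
    lem : ∀ x y z → 4 ℕ.* x ℕ.+ (4 ℕ.* y ℕ.+ 4 ℕ.* z) ≡ 4 ℕ.* (x ℕ.+ (y ℕ.+ z))
    lem = ℕ-solver.solve-∀
  ∈-fibre : ∀ n x → Graded.degree squares³ x ≡ n → x ∈ Graded.fibre squares³ n
  ∈-fibre _ x refl = Graded.complete squares³ x
  into : ∀ {x} → x ∈ Graded.fibre squares³ m → double x ∈ Graded.fibre squares³ (4 ℕ.* m)
  into {x} x∈ = ∈-fibre (4 ℕ.* m) (double x) (trans (degree-double x) (cong (4 ℕ.*_) (Graded.sound squares³ {m} x∈)))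
  onto : ∀ {y} → y ∈ Graded.fibre squares³ (4 ℕ.* m) → ∃[ x ] x ∈ Graded.fibre squares³ m × y ≡ double x
  onto {a , b , c} y∈
    with ℤ∣.divides i refl , ℤ∣.divides j refl , ℤ∣.divides k refl ←
      three-squares-mod-4 a b c {m} (Graded.sound squares³ {4 ℕ.* m} y∈) =
    (i , j , k) , ∈-fibre m (i , j , k) (ℕ.*-cancelˡ-≡ _ _ 4
      (trans (sym (degree-double (i , j , k))) (Graded.sound squares³ {4 ℕ.* m} y∈))) , refl

-- Power series with integer coefficients, compared modulo 5

infix 4 _≡₅_

_≡₅_ : ℤ → ℤ → Set
a ≡₅ b = + 5 ∣ℤ a ℤ.- b

module _ where
  open ℤ-ops using (_+_; _*_; _-_; -_)

  ≡⇒≡₅ : ∀ {a b} → a ≡ b → a ≡₅ b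
  ≡⇒≡₅ {a} refl = ℤ∣.divides 0ℤ (ℤ.+-inverseʳ a)

  ≡₅-sym : ∀ {a b} → a ≡₅ b → b ≡₅ a
  ≡₅-sym {a} {b} p = subst (+ 5 ∣ℤ_) (lem a b) (ℤ∣.∣m⇒∣-m p)
    where
    lem : ∀ a b → - (a - b) ≡ b - a
    lem = solve-∀

  ≡₅-trans : ∀ {a b c} → a ≡₅ b → b ≡₅ c → a ≡₅ c
  ≡₅-trans {a} {b} {c} p q = subst (+ 5 ∣ℤ_) (lem a b c) (ℤ∣.∣m∣n⇒∣m+n p q)
    where
    lem : ∀ a b c → (a - b) + (b - c) ≡ a - c
    lem = solve-∀

  +-cong₅ : ∀ a b c d → a ≡₅ b → c ≡₅ d → a + c ≡₅ b + d
  +-cong₅ a b c d p q = subst (+ 5 ∣ℤ_) (lem a b c d) (ℤ∣.∣m∣n⇒∣m+n p q)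
    where
    lem : ∀ a b c d → (a - b) + (c - d) ≡ (a + c) - (b + d)
    lem = solve-∀

  *-cong₅ : ∀ a b c d → a ≡₅ b → c ≡₅ d → a * c ≡₅ b * d
  *-cong₅ a b c d p q = subst (+ 5 ∣ℤ_) (lem a b c d) (ℤ∣.∣m∣n⇒∣m+n (ℤ∣.∣m⇒∣m*n c p) (ℤ∣.∣n⇒∣m*n b q))
    where
    lem : ∀ a b c d → (a - b) * c + b * (c - d) ≡ a * c - b * d
    lem = solve-∀

  neg-cong₅ : ∀ a b → a ≡₅ b → - a ≡₅ - b
  neg-cong₅ a b p = subst (+ 5 ∣ℤ_) (lem a b) (ℤ∣.∣m⇒∣-m p)
    where
    lem : ∀ a b → - (a - b) ≡ - a - (- b)
    lem = solve-∀

Series : Set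
Series = ℕ → ℤ

infixl 6 _+ₛ_
infixl 7 _*ₛ_
infix  8 -ₛ_
infix  4 _≈ₛ_

record _≈ₛ_ (f g : Series) : Set where
  constructor coefficientwise
  field
    coefficient : ∀ n → f n ≡₅ g n
open _≈ₛ_ public

tail : Series → Series
tail f n = f (suc n)

const : ℤ → Series
const a zero    = a
const a (suc n) = 0ℤ

0ₛ 1ₛ : Series
0ₛ n = 0ℤ
1ₛ   = const 1ℤ

opaque

  _+ₛ_ _*ₛ_ : Series → Series → Series
  (f +ₛ g) n = f n ℤ.+ g n
  (f *ₛ g) zero    = f 0 ℤ.* g 0
  (f *ₛ g) (suc n) = f 0 ℤ.* g (suc n) ℤ.+ (tail f *ₛ g) n

  -ₛ_ : Series → Series
  (-ₛ f) n = ℤ.- f n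

module _ where
  open ℤ-ops using (_+_; _*_; _-_; -_)

  opaque
    unfolding _+ₛ_ _*ₛ_

    *ₛ-tailʳ : ∀ f g n → (f *ₛ g) (suc n) ≡ (f *ₛ tail g) n + f (suc n) * g 0
    *ₛ-tailʳ f g zero    = refl
    *ₛ-tailʳ f g (suc n) = trans (cong (λ z → f 0 * g (suc (suc n)) + z) (*ₛ-tailʳ (tail f) g n))
      (sym (ℤ.+-assoc (f 0 * g (suc (suc n))) ((tail f *ₛ tail g) n) (f (suc (suc n)) * g 0)))

    *ₛ-comm : ∀ f g n → (f *ₛ g) n ≡ (g *ₛ f) n
    *ₛ-comm f g zero    = ℤ.*-comm (f 0) (g 0)
    *ₛ-comm f g (suc n) = begin
      f 0 * g (suc n) + (tail f *ₛ g) n   ≡⟨ cong₂ _+_ (ℤ.*-comm (f 0) (g (suc n))) (*ₛ-comm (tail f) g n) ⟩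
      g (suc n) * f 0 + (g *ₛ tail f) n   ≡⟨ ℤ.+-comm (g (suc n) * f 0) _ ⟩
      (g *ₛ tail f) n + g (suc n) * f 0   ≡⟨ *ₛ-tailʳ g f n ⟨
      (g *ₛ f) (suc n)                    ∎
      where open ≡-Reasoning

    *ₛ-distribʳ : ∀ h f g n → ((f +ₛ g) *ₛ h) n ≡ (f *ₛ h) n + (g *ₛ h) n
    *ₛ-distribʳ h f g zero    = ℤ.*-distribʳ-+ (h 0) (f 0) (g 0)
    *ₛ-distribʳ h f g (suc n) = trans
      (cong₂ _+_ (ℤ.*-distribʳ-+ (h (suc n)) (f 0) (g 0)) (*ₛ-distribʳ h (tail f) (tail g) n))
      (lem (f 0 * h (suc n)) (g 0 * h (suc n)) ((tail f *ₛ h) n) ((tail g *ₛ h) n))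
      where
      lem : ∀ a b c d → a + b + (c + d) ≡ a + c + (b + d)
      lem = solve-∀

    scale : ℤ → Series → Series
    scale a f n = a * f n

    scale-*ₛ : ∀ a f g n → (scale a f *ₛ g) n ≡ a * (f *ₛ g) n
    scale-*ₛ a f g zero    = ℤ.*-assoc a (f 0) (g 0)
    scale-*ₛ a f g (suc n) = trans (cong₂ _+_ (ℤ.*-assoc a (f 0) (g (suc n))) (scale-*ₛ a (tail f) g n))
      (sym (ℤ.*-distribˡ-+ a (f 0 * g (suc n)) ((tail f *ₛ g) n)))

    *ₛ-assoc : ∀ f g h n → ((f *ₛ g) *ₛ h) n ≡ (f *ₛ (g *ₛ h)) n
    *ₛ-assoc f g h zero    = ℤ.*-assoc (f 0) (g 0) (h 0)
    *ₛ-assoc f g h (suc n) = begin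
      f 0 * g 0 * h (suc n) + ((scale (f 0) (tail g) +ₛ tail f *ₛ g) *ₛ h) n
        ≡⟨ cong (λ z → f 0 * g 0 * h (suc n) + z) (*ₛ-distribʳ h (scale (f 0) (tail g)) (tail f *ₛ g) n) ⟩
      f 0 * g 0 * h (suc n) + ((scale (f 0) (tail g) *ₛ h) n + ((tail f *ₛ g) *ₛ h) n)
        ≡⟨ cong₂ (λ y z → f 0 * g 0 * h (suc n) + (y + z)) (scale-*ₛ (f 0) (tail g) h n) (*ₛ-assoc (tail f) g h n) ⟩
      f 0 * g 0 * h (suc n) + (f 0 * (tail g *ₛ h) n + (tail f *ₛ (g *ₛ h)) n)
        ≡⟨ lem (f 0) (g 0) (h (suc n)) ((tail g *ₛ h) n) ((tail f *ₛ (g *ₛ h)) n) ⟩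
      f 0 * (g 0 * h (suc n) + (tail g *ₛ h) n) + (tail f *ₛ (g *ₛ h)) n ∎
      where
      open ≡-Reasoning
      lem : ∀ a b c d e → a * b * c + (a * d + e) ≡ a * (b * c + d) + e
      lem = solve-∀

    *ₛ-zeroˡ : ∀ f n → (0ₛ *ₛ f) n ≡ 0ℤ
    *ₛ-zeroˡ f zero    = refl
    *ₛ-zeroˡ f (suc n) = trans (ℤ.+-identityˡ _) (*ₛ-zeroˡ f n)

    const-*ₛ : ∀ a f n → (const a *ₛ f) n ≡ a * f n
    const-*ₛ a f zero    = refl
    const-*ₛ a f (suc n) = trans (cong (λ z → a * f (suc n) + z) (*ₛ-zeroˡ f n)) (ℤ.+-identityʳ _)

    *ₛ-identityˡ : ∀ f n → (1ₛ *ₛ f) n ≡ f n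
    *ₛ-identityˡ f n = trans (const-*ₛ 1ℤ f n) (ℤ.*-identityˡ (f n))

    *ₛ-cong₅ : ∀ f f′ g g′ → (∀ n → f n ≡₅ f′ n) → (∀ n → g n ≡₅ g′ n) → ∀ n → (f *ₛ g) n ≡₅ (f′ *ₛ g′) n
    *ₛ-cong₅ f f′ g g′ p q zero    = *-cong₅ (f 0) (f′ 0) (g 0) (g′ 0) (p 0) (q 0)
    *ₛ-cong₅ f f′ g g′ p q (suc n) =
      +-cong₅ (f 0 * g (suc n)) (f′ 0 * g′ (suc n)) ((tail f *ₛ g) n) ((tail f′ *ₛ g′) n)
        (*-cong₅ (f 0) (f′ 0) (g (suc n)) (g′ (suc n)) (p 0) (q (suc n)))
        (*ₛ-cong₅ (tail f) (tail f′) g g′ (λ n → p (suc n)) q n)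

    -- Replaces a limit of series: an identity for truncations determines each coefficient of the
    -- full product once the truncation bound reaches its index.
    *ₛ-local : ∀ f f′ g g′ n → (∀ {k} → k ≤ n → f k ≡ f′ k) → (∀ {k} → k ≤ n → g k ≡ g′ k) →
               (f *ₛ g) n ≡ (f′ *ₛ g′) n
    *ₛ-local f f′ g g′ zero    p q = cong₂ _*_ (p z≤n) (q z≤n)
    *ₛ-local f f′ g g′ (suc n) p q = cong₂ _+_ (cong₂ _*_ (p z≤n) (q ℕ.≤-refl))
      (*ₛ-local (tail f) (tail f′) g g′ n (λ k≤n → p (s≤s k≤n)) (λ k≤n → q (ℕ.m≤n⇒m≤1+n k≤n)))

pointwise : ∀ {f g} → (∀ n → f n ≡ g n) → f ≈ₛ g
pointwise eq = coefficientwise λ n → ≡⇒≡₅ (eq n)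

≈ₛ-refl : ∀ {f} → f ≈ₛ f
≈ₛ-refl = pointwise λ n → refl

≈ₛ-sym : ∀ {f g} → f ≈ₛ g → g ≈ₛ f
≈ₛ-sym {f} {g} (coefficientwise p) = coefficientwise λ n → ≡₅-sym {f n} {g n} (p n)

≈ₛ-trans : ∀ {f g h} → f ≈ₛ g → g ≈ₛ h → f ≈ₛ h
≈ₛ-trans {f} {g} {h} (coefficientwise p) (coefficientwise q) =
  coefficientwise λ n → ≡₅-trans {f n} {g n} {h n} (p n) (q n)

opaque
  unfolding _+ₛ_ -ₛ_

  +ₛ-cong : ∀ {f f′ g g′} → f ≈ₛ f′ → g ≈ₛ g′ → f +ₛ g ≈ₛ f′ +ₛ g′
  +ₛ-cong {f} {f′} {g} {g′} (coefficientwise p) (coefficientwise q) =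
    coefficientwise λ n → +-cong₅ (f n) (f′ n) (g n) (g′ n) (p n) (q n)

  -ₛ-cong : ∀ {f g} → f ≈ₛ g → -ₛ f ≈ₛ -ₛ g
  -ₛ-cong {f} {g} (coefficientwise p) = coefficientwise λ n → neg-cong₅ (f n) (g n) (p n)

  *ₛ-cong : ∀ {f f′ g g′} → f ≈ₛ f′ → g ≈ₛ g′ → f *ₛ g ≈ₛ f′ *ₛ g′
  *ₛ-cong (coefficientwise p) (coefficientwise q) = coefficientwise (*ₛ-cong₅ _ _ _ _ p q)

  +ₛ-assoc : ∀ f g h → (f +ₛ g) +ₛ h ≈ₛ f +ₛ (g +ₛ h)
  +ₛ-assoc f g h = pointwise λ n → ℤ.+-assoc (f n) (g n) (h n)

  +ₛ-comm : ∀ f g → f +ₛ g ≈ₛ g +ₛ f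
  +ₛ-comm f g = pointwise λ n → ℤ.+-comm (f n) (g n)

  +ₛ-identityˡ : ∀ f → 0ₛ +ₛ f ≈ₛ f
  +ₛ-identityˡ f = pointwise λ n → ℤ.+-identityˡ (f n)

  +ₛ-inverseˡ : ∀ f → -ₛ f +ₛ f ≈ₛ 0ₛ
  +ₛ-inverseˡ f = pointwise λ n → ℤ.+-inverseˡ (f n)

  *ₛ-distribʳ-≈ : ∀ h f g → (f +ₛ g) *ₛ h ≈ₛ f *ₛ h +ₛ g *ₛ h
  *ₛ-distribʳ-≈ h f g = pointwise (*ₛ-distribʳ h f g)

*ₛ-comm-≈ : ∀ f g → f *ₛ g ≈ₛ g *ₛ f
*ₛ-comm-≈ f g = pointwise (*ₛ-comm f g)

seriesRing : CommutativeRing 0ℓ 0ℓ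
seriesRing = record
  { Carrier = Series ; _≈_ = _≈ₛ_ ; _+_ = _+ₛ_ ; _*_ = _*ₛ_ ; -_ = -ₛ_ ; 0# = 0ₛ ; 1# = 1ₛ
  ; isCommutativeRing = record
    { isRing = record
      { +-isAbelianGroup = record
        { isGroup = record
          { isMonoid = record
            { isSemigroup = record
              { isMagma = record
                { isEquivalence = record { refl = ≈ₛ-refl ; sym = ≈ₛ-sym ; trans = ≈ₛ-trans }
                ; ∙-cong = +ₛ-cong
                }
              ; assoc = +ₛ-assoc
              }
            ; identity = +ₛ-identityˡ , λ f → ≈ₛ-trans (+ₛ-comm f 0ₛ) (+ₛ-identityˡ f)
            }
          ; inverse = +ₛ-inverseˡ , λ f → ≈ₛ-trans (+ₛ-comm f (-ₛ f)) (+ₛ-inverseˡ f)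
          ; ⁻¹-cong = -ₛ-cong
          }
        ; comm = +ₛ-comm
        }
      ; *-cong = *ₛ-cong
      ; *-assoc = λ f g h → pointwise (*ₛ-assoc f g h)
      ; *-identity = (λ f → pointwise (*ₛ-identityˡ f)) ,
                     (λ f → ≈ₛ-trans (*ₛ-comm-≈ f 1ₛ) (pointwise (*ₛ-identityˡ f)))
      ; distrib = (λ f g h → ≈ₛ-trans (*ₛ-comm-≈ f (g +ₛ h))
                     (≈ₛ-trans (*ₛ-distribʳ-≈ f g h) (+ₛ-cong (*ₛ-comm-≈ g f) (*ₛ-comm-≈ h f)))) ,
                  *ₛ-distribʳ-≈
      }
    ; *-comm = *ₛ-comm-≈
    }
  }

opaque
  unfolding _*ₛ_

  const-+ : ∀ a b n → const (a ℤ.+ b) n ≡ (const a +ₛ const b) n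
  const-+ a b zero    = refl
  const-+ a b (suc n) = refl

  const-* : ∀ a b n → const (a ℤ.* b) n ≡ (const a *ₛ const b) n
  const-* a b zero    = refl
  const-* a b (suc n) = sym (trans (const-*ₛ a (const b) (suc n)) (ℤ.*-zeroʳ a))

  const-neg : ∀ a n → const (ℤ.- a) n ≡ (-ₛ const a) n
  const-neg a zero    = refl
  const-neg a (suc n) = refl

const-cong₅ : ∀ {a b} → a ≡₅ b → const a ≈ₛ const b
const-cong₅ a≡b = coefficientwise λ { zero → a≡b ; (suc n) → ≡⇒≡₅ {0ℤ} refl }

-- Deciding coefficients modulo 5 lets the solver prove (x + y)⁵ ≈ x⁵ + y⁵.
private
  seriesRing′ : AlmostCommutativeRing 0ℓ 0ℓ
  seriesRing′ = fromCommutativeRing seriesRing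

  constants : ℤ-ops.+-*-rawRing -Raw-AlmostCommutative⟶ seriesRing′
  constants = record
    { ⟦_⟧    = const
    ; +-homo = λ a b → pointwise (const-+ a b)
    ; *-homo = λ a b → pointwise (const-* a b)
    ; -‿homo = λ a → pointwise (const-neg a)
    ; 0-homo = pointwise λ { zero → refl ; (suc n) → refl }
    ; 1-homo = ≈ₛ-refl
    }

  _≟₅_ : ∀ a b → Maybe (const a ≈ₛ const b)
  a ≟₅ b with + 5 ∣ℤ? a ℤ.- b
  ... | yes a≡b = just (const-cong₅ a≡b)
  ... | no  _   = nothing

open import Algebra.Solver.Ring ℤ-ops.+-*-rawRing seriesRing′ constants _≟₅_ public
  using (solve; _:=_; _:+_; _:*_; :-_; con)

open CommutativeRing seriesRing public using () renaming (setoid to seriesSetoid)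

-- Monomials

q^ : ℕ → Series
q^ zero            = 1ₛ
q^ (suc k) zero    = 0ℤ
q^ (suc k) (suc n) = q^ k n

opaque
  unfolding _*ₛ_

  q^-shift : ∀ k f n → (q^ k *ₛ f) (k ℕ.+ n) ≡ f n
  q^-shift zero    f n = *ₛ-identityˡ f n
  q^-shift (suc k) f n = trans (ℤ.+-identityˡ _) (q^-shift k f n)

  q^-low : ∀ k f {n} → n < k → (q^ k *ₛ f) n ≡ 0ℤ
  q^-low (suc k) f {zero}  _         = refl
  q^-low (suc k) f {suc n} (s≤s n<k) = trans (ℤ.+-identityˡ _) (q^-low k f n<k)

q^-≈ : ∀ k f g → (∀ n → g (k ℕ.+ n) ≡ f n) → (∀ {n} → n < k → g n ≡ 0ℤ) → g ≈ₛ q^ k *ₛ f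
q^-≈ k f g high low = pointwise go
  where
  go : ∀ n → g n ≡ (q^ k *ₛ f) n
  go n with k ℕ.≤? n
  ... | yes k≤n = subst (λ n → g n ≡ (q^ k *ₛ f) n) (ℕ.m+[n∸m]≡n k≤n)
                    (trans (high (n ℕ.∸ k)) (sym (q^-shift k f (n ℕ.∸ k))))
  ... | no  k≰n = trans (low (ℕ.≰⇒> k≰n)) (sym (q^-low k f (ℕ.≰⇒> k≰n)))

q^-+ : ∀ j k → q^ (j ℕ.+ k) ≈ₛ q^ j *ₛ q^ k
q^-+ j k = q^-≈ j (q^ k) (q^ (j ℕ.+ k)) (high j) (low j)
  where
  high : ∀ j n → q^ (j ℕ.+ k) (j ℕ.+ n) ≡ q^ k n
  high zero    n = refl
  high (suc j) n = high j n
  low : ∀ j {n} → n < j → q^ (j ℕ.+ k) n ≡ 0ℤ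
  low (suc j) {zero}  _         = refl
  low (suc j) {suc n} (s≤s n<j) = low j n<j

opaque
  unfolding _*ₛ_

  -- The first coefficient prime to 5 would have to reappear from a strictly smaller index. Through
  -- `q^-cancel` this allows cancelling the factor 1 - q^(k + 1) without inverting it.
  q^-fixed⇒0 : ∀ k f → f ≈ₛ q^ (suc k) *ₛ f → f ≈ₛ 0ₛ
  q^-fixed⇒0 k f (coefficientwise fixed) = coefficientwise λ n →
    subst (+ 5 ∣ℤ_) (sym (ℤ.+-identityʳ (f n))) (below (suc n) ℕ.≤-refl)
    where
    vanish : ∀ g n → (∀ {i} → i ≤ n → + 5 ∣ℤ f i) → + 5 ∣ℤ (g *ₛ f) n
    vanish g zero    5∣ = ℤ∣.∣n⇒∣m*n (g 0) (5∣ z≤n)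
    vanish g (suc n) 5∣ = ℤ∣.∣m∣n⇒∣m+n (ℤ∣.∣n⇒∣m*n (g 0) (5∣ ℕ.≤-refl))
      (vanish (tail g) n (λ i≤n → 5∣ (ℕ.m≤n⇒m≤1+n i≤n)))
    step : ∀ n → (∀ {i} → i < n → + 5 ∣ℤ f i) → + 5 ∣ℤ (q^ (suc k) *ₛ f) n
    step zero    _  = ℤ∣.divides 0ℤ refl
    step (suc n) 5∣ = subst (+ 5 ∣ℤ_) (sym (ℤ.+-identityˡ _)) (vanish (q^ k) n (λ i≤n → 5∣ (s≤s i≤n)))
    restore : ∀ a b → a ≡₅ b → + 5 ∣ℤ b → + 5 ∣ℤ a
    restore a b a≡b 5∣b = subst (+ 5 ∣ℤ_) (lem a b) (ℤ∣.∣m∣n⇒∣m+n a≡b 5∣b)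
      where
      open ℤ-ops using (_+_; _-_)
      lem : ∀ a b → a - b + b ≡ a
      lem = solve-∀
    below : ∀ n {i} → i < n → + 5 ∣ℤ f i
    below (suc n) {i} (s≤s i≤n) = restore (f i) ((q^ (suc k) *ₛ f) i) (fixed i)
      (step i (λ j<i → below n (ℕ.<-≤-trans j<i i≤n)))

-- Gauss's identity for overpartitions

count-⊎ : ∀ {A : Set} {P Q R : A → Set} (P? : Decidable P) (Q? : Decidable Q) (R? : Decidable R) →
  (∀ {x} → P x → Q x ⊎ R x) → (∀ {x} → Q x → P x) → (∀ {x} → R x → P x) → (∀ {x} → Q x → ¬ R x) →
  ∀ xs → count P? xs ≡ count Q? xs ℕ.+ count R? xs
count-⊎ P? Q? R? split Q⊆P R⊆P disj [] = refl
count-⊎ P? Q? R? split Q⊆P R⊆P disj (x ∷ xs) with ih ← count-⊎ P? Q? R? split Q⊆P R⊆P disj xs | P? x | Q? x | R? x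
... | yes p | yes q | yes r = contradiction r (disj q)
... | yes p | yes q | no ¬r = cong suc ih
... | yes p | no ¬q | yes r = trans (cong suc ih) (sym (ℕ.+-suc _ _))
... | yes p | no ¬q | no ¬r with split p
...   | inj₁ q = contradiction q ¬q
...   | inj₂ r = contradiction r ¬r
count-⊎ P? Q? R? split Q⊆P R⊆P disj (x ∷ xs) | no ¬p | yes q | _     = contradiction (Q⊆P q) ¬p
count-⊎ P? Q? R? split Q⊆P R⊆P disj (x ∷ xs) | no ¬p | no ¬q | yes r = contradiction (R⊆P r) ¬p
count-⊎ P? Q? R? split Q⊆P R⊆P disj (x ∷ xs) | no ¬p | no ¬q | no ¬r = ih

-- Sizes decrease weakly, so a condition on the head bounds all parts. `HeadFits M` differs from
-- `HeadSize≤ M` only in forbidding an overlined head of size `M`: it describes what may follow a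
-- part of size `M`.
HeadSize≤ HeadFits : ℕ → List Part → Set
HeadSize≤ M []       = ⊤
HeadSize≤ M (p ∷ ps) = size p ≤ M
HeadFits M []       = ⊤
HeadFits M (p ∷ ps) = part M false ▷ p

HeadIs : Part → List Part → Set
HeadIs q []       = ⊥
HeadIs q (p ∷ ps) = p ≡ q

headSize≤? : ∀ M → Decidable (HeadSize≤ M)
headSize≤? M []       = yes tt
headSize≤? M (p ∷ ps) = size p ℕ.≤? M

headFits? : ∀ M → Decidable (HeadFits M)
headFits? M []       = yes tt
headFits? M (p ∷ ps) = part M false ▷? p

headIs? : ∀ q → Decidable (HeadIs q)
headIs? q []       = no λ ()
headIs? (part a false) (part b true ∷ ps)  = no λ ()
headIs? (part a true) (part b false ∷ ps)  = no λ ()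
headIs? (part a false) (part b false ∷ ps) with b ℕ.≟ a
... | yes refl = yes refl
... | no  b≢a  = no λ { refl → b≢a refl }
headIs? (part a true) (part b true ∷ ps) with b ℕ.≟ a
... | yes refl = yes refl
... | no  b≢a  = no λ { refl → b≢a refl }

countBounded countFitting : ℕ → ℕ → ℕ
countBounded M n = count (headSize≤? M) (overpartitions n)
countFitting M n = count (headFits? M) (overpartitions n)

countFitting-split : ∀ M n → countFitting (suc M) n ≡ countBounded M n ℕ.+ count (headIs? (part (suc M) false)) (overpartitions n)
countFitting-split M n = count-⊎ (headFits? (suc M)) (headSize≤? M) (headIs? (part (suc M) false))
  (λ {ps} → split {ps}) (λ {ps} → small {ps}) (λ {ps} → large {ps}) (λ {ps} → disjoint {ps}) (overpartitions n)
  where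
  split : ∀ {ps} → HeadFits (suc M) ps → HeadSize≤ M ps ⊎ HeadIs (part (suc M) false) ps
  split {[]}               _          = inj₁ tt
  split {part a true ∷ _}  (s≤s a≤M)  = inj₁ a≤M
  split {part a false ∷ _} a≤1+M with ℕ.m≤n⇒m<n∨m≡n a≤1+M
  ... | inj₁ (s≤s a≤M) = inj₁ a≤M
  ... | inj₂ refl      = inj₂ refl
  small : ∀ {ps} → HeadSize≤ M ps → HeadFits (suc M) ps
  small {[]}               _   = tt
  small {part a true ∷ _}  a≤M = s≤s a≤M
  small {part a false ∷ _} a≤M = ℕ.m≤n⇒m≤1+n a≤M
  large : ∀ {ps} → HeadIs (part (suc M) false) ps → HeadFits (suc M) ps
  large {_ ∷ _} refl = ℕ.≤-refl
  disjoint : ∀ {ps} → HeadSize≤ M ps → ¬ HeadIs (part (suc M) false) ps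
  disjoint {_ ∷ _} a≤M refl = ℕ.1+n≰n a≤M

countBounded-split : ∀ M n → countBounded (suc M) n ≡ countFitting (suc M) n ℕ.+ count (headIs? (part (suc M) true)) (overpartitions n)
countBounded-split M n = count-⊎ (headSize≤? (suc M)) (headFits? (suc M)) (headIs? (part (suc M) true))
  (λ {ps} → split {ps}) (λ {ps} → small {ps}) (λ {ps} → large {ps}) (λ {ps} → disjoint {ps}) (overpartitions n)
  where
  split : ∀ {ps} → HeadSize≤ (suc M) ps → HeadFits (suc M) ps ⊎ HeadIs (part (suc M) true) ps
  split {[]}               _     = inj₁ tt
  split {part a false ∷ _} a≤1+M = inj₁ a≤1+M
  split {part a true ∷ _}  a≤1+M with ℕ.m≤n⇒m<n∨m≡n a≤1+M
  ... | inj₁ a<1+M = inj₁ a<1+M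
  ... | inj₂ refl  = inj₂ refl
  small : ∀ {ps} → HeadFits (suc M) ps → HeadSize≤ (suc M) ps
  small {[]}               _     = tt
  small {part a true ∷ _}  a<1+M = ℕ.<⇒≤ a<1+M
  small {part a false ∷ _} a≤1+M = a≤1+M
  large : ∀ {ps} → HeadIs (part (suc M) true) ps → HeadSize≤ (suc M) ps
  large {_ ∷ _} refl = ℕ.≤-refl
  disjoint : ∀ {ps} → HeadFits (suc M) ps → ¬ HeadIs (part (suc M) true) ps
  disjoint {_ ∷ _} a<1+M refl = ℕ.1+n≰n a<1+M

∈⇒IsOverpartition : ∀ n {ps} → ps ∈ overpartitions n → IsOverpartition n ps
∈⇒IsOverpartition n = Equivalence.to (∈-overpartitions n)

IsOverpartition⇒∈ : ∀ n {ps} → IsOverpartition n ps → ps ∈ overpartitions n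
IsOverpartition⇒∈ n = Equivalence.from (∈-overpartitions n)

▷-size : ∀ M b p → part M b ▷ p → part M false ▷ p
▷-size M b (part a false) a≤M = a≤M
▷-size M b (part a true)  a<M = a<M

▷-size⁻ : ∀ M b p → part M false ▷ p → part M b ▷ p
▷-size⁻ M b (part a false) a≤M = a≤M
▷-size⁻ M b (part a true)  a<M = a<M

prepend-linked : ∀ M b ps → HeadFits M ps → Linked _▷_ ps → Linked _▷_ (part M b ∷ ps)
prepend-linked M b []       _    _   = [-]
prepend-linked M b (p ∷ ps) fits lps = ▷-size⁻ M b p fits ∷ lps

linked-tail : ∀ M b ps → Linked _▷_ (part M b ∷ ps) → HeadFits M ps × Linked _▷_ ps
linked-tail M b []       _          = tt , []
linked-tail M b (p ∷ ps) (M▷p ∷ lps) = ▷-size M b p M▷p , lps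

-- Removing the head is a bijection. An overline restricts what precedes a part, not what follows
-- it, so the tails are the same for both values of `b`.
headIs-count : ∀ M b n → count (headIs? (part (suc M) b)) (overpartitions (suc M ℕ.+ n)) ≡ countFitting (suc M) n
headIs-count M b n = sym (length-bijection (part (suc M) b ∷_) (λ { refl → refl })
  (Unique.filter⁺ (headFits? (suc M)) (overpartitions-unique n))
  (Unique.filter⁺ (headIs? (part (suc M) b)) (overpartitions-unique (suc M ℕ.+ n))) into onto)
  where
  into : ∀ {ps} → ps ∈ filter (headFits? (suc M)) (overpartitions n) →
         part (suc M) b ∷ ps ∈ filter (headIs? (part (suc M) b)) (overpartitions (suc M ℕ.+ n))
  into {ps} ps∈ with ps∈n , fits ← ∈-filter⁻ (headFits? (suc M)) {xs = overpartitions n} ps∈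
    with isOverpartition pos total ord ← ∈⇒IsOverpartition n ps∈n =
    ∈-filter⁺ (headIs? (part (suc M) b)) (IsOverpartition⇒∈ (suc M ℕ.+ n)
      (isOverpartition (s≤s z≤n ∷ pos) (cong (λ s → suc M ℕ.+ s) total) (prepend-linked (suc M) b ps fits ord))) refl
  onto : ∀ {qs} → qs ∈ filter (headIs? (part (suc M) b)) (overpartitions (suc M ℕ.+ n)) →
         ∃[ ps ] ps ∈ filter (headFits? (suc M)) (overpartitions n) × qs ≡ part (suc M) b ∷ ps
  onto {qs} qs∈ with qs∈n , is ← ∈-filter⁻ (headIs? (part (suc M) b)) {xs = overpartitions (suc M ℕ.+ n)} qs∈ =
    go qs is (∈⇒IsOverpartition (suc M ℕ.+ n) qs∈n)
    where
    go : ∀ qs → HeadIs (part (suc M) b) qs → IsOverpartition (suc M ℕ.+ n) qs →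
         ∃[ ps ] ps ∈ filter (headFits? (suc M)) (overpartitions n) × qs ≡ part (suc M) b ∷ ps
    go (_ ∷ ps) refl (isOverpartition (_ ∷ pos) total ord) with fits , ord′ ← linked-tail (suc M) b ps ord =
      ps , ∈-filter⁺ (headFits? (suc M))
        (IsOverpartition⇒∈ n (isOverpartition pos (ℕ.+-cancelˡ-≡ (suc M) _ _ total) ord′)) fits , refl

size≤total : ∀ {n p ps} → p ∷ ps ∈ overpartitions n → size p ≤ n
size≤total {n} {p} p∷ps∈ with isOverpartition _ total _ ← ∈⇒IsOverpartition n p∷ps∈ =
  subst (size p ≤_) total (ℕ.m≤m+n (size p) _)

headIs-count-low : ∀ M b {n} → n < suc M → count (headIs? (part (suc M) b)) (overpartitions n) ≡ 0
headIs-count-low M b {n} n<M = cong length (filter-none (headIs? (part (suc M) b)) (All.tabulate (λ {ps} → none {ps})))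
  where
  none : ∀ {ps} → ps ∈ overpartitions n → ¬ HeadIs (part (suc M) b) ps
  none {p ∷ ps} ps∈ refl = ℕ.<⇒≱ n<M (size≤total ps∈)

countBounded-zero : ∀ n → + countBounded 0 n ≡ 1ₛ n
countBounded-zero zero    = refl
countBounded-zero (suc n) = cong (+_ ∘ length) (filter-none (headSize≤? 0) {overpartitions (suc n)} (All.tabulate (λ {ps} → none {ps})))
  where
  none : ∀ {ps} → ps ∈ overpartitions (suc n) → ¬ HeadSize≤ 0 ps
  none {[]} ps∈ _ with () ← IsOverpartition.total (∈⇒IsOverpartition (suc n) ps∈)
  none {p ∷ ps} ps∈ p≤0 with pos ∷ _ ← IsOverpartition.positive (∈⇒IsOverpartition (suc n) ps∈) = ℕ.<⇒≱ pos p≤0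

countBounded-stable : ∀ {M n} → n ≤ M → countBounded M n ≡ p̄ n
countBounded-stable {M} {n} n≤M = cong length (filter-all (headSize≤? M) (All.tabulate (λ {ps} → all {ps})))
  where
  all : ∀ {ps} → ps ∈ overpartitions n → HeadSize≤ M ps
  all {[]}     _   = tt
  all {p ∷ ps} ps∈ = ℕ.≤-trans (size≤total ps∈) n≤M

-- As products, `boundedₛ M` is ∏_{i ≤ M} (1 + qⁱ)/(1 - qⁱ) and `fittingₛ (suc M)` is `boundedₛ M`
-- divided by 1 - q^(M + 1). The two recursions below express this without any inverse series.
boundedₛ fittingₛ : ℕ → Series
boundedₛ M n = + countBounded M n
fittingₛ M n = + countFitting M n

headIs-series : ∀ M b → (λ n → + count (headIs? (part (suc M) b)) (overpartitions n)) ≈ₛ q^ (suc M) *ₛ fittingₛ (suc M)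
headIs-series M b = q^-≈ (suc M) (fittingₛ (suc M)) _
  (λ n → cong +_ (headIs-count M b n)) (λ n<M → cong +_ (headIs-count-low M b n<M))

opaque
  unfolding _+ₛ_

  fittingₛ-suc : ∀ M → fittingₛ (suc M) ≈ₛ boundedₛ M +ₛ q^ (suc M) *ₛ fittingₛ (suc M)
  fittingₛ-suc M = ≈ₛ-trans (pointwise λ n → cong +_ (countFitting-split M n)) (+ₛ-cong (≈ₛ-refl {boundedₛ M}) (headIs-series M false))

  boundedₛ-suc : ∀ M → boundedₛ (suc M) ≈ₛ fittingₛ (suc M) +ₛ q^ (suc M) *ₛ fittingₛ (suc M)
  boundedₛ-suc M = ≈ₛ-trans (pointwise λ n → cong +_ (countBounded-split M n)) (+ₛ-cong (≈ₛ-refl {fittingₛ (suc M)}) (headIs-series M true))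

-- A finite form of Gauss's identity

sgn : ℕ → ℤ
sgn zero    = 1ℤ
sgn (suc n) = ℤ.- sgn n

-- The constant series (-1)ⁿ, built with `-ₛ_` so that consecutive signs are visibly opposite in
-- identities left to the ring solver.
σ : ℕ → Series
σ zero    = 1ₛ
σ (suc n) = -ₛ σ n

opaque
  unfolding _*ₛ_

  -ₛ-*ₛ : ∀ f g n → ((-ₛ f) *ₛ g) n ≡ ℤ.- (f *ₛ g) n
  -ₛ-*ₛ f g zero    = sym (ℤ.neg-distribˡ-* (f 0) (g 0))
  -ₛ-*ₛ f g (suc n) = trans (cong₂ ℤ._+_ (sym (ℤ.neg-distribˡ-* (f 0) (g (suc n)))) (-ₛ-*ₛ (tail f) g n))
    (sym (ℤ.neg-distrib-+ (f 0 ℤ.* g (suc n)) ((tail f *ₛ g) n)))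

  σ-*ₛ : ∀ k f n → (σ k *ₛ f) n ≡ sgn k ℤ.* f n
  σ-*ₛ zero    f n = trans (*ₛ-identityˡ f n) (sym (ℤ.*-identityˡ (f n)))
  σ-*ₛ (suc k) f n = trans (-ₛ-*ₛ (σ k) f n) (trans (cong ℤ.-_ (σ-*ₛ k f n)) (ℤ.neg-distribˡ-* (sgn k) (f n)))

-- The product ∏_{i ≤ s} (1 + q^(i - 1))/(1 - qⁱ): its factor 1 + q⁰ = 2 gives the doubling, and the
-- shifted numerators against the denominators form `fittingₛ s`.
shanksTerm : ℕ → Series
shanksTerm zero    = 1ₛ
shanksTerm (suc s) = fittingₛ (suc s) +ₛ fittingₛ (suc s)

-- A Shanks-type finite form of Gauss's identity:
-- boundedₛ n * ∑_{∣j∣ ≤ n} (-1)ʲ q^(j²) = ∑_{s ≤ n} (-1)ˢ q^(s(n + 1)) ∏_{i ≤ s} (1 + q^(i - 1)) / (1 - qⁱ).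
shanks : ℕ → ℕ → Series
shanks zero    n = 1ₛ
shanks (suc N) n = shanks N n +ₛ σ (suc N) *ₛ (q^ (suc N ℕ.* suc n) *ₛ shanksTerm (suc N))

partialTheta : ℕ → Series
partialTheta zero    = 1ₛ
partialTheta (suc n) = partialTheta n +ₛ σ (suc n) *ₛ (q^ (suc n ℕ.* suc n) +ₛ q^ (suc n ℕ.* suc n))

q^-cong : ∀ {m n} → m ≡ n → q^ m ≈ₛ q^ n
q^-cong refl = ≈ₛ-refl

bounded≈fitting : ∀ n → boundedₛ n ≈ₛ fittingₛ (suc n) +ₛ -ₛ (q^ (suc n) *ₛ fittingₛ (suc n))
bounded≈fitting n = begin
  boundedₛ n                                 ≈⟨ lem (boundedₛ n) (q^ (suc n) *ₛ fittingₛ (suc n)) ⟩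
  (boundedₛ n +ₛ q^ (suc n) *ₛ fittingₛ (suc n)) +ₛ -ₛ (q^ (suc n) *ₛ fittingₛ (suc n))
                                       ≈⟨ +ₛ-cong (≈ₛ-sym (fittingₛ-suc n)) ≈ₛ-refl ⟩
  fittingₛ (suc n) +ₛ -ₛ (q^ (suc n) *ₛ fittingₛ (suc n)) ∎
  where
  open SetoidReasoning seriesSetoid
  lem : ∀ a b → a ≈ₛ (a +ₛ b) +ₛ -ₛ b
  lem = solve 2 (λ a b → a := (a :+ b) :+ :- b) ≈ₛ-refl

-- The recurrence in `n` satisfied by the Shanks sum, with a boundary term left by stopping at `N`.
-- Keeping `N` free makes it provable by induction on `N`; at N = n the boundary term and the last
-- summand of the next Shanks sum together account for the new theta term ±2 q^((n + 1)²).
telescope : ∀ n N → shanks N (suc n) +ₛ -ₛ (q^ (suc n) *ₛ shanks N (suc n))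
  ≈ₛ (shanks N n +ₛ q^ (suc n) *ₛ shanks N n)
     +ₛ -ₛ (σ N *ₛ (q^ (suc N ℕ.* suc n) *ₛ (boundedₛ N +ₛ boundedₛ N)))
telescope n zero = begin
  1ₛ +ₛ -ₛ (Q *ₛ 1ₛ)                                   ≈⟨ lem Q ⟩
  (1ₛ +ₛ Q *ₛ 1ₛ) +ₛ -ₛ (1ₛ *ₛ (Q *ₛ (1ₛ +ₛ 1ₛ)))
    ≈⟨ +ₛ-cong ≈ₛ-refl (-ₛ-cong (*ₛ-cong ≈ₛ-refl (*ₛ-cong
         (q^-cong (cong suc (sym (ℕ.+-identityʳ n)))) (≈ₛ-sym (+ₛ-cong (pointwise countBounded-zero) (pointwise countBounded-zero)))))) ⟩
  (1ₛ +ₛ Q *ₛ 1ₛ) +ₛ -ₛ (1ₛ *ₛ (q^ (1 ℕ.* suc n) *ₛ (boundedₛ 0 +ₛ boundedₛ 0))) ∎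
  where
  open SetoidReasoning seriesSetoid
  Q : Series
  Q = q^ (suc n)
  lem : ∀ q → 1ₛ +ₛ -ₛ (q *ₛ 1ₛ) ≈ₛ (1ₛ +ₛ q *ₛ 1ₛ) +ₛ -ₛ (1ₛ *ₛ (q *ₛ (1ₛ +ₛ 1ₛ)))
  lem = solve 1 (λ q → let one = con 1ℤ in
    one :+ :- (q :* one) := (one :+ q :* one) :+ :- (one :* (q :* (one :+ one)))) ≈ₛ-refl
telescope n (suc N) = begin
  (e +ₛ -ₛ s *ₛ (q^ (suc N ℕ.* suc (suc n)) *ₛ (c +ₛ c)))
    +ₛ -ₛ (Q *ₛ (e +ₛ -ₛ s *ₛ (q^ (suc N ℕ.* suc (suc n)) *ₛ (c +ₛ c))))
    ≈⟨ +ₛ-cong (+ₛ-cong ≈ₛ-refl (*ₛ-cong ≈ₛ-refl (*ₛ-cong exponent ≈ₛ-refl)))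
         (-ₛ-cong (*ₛ-cong ≈ₛ-refl (+ₛ-cong ≈ₛ-refl (*ₛ-cong ≈ₛ-refl (*ₛ-cong exponent ≈ₛ-refl))))) ⟩
  (e +ₛ -ₛ s *ₛ ((K *ₛ W) *ₛ (c +ₛ c))) +ₛ -ₛ (Q *ₛ (e +ₛ -ₛ s *ₛ ((K *ₛ W) *ₛ (c +ₛ c))))
    ≈⟨ lem₁ e s K W c Q ⟩
  (e +ₛ -ₛ (Q *ₛ e)) +ₛ (-ₛ s *ₛ ((K *ₛ W) *ₛ (c +ₛ c)) +ₛ Q *ₛ (s *ₛ ((K *ₛ W) *ₛ (c +ₛ c))))
    ≈⟨ +ₛ-cong (≈ₛ-trans (telescope n N)
         (+ₛ-cong ≈ₛ-refl (-ₛ-cong (*ₛ-cong ≈ₛ-refl (*ₛ-cong ≈ₛ-refl (+ₛ-cong (bounded≈fitting N) (bounded≈fitting N))))))) ≈ₛ-refl ⟩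
  ((e′ +ₛ Q *ₛ e′) +ₛ -ₛ (s *ₛ (W *ₛ ((c +ₛ -ₛ (K *ₛ c)) +ₛ (c +ₛ -ₛ (K *ₛ c))))))
    +ₛ (-ₛ s *ₛ ((K *ₛ W) *ₛ (c +ₛ c)) +ₛ Q *ₛ (s *ₛ ((K *ₛ W) *ₛ (c +ₛ c))))
    ≈⟨ lem₂ e′ s K W c Q ⟩
  ((e′ +ₛ -ₛ s *ₛ (W *ₛ (c +ₛ c))) +ₛ Q *ₛ (e′ +ₛ -ₛ s *ₛ (W *ₛ (c +ₛ c))))
    +ₛ -ₛ (-ₛ s *ₛ ((Q *ₛ W) *ₛ ((c +ₛ K *ₛ c) +ₛ (c +ₛ K *ₛ c))))
    ≈⟨ +ₛ-cong ≈ₛ-refl (-ₛ-cong (*ₛ-cong ≈ₛ-refl (*ₛ-cong (≈ₛ-sym (q^-+ (suc n) (suc N ℕ.* suc n)))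
         (≈ₛ-sym (+ₛ-cong (boundedₛ-suc N) (boundedₛ-suc N)))))) ⟩
  ((e′ +ₛ -ₛ s *ₛ (W *ₛ (c +ₛ c))) +ₛ Q *ₛ (e′ +ₛ -ₛ s *ₛ (W *ₛ (c +ₛ c))))
    +ₛ -ₛ (-ₛ s *ₛ (q^ (suc (suc N) ℕ.* suc n) *ₛ (boundedₛ (suc N) +ₛ boundedₛ (suc N)))) ∎
  where
  open SetoidReasoning seriesSetoid
  e e′ s K W c Q : Series
  e  = shanks N (suc n)
  e′ = shanks N n
  s  = σ N
  K  = q^ (suc N)
  W  = q^ (suc N ℕ.* suc n)
  c  = fittingₛ (suc N)
  Q  = q^ (suc n)
  exponent : q^ (suc N ℕ.* suc (suc n)) ≈ₛ K *ₛ W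
  exponent = ≈ₛ-trans (q^-cong (ℕ.*-suc (suc N) (suc n))) (q^-+ (suc N) (suc N ℕ.* suc n))
  lem₁ : ∀ e s k w c q →
    (e +ₛ -ₛ s *ₛ ((k *ₛ w) *ₛ (c +ₛ c))) +ₛ -ₛ (q *ₛ (e +ₛ -ₛ s *ₛ ((k *ₛ w) *ₛ (c +ₛ c))))
    ≈ₛ (e +ₛ -ₛ (q *ₛ e)) +ₛ (-ₛ s *ₛ ((k *ₛ w) *ₛ (c +ₛ c)) +ₛ q *ₛ (s *ₛ ((k *ₛ w) *ₛ (c +ₛ c))))
  lem₁ = solve 6 (λ e s k w c q →
    (e :+ (:- s) :* ((k :* w) :* (c :+ c))) :+ :- (q :* (e :+ (:- s) :* ((k :* w) :* (c :+ c))))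
    := (e :+ :- (q :* e)) :+ ((:- s) :* ((k :* w) :* (c :+ c)) :+ q :* (s :* ((k :* w) :* (c :+ c))))) ≈ₛ-refl
  lem₂ : ∀ e s k w c q →
    ((e +ₛ q *ₛ e) +ₛ -ₛ (s *ₛ (w *ₛ ((c +ₛ -ₛ (k *ₛ c)) +ₛ (c +ₛ -ₛ (k *ₛ c))))))
      +ₛ (-ₛ s *ₛ ((k *ₛ w) *ₛ (c +ₛ c)) +ₛ q *ₛ (s *ₛ ((k *ₛ w) *ₛ (c +ₛ c))))
    ≈ₛ ((e +ₛ -ₛ s *ₛ (w *ₛ (c +ₛ c))) +ₛ q *ₛ (e +ₛ -ₛ s *ₛ (w *ₛ (c +ₛ c))))
      +ₛ -ₛ (-ₛ s *ₛ ((q *ₛ w) *ₛ ((c +ₛ k *ₛ c) +ₛ (c +ₛ k *ₛ c))))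
  lem₂ = solve 6 (λ e s k w c q →
    ((e :+ q :* e) :+ :- (s :* (w :* ((c :+ :- (k :* c)) :+ (c :+ :- (k :* c))))))
      :+ ((:- s) :* ((k :* w) :* (c :+ c)) :+ q :* (s :* ((k :* w) :* (c :+ c))))
    := ((e :+ (:- s) :* (w :* (c :+ c))) :+ q :* (e :+ (:- s) :* (w :* (c :+ c))))
      :+ :- ((:- s) :* ((q :* w) :* ((c :+ k :* c) :+ (c :+ k :* c))))) ≈ₛ-refl

q^-cancel : ∀ k f g → f +ₛ -ₛ (q^ (suc k) *ₛ f) ≈ₛ g +ₛ -ₛ (q^ (suc k) *ₛ g) → f ≈ₛ g
q^-cancel k f g eq = begin
  f                       ≈⟨ lem₁ f g ⟩
  (f +ₛ -ₛ g) +ₛ g        ≈⟨ +ₛ-cong (q^-fixed⇒0 k (f +ₛ -ₛ g) fixed) ≈ₛ-refl ⟩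
  0ₛ +ₛ g                 ≈⟨ +ₛ-identityˡ g ⟩
  g                       ∎
  where
  open SetoidReasoning seriesSetoid
  Q : Series
  Q = q^ (suc k)
  lem₁ : ∀ f g → f ≈ₛ (f +ₛ -ₛ g) +ₛ g
  lem₁ = solve 2 (λ f g → f := (f :+ :- g) :+ g) ≈ₛ-refl
  lem₂ : ∀ f g q → f +ₛ -ₛ g ≈ₛ ((f +ₛ -ₛ (q *ₛ f)) +ₛ q *ₛ f) +ₛ -ₛ g
  lem₂ = solve 3 (λ f g q → f :+ :- g := ((f :+ :- (q :* f)) :+ q :* f) :+ :- g) ≈ₛ-refl
  lem₃ : ∀ f g q → ((g +ₛ -ₛ (q *ₛ g)) +ₛ q *ₛ f) +ₛ -ₛ g ≈ₛ q *ₛ (f +ₛ -ₛ g)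
  lem₃ = solve 3 (λ f g q → ((g :+ :- (q :* g)) :+ q :* f) :+ :- g := q :* (f :+ :- g)) ≈ₛ-refl
  fixed : f +ₛ -ₛ g ≈ₛ Q *ₛ (f +ₛ -ₛ g)
  fixed = begin
    f +ₛ -ₛ g                                  ≈⟨ lem₂ f g Q ⟩
    ((f +ₛ -ₛ (Q *ₛ f)) +ₛ Q *ₛ f) +ₛ -ₛ g     ≈⟨ +ₛ-cong (+ₛ-cong eq ≈ₛ-refl) ≈ₛ-refl ⟩
    ((g +ₛ -ₛ (Q *ₛ g)) +ₛ Q *ₛ f) +ₛ -ₛ g     ≈⟨ lem₃ f g Q ⟩
    Q *ₛ (f +ₛ -ₛ g)                           ∎

-- Both sides are multiplied by 1 - q^(n + 1). This turns `boundedₛ (suc n)` into (1 + q^(n + 1))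
-- `boundedₛ n`, so the induction hypothesis applies, and `telescope` shows that the other side
-- obeys the same recurrence.
bounded*theta≈shanks : ∀ n → boundedₛ n *ₛ partialTheta n ≈ₛ shanks n n
bounded*theta≈shanks zero    = ≈ₛ-trans (*ₛ-cong (pointwise countBounded-zero) ≈ₛ-refl) (pointwise (*ₛ-identityˡ 1ₛ))
bounded*theta≈shanks (suc n) = q^-cancel n (boundedₛ (suc n) *ₛ partialTheta (suc n)) (shanks (suc n) (suc n)) (begin
  boundedₛ (suc n) *ₛ T′ +ₛ -ₛ (Q *ₛ (boundedₛ (suc n) *ₛ T′))
    ≈⟨ +ₛ-cong (*ₛ-cong (boundedₛ-suc n) ≈ₛ-refl) (-ₛ-cong (*ₛ-cong ≈ₛ-refl (*ₛ-cong (boundedₛ-suc n) ≈ₛ-refl))) ⟩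
  (c +ₛ Q *ₛ c) *ₛ T′ +ₛ -ₛ (Q *ₛ ((c +ₛ Q *ₛ c) *ₛ T′))
    ≈⟨ lem₁ c Q T s S ⟩
  ((c +ₛ -ₛ (Q *ₛ c)) *ₛ T +ₛ Q *ₛ ((c +ₛ -ₛ (Q *ₛ c)) *ₛ T))
    +ₛ (-ₛ s *ₛ S) *ₛ (((c +ₛ -ₛ (Q *ₛ c)) +ₛ (c +ₛ -ₛ (Q *ₛ c))) +ₛ Q *ₛ ((c +ₛ -ₛ (Q *ₛ c)) +ₛ (c +ₛ -ₛ (Q *ₛ c))))
    ≈⟨ +ₛ-cong (+ₛ-cong IH (*ₛ-cong ≈ₛ-refl IH)) ≈ₛ-refl ⟩
  (E +ₛ Q *ₛ E)
    +ₛ (-ₛ s *ₛ S) *ₛ (((c +ₛ -ₛ (Q *ₛ c)) +ₛ (c +ₛ -ₛ (Q *ₛ c))) +ₛ Q *ₛ ((c +ₛ -ₛ (Q *ₛ c)) +ₛ (c +ₛ -ₛ (Q *ₛ c))))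
    ≈⟨ lem₂ c Q E s S ⟩
  ((E +ₛ Q *ₛ E) +ₛ -ₛ (s *ₛ (S *ₛ ((c +ₛ -ₛ (Q *ₛ c)) +ₛ (c +ₛ -ₛ (Q *ₛ c))))))
    +ₛ (-ₛ s *ₛ ((Q *ₛ S) *ₛ (c +ₛ c)) +ₛ Q *ₛ (s *ₛ ((Q *ₛ S) *ₛ (c +ₛ c))))
    ≈⟨ +ₛ-cong (≈ₛ-sym (≈ₛ-trans (telescope n n)
         (+ₛ-cong ≈ₛ-refl (-ₛ-cong (*ₛ-cong ≈ₛ-refl (*ₛ-cong ≈ₛ-refl (+ₛ-cong (bounded≈fitting n) (bounded≈fitting n)))))))) ≈ₛ-refl ⟩
  (E′ +ₛ -ₛ (Q *ₛ E′)) +ₛ (-ₛ s *ₛ ((Q *ₛ S) *ₛ (c +ₛ c)) +ₛ Q *ₛ (s *ₛ ((Q *ₛ S) *ₛ (c +ₛ c))))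
    ≈⟨ lem₃ E′ s Q S c ⟩
  (E′ +ₛ -ₛ s *ₛ ((Q *ₛ S) *ₛ (c +ₛ c))) +ₛ -ₛ (Q *ₛ (E′ +ₛ -ₛ s *ₛ ((Q *ₛ S) *ₛ (c +ₛ c))))
    ≈⟨ +ₛ-cong last (-ₛ-cong (*ₛ-cong ≈ₛ-refl last)) ⟩
  shanks (suc n) (suc n) +ₛ -ₛ (Q *ₛ shanks (suc n) (suc n)) ∎)
  where
  open SetoidReasoning seriesSetoid
  c s Q S T T′ E E′ : Series
  c  = fittingₛ (suc n)
  s  = σ n
  Q  = q^ (suc n)
  S  = q^ (suc n ℕ.* suc n)
  T  = partialTheta n
  T′ = T +ₛ -ₛ s *ₛ (S +ₛ S)
  E  = shanks n n
  E′ = shanks n (suc n)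
  IH : (c +ₛ -ₛ (Q *ₛ c)) *ₛ T ≈ₛ E
  IH = ≈ₛ-trans (*ₛ-cong (≈ₛ-sym (bounded≈fitting n)) ≈ₛ-refl) (bounded*theta≈shanks n)
  last : E′ +ₛ -ₛ s *ₛ ((Q *ₛ S) *ₛ (c +ₛ c)) ≈ₛ shanks (suc n) (suc n)
  last = +ₛ-cong ≈ₛ-refl (*ₛ-cong ≈ₛ-refl (*ₛ-cong
    (≈ₛ-sym (≈ₛ-trans (q^-cong (ℕ.*-suc (suc n) (suc n))) (q^-+ (suc n) (suc n ℕ.* suc n)))) ≈ₛ-refl))
  lem₁ : ∀ c q t s w →
    (c +ₛ q *ₛ c) *ₛ (t +ₛ -ₛ s *ₛ (w +ₛ w)) +ₛ -ₛ (q *ₛ ((c +ₛ q *ₛ c) *ₛ (t +ₛ -ₛ s *ₛ (w +ₛ w))))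
    ≈ₛ ((c +ₛ -ₛ (q *ₛ c)) *ₛ t +ₛ q *ₛ ((c +ₛ -ₛ (q *ₛ c)) *ₛ t))
       +ₛ (-ₛ s *ₛ w) *ₛ (((c +ₛ -ₛ (q *ₛ c)) +ₛ (c +ₛ -ₛ (q *ₛ c))) +ₛ q *ₛ ((c +ₛ -ₛ (q *ₛ c)) +ₛ (c +ₛ -ₛ (q *ₛ c))))
  lem₁ = solve 5 (λ c q t s w →
    (c :+ q :* c) :* (t :+ (:- s) :* (w :+ w)) :+ :- (q :* ((c :+ q :* c) :* (t :+ (:- s) :* (w :+ w))))
    := ((c :+ :- (q :* c)) :* t :+ q :* ((c :+ :- (q :* c)) :* t))
       :+ ((:- s) :* w) :* (((c :+ :- (q :* c)) :+ (c :+ :- (q :* c))) :+ q :* ((c :+ :- (q :* c)) :+ (c :+ :- (q :* c))))) ≈ₛ-refl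
  lem₂ : ∀ c q e s w →
    (e +ₛ q *ₛ e)
      +ₛ (-ₛ s *ₛ w) *ₛ (((c +ₛ -ₛ (q *ₛ c)) +ₛ (c +ₛ -ₛ (q *ₛ c))) +ₛ q *ₛ ((c +ₛ -ₛ (q *ₛ c)) +ₛ (c +ₛ -ₛ (q *ₛ c))))
    ≈ₛ ((e +ₛ q *ₛ e) +ₛ -ₛ (s *ₛ (w *ₛ ((c +ₛ -ₛ (q *ₛ c)) +ₛ (c +ₛ -ₛ (q *ₛ c))))))
      +ₛ (-ₛ s *ₛ ((q *ₛ w) *ₛ (c +ₛ c)) +ₛ q *ₛ (s *ₛ ((q *ₛ w) *ₛ (c +ₛ c))))
  lem₂ = solve 5 (λ c q e s w →
    (e :+ q :* e)
      :+ ((:- s) :* w) :* (((c :+ :- (q :* c)) :+ (c :+ :- (q :* c))) :+ q :* ((c :+ :- (q :* c)) :+ (c :+ :- (q :* c))))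
    := ((e :+ q :* e) :+ :- (s :* (w :* ((c :+ :- (q :* c)) :+ (c :+ :- (q :* c))))))
      :+ ((:- s) :* ((q :* w) :* (c :+ c)) :+ q :* (s :* ((q :* w) :* (c :+ c))))) ≈ₛ-refl
  lem₃ : ∀ e s q w c →
    (e +ₛ -ₛ (q *ₛ e)) +ₛ (-ₛ s *ₛ ((q *ₛ w) *ₛ (c +ₛ c)) +ₛ q *ₛ (s *ₛ ((q *ₛ w) *ₛ (c +ₛ c))))
    ≈ₛ (e +ₛ -ₛ s *ₛ ((q *ₛ w) *ₛ (c +ₛ c))) +ₛ -ₛ (q *ₛ (e +ₛ -ₛ s *ₛ ((q *ₛ w) *ₛ (c +ₛ c))))
  lem₃ = solve 5 (λ e s q w c →
    (e :+ :- (q :* e)) :+ ((:- s) :* ((q :* w) :* (c :+ c)) :+ q :* (s :* ((q :* w) :* (c :+ c))))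
    := (e :+ (:- s) :* ((q :* w) :* (c :+ c))) :+ :- (q :* (e :+ (:- s) :* ((q :* w) :* (c :+ c))))) ≈ₛ-refl

opaque
  unfolding _+ₛ_

  -- The summand of index s ≥ 1 starts at q^(s(n + 1)), beyond every exponent up to n; in this range
  -- the Shanks sum is just 1.
  shanks-low : ∀ N {n k} → k ≤ n → shanks N n k ≡ 1ₛ k
  shanks-low zero    _ = refl
  shanks-low (suc N) {n} {k} k≤n = trans (cong₂ ℤ._+_ (shanks-low N k≤n)
    (trans (σ-*ₛ (suc N) (q^ (suc N ℕ.* suc n) *ₛ shanksTerm (suc N)) k)
      (trans (cong (ℤ._*_ (sgn (suc N))) (q^-low (suc N ℕ.* suc n) (shanksTerm (suc N)) (ℕ.<-≤-trans (s≤s k≤n) (ℕ.m≤m+n (suc n) (N ℕ.* suc n)))))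
        (ℤ.*-zeroʳ (sgn (suc N))))))
    (ℤ.+-identityʳ (1ₛ k))

-- Signs, theta series and the limit of the finite identity

sgn-+ : ∀ m n → sgn (m ℕ.+ n) ≡ sgn m ℤ.* sgn n
sgn-+ zero    n = sym (ℤ.*-identityˡ (sgn n))
sgn-+ (suc m) n = trans (cong ℤ.-_ (sgn-+ m n)) (ℤ.neg-distribˡ-* (sgn m) (sgn n))

sgn*sgn : ∀ n → sgn n ℤ.* sgn n ≡ 1ℤ
sgn*sgn zero    = refl
sgn*sgn (suc n) = trans (lem (sgn n)) (sgn*sgn n)
  where
  open ℤ-ops using (_*_; -_)
  lem : ∀ a → (- a) * (- a) ≡ a * a
  lem = solve-∀

-- The sign (-1)ʲ of a theta term can be read off its exponent j². This identifies the alternating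
-- theta series with `twist θ`.
sgn-square : ∀ n → sgn (n ℕ.* n) ≡ sgn n
sgn-square zero    = refl
sgn-square (suc n) = cong ℤ.-_ (begin
  sgn (n ℕ.+ n ℕ.* suc n)                     ≡⟨ cong (λ m → sgn (n ℕ.+ m)) (ℕ.*-suc n n) ⟩
  sgn (n ℕ.+ (n ℕ.+ n ℕ.* n))                 ≡⟨ trans (sgn-+ n (n ℕ.+ n ℕ.* n)) (cong (ℤ._*_ (sgn n)) (sgn-+ n (n ℕ.* n))) ⟩
  sgn n ℤ.* (sgn n ℤ.* sgn (n ℕ.* n))         ≡⟨ ℤ.*-assoc (sgn n) (sgn n) (sgn (n ℕ.* n)) ⟨
  sgn n ℤ.* sgn n ℤ.* sgn (n ℕ.* n)           ≡⟨ cong₂ ℤ._*_ (sgn*sgn n) (sgn-square n) ⟩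
  1ℤ ℤ.* sgn n                                ≡⟨ ℤ.*-identityˡ (sgn n) ⟩
  sgn n                                       ∎)
  where open ≡-Reasoning

sgn-*5 : ∀ n → sgn (n ℕ.* 5) ≡ sgn n
sgn-*5 zero    = refl
sgn-*5 (suc n) = trans (lem (sgn (n ℕ.* 5))) (cong ℤ.-_ (sgn-*5 n))
  where
  open ℤ-ops using (-_)
  lem : ∀ a → - (- (- (- (- a)))) ≡ - a
  lem = solve-∀

q^-diagonal : ∀ k → q^ k k ≡ 1ℤ
q^-diagonal zero    = refl
q^-diagonal (suc k) = q^-diagonal k

q^-off-diagonal : ∀ k n → k ≢ n → q^ k n ≡ 0ℤ
q^-off-diagonal zero    zero    k≢n = contradiction refl k≢n
q^-off-diagonal zero    (suc n) _   = refl
q^-off-diagonal (suc k) zero    _   = refl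
q^-off-diagonal (suc k) (suc n) k≢n = q^-off-diagonal k n (k≢n ∘ cong suc)

sq≟ : ∀ n a → Dec (sq a ≡ n)
sq≟ n a = sq a ℕ.≟ n

opaque
  unfolding _+ₛ_

  partialTheta-count : ∀ N n → partialTheta N n ≡ sgn n ℤ.* + count (sq≟ n) (interval N)
  partialTheta-count zero zero    = refl
  partialTheta-count zero (suc n) = sym (ℤ.*-zeroʳ (sgn (suc n)))
  partialTheta-count (suc N) n = trans (cong (ℤ._+_ (partialTheta N n)) (σ-*ₛ (suc N) (q^ m +ₛ q^ m) n)) (go (m ℕ.≟ n))
    where
    open ℤ-ops using (_+_; _*_)
    m c : ℕ
    m = suc N ℕ.* suc N
    c = count (sq≟ n) (interval N)
    go : Dec (m ≡ n) → partialTheta N n + sgn (suc N) * (q^ m n + q^ m n)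
         ≡ sgn n * + count (sq≟ n) (interval (suc N))
    go (yes m≡n) = begin
      partialTheta N n + sgn (suc N) * (q^ m n + q^ m n)
        ≡⟨ cong₂ (λ x y → x + sgn (suc N) * (y + y)) (partialTheta-count N n) (trans (cong (q^ m) (sym m≡n)) (q^-diagonal m)) ⟩
      sgn n * + c + sgn (suc N) * (1ℤ + 1ℤ)
        ≡⟨ cong (λ s → sgn n * + c + s * (1ℤ + 1ℤ)) (trans (sym (sgn-square (suc N))) (cong sgn m≡n)) ⟩
      sgn n * + c + sgn n * (1ℤ + 1ℤ)
        ≡⟨ lem (sgn n) (+ c) ⟩
      sgn n * (1ℤ + (1ℤ + + c))
        ≡⟨ cong (λ c → sgn n * + c) (trans (count-∷-yes (sq≟ n) {+ suc N} (-[1+ N ] ∷ interval N) m≡n)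
             (cong suc (count-∷-yes (sq≟ n) { -[1+ N ]} (interval N) m≡n))) ⟨
      sgn n * + count (sq≟ n) (interval (suc N)) ∎
      where
      open ≡-Reasoning
      lem : ∀ s c → s * c + s * (1ℤ + 1ℤ) ≡ s * (1ℤ + (1ℤ + c))
      lem = solve-∀
    go (no m≢n) = begin
      partialTheta N n + sgn (suc N) * (q^ m n + q^ m n)
        ≡⟨ cong₂ (λ x y → x + sgn (suc N) * (y + y)) (partialTheta-count N n) (q^-off-diagonal m n m≢n) ⟩
      sgn n * + c + sgn (suc N) * 0ℤ
        ≡⟨ trans (cong (ℤ._+_ (sgn n * + c)) (ℤ.*-zeroʳ (sgn (suc N)))) (ℤ.+-identityʳ _) ⟩
      sgn n * + c
        ≡⟨ cong (λ c → sgn n * + c) (trans (count-∷-no (sq≟ n) {+ suc N} (-[1+ N ] ∷ interval N) m≢n)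
             (count-∷-no (sq≟ n) { -[1+ N ]} (interval N) m≢n)) ⟨
      sgn n * + count (sq≟ n) (interval (suc N)) ∎
      where open ≡-Reasoning

interval-stable : ∀ {N n} → n ≤ N → count (sq≟ n) (interval N) ≡ count (sq≟ n) (interval n)
interval-stable {zero}  {zero} _ = refl
interval-stable {suc N} {n} n≤1+N with ℕ.m≤n⇒m<n∨m≡n n≤1+N
... | inj₂ refl      = refl
... | inj₁ (s≤s n≤N) = trans (count-∷-no (sq≟ n) {+ suc N} (-[1+ N ] ∷ interval N) large)
        (trans (count-∷-no (sq≟ n) { -[1+ N ]} (interval N) large) (interval-stable n≤N))
  where
  large : suc N ℕ.* suc N ≢ n
  large eq = ℕ.<⇒≢ (ℕ.<-≤-trans (s≤s n≤N) (ℕ.m≤m+n (suc N) (N ℕ.* suc N))) (sym eq)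

-- The substitution q ↦ -q, hence multiplicative (`twist-*ₛ`).
twist : Series → Series
twist f n = sgn n ℤ.* f n

θ Pₛ : Series
θ n  = + length (Graded.fibre squares n)
Pₛ n = + p̄ n

-- For the coefficient of index n the bound n is already exact: overpartitions of k ≤ n have no part
-- above n, and a square k ≤ n has its roots in `interval n`.
gauss : Pₛ *ₛ twist θ ≈ₛ 1ₛ
gauss = coefficientwise λ n → subst₂ _≡₅_
  (*ₛ-local (boundedₛ n) Pₛ (partialTheta n) (twist θ) n
    (λ k≤n → cong +_ (countBounded-stable k≤n))
    (λ {k} k≤n → trans (partialTheta-count n k) (cong (λ c → sgn k ℤ.* + c) (interval-stable k≤n))))
  (shanks-low n ℕ.≤-refl)
  (coefficient (bounded*theta≈shanks n) n)

opaque
  unfolding _*ₛ_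

  twist-*ₛ : ∀ f g n → twist (f *ₛ g) n ≡ (twist f *ₛ twist g) n
  twist-*ₛ f g zero    = lem (f 0) (g 0)
    where
    open ℤ-ops using (_*_)
    lem : ∀ a b → 1ℤ * (a * b) ≡ 1ℤ * a * (1ℤ * b)
    lem = solve-∀
  twist-*ₛ f g (suc n) = begin
    - s * (f 0 * g (suc n) + (tail f *ₛ g) n)
      ≡⟨ lem s (f 0) (g (suc n)) ((tail f *ₛ g) n) ⟩
    1ℤ * f 0 * (- s * g (suc n)) + - (s * (tail f *ₛ g) n)
      ≡⟨ cong (λ z → 1ℤ * f 0 * (- s * g (suc n)) + - z) (twist-*ₛ (tail f) g n) ⟩
    1ℤ * f 0 * (- s * g (suc n)) + - (twist (tail f) *ₛ twist g) n
      ≡⟨ cong (ℤ._+_ (1ℤ * f 0 * (- s * g (suc n)))) (-ₛ-*ₛ (twist (tail f)) (twist g) n) ⟨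
    1ℤ * f 0 * (- s * g (suc n)) + ((-ₛ twist (tail f)) *ₛ twist g) n
      ≡⟨ cong (ℤ._+_ (1ℤ * f 0 * (- s * g (suc n))))
           (*ₛ-local (-ₛ twist (tail f)) (tail (twist f)) (twist g) (twist g) n
             (λ {k} _ → ℤ.neg-distribˡ-* (sgn k) (f (suc k))) (λ _ → refl)) ⟩
    1ℤ * f 0 * (- s * g (suc n)) + (tail (twist f) *ₛ twist g) n ∎
    where
    open ≡-Reasoning
    open ℤ-ops using (_*_; _+_; -_)
    s : ℤ
    s = sgn n
    lem : ∀ s a b c → - s * (a * b + c) ≡ 1ℤ * a * (- s * b) + - (s * c)
    lem = solve-∀

  length-cartesianProduct : ∀ {A B : Set} (xs : List A) (ys : List B) →
    length (cartesianProduct xs ys) ≡ length xs ℕ.* length ys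
  length-cartesianProduct []       ys = refl
  length-cartesianProduct (x ∷ xs) ys = trans (length-++ (map (x ,_) ys))
    (cong₂ ℕ._+_ (length-map (x ,_) ys) (length-cartesianProduct xs ys))

  length-conv : ∀ {A B : Set} (F : ℕ → List A) (G : ℕ → List B) n →
    + length (conv F G n) ≡ ((λ k → + length (F k)) *ₛ (λ k → + length (G k))) n
  length-conv F G zero    = trans (cong +_ (length-cartesianProduct (F 0) (G 0))) (ℤ.pos-* (length (F 0)) (length (G 0)))
  length-conv F G (suc n) = trans (cong +_ (length-++ (cartesianProduct (F 0) (G (suc n)))))
    (cong₂ ℤ._+_ (trans (cong +_ (length-cartesianProduct (F 0) (G (suc n)))) (ℤ.pos-* (length (F 0)) (length (G (suc n)))))
                 (length-conv (F ∘ suc) G n))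

θ³ : θ *ₛ (θ *ₛ θ) ≈ₛ λ n → + r₃ n
θ³ = ≈ₛ-sym (≈ₛ-trans (pointwise (length-conv (Graded.fibre squares) (Graded.fibre (squares ⊗ squares))))
  (*ₛ-cong ≈ₛ-refl (pointwise (length-conv (Graded.fibre squares) (Graded.fibre squares)))))

θ⁴ : θ *ₛ (θ *ₛ (θ *ₛ θ)) ≈ₛ λ n → + r₄ n
θ⁴ = ≈ₛ-sym (≈ₛ-trans (pointwise (length-conv (Graded.fibre squares) (Graded.fibre squares³)))
  (*ₛ-cong ≈ₛ-refl (≈ₛ-sym θ³)))

twist-cong : ∀ {f g} → f ≈ₛ g → twist f ≈ₛ twist g
twist-cong {f} {g} (coefficientwise p) = coefficientwise λ n → *-cong₅ (sgn n) (sgn n) (f n) (g n) (≡⇒≡₅ {sgn n} refl) (p n)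

-- f(q⁵)
spread : Series → Series
spread f 0 = f 0
spread f 1 = 0ℤ
spread f 2 = 0ℤ
spread f 3 = 0ℤ
spread f 4 = 0ℤ
spread f (suc (suc (suc (suc (suc n))))) = spread (tail f) n

-- Extraction of exponents divisible by 5, and fifth powers modulo 5

every5th : Series → Series
every5th f n = f (n ℕ.* 5)

opaque
  unfolding _*ₛ_

  -- A factor in q⁵ passes through the extraction unchanged, since it only shifts exponents by
  -- multiples of 5.
  every5th-spread : ∀ f g n → every5th (spread f *ₛ g) n ≡ (f *ₛ every5th g) n
  every5th-spread f g zero    = refl
  every5th-spread f g (suc n) = cong (ℤ._+_ (f 0 ℤ.* g (suc n ℕ.* 5))) (begin
    0ℤ + (0ℤ + (0ℤ + (0ℤ + (spread (tail f) *ₛ g) (n ℕ.* 5))))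
      ≡⟨ lem ((spread (tail f) *ₛ g) (n ℕ.* 5)) ⟩
    (spread (tail f) *ₛ g) (n ℕ.* 5)
      ≡⟨ every5th-spread (tail f) g n ⟩
    (tail f *ₛ every5th g) n ∎)
    where
    open ≡-Reasoning
    open ℤ-ops using (_+_)
    lem : ∀ a → 0ℤ + (0ℤ + (0ℤ + (0ℤ + a))) ≡ a
    lem = solve-∀

  decompose : ∀ f → f ≈ₛ const (f 0) +ₛ q^ 1 *ₛ tail f
  decompose f = pointwise λ { zero → sym (ℤ.+-identityʳ (f 0)) ; (suc n) → sym (trans (ℤ.+-identityˡ _) (q^-shift 1 (tail f) n)) }

  +ₛ-coefficient : ∀ f g n → (f +ₛ g) n ≡ f n ℤ.+ g n
  +ₛ-coefficient f g n = refl

_⁵ : Series → Series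
f ⁵ = f *ₛ (f *ₛ (f *ₛ (f *ₛ f)))

const⁵ : ∀ a → const a ⁵ ≈ₛ const a
const⁵ a = begin
  const a ⁵                           ≈⟨ merge ⟨
  const (a * (a * (a * (a * a))))     ≈⟨ const-cong₅ fermat ⟩
  const a                             ∎
  where
  open SetoidReasoning seriesSetoid
  open ℤ-ops using (_*_; _-_; _+_)
  merge : const (a * (a * (a * (a * a)))) ≈ₛ const a ⁵
  merge = ≈ₛ-trans (pointwise (const-* a _)) (*ₛ-cong ≈ₛ-refl (≈ₛ-trans (pointwise (const-* a _)) (*ₛ-cong ≈ₛ-refl
    (≈ₛ-trans (pointwise (const-* a _)) (*ₛ-cong ≈ₛ-refl (pointwise (const-* a a)))))))
  fermat : a * (a * (a * (a * a))) ≡₅ a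
  fermat = ≡₅-trans {a * (a * (a * (a * a)))} {+ r * (+ r * (+ r * (+ r * + r)))} (up (up (up (up a≡r))))
             (≡₅-trans {+ r * (+ r * (+ r * (+ r * + r)))} {+ r} {a} (residues r (ℤ.n%ℕd<d a 5)) (≡₅-sym {a} a≡r))
    where
    r : ℕ
    r = a ℤ.%ℕ 5
    lem : ∀ r q → r + q * + 5 - r ≡ q * + 5
    lem = solve-∀
    a≡r : a ≡₅ + r
    a≡r = ℤ∣.divides (a ℤ./ℕ 5) (trans (cong (λ z → z - + r) (ℤ.a≡a%ℕn+[a/ℕn]*n a 5)) (lem (+ r) (a ℤ./ℕ 5)))
    up : ∀ {x y} → x ≡₅ y → a * x ≡₅ + r * y
    up {x} {y} = *-cong₅ a (+ r) x y a≡r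
    residues : ∀ r → r < 5 → + 5 ∣ℤ + r * (+ r * (+ r * (+ r * + r))) - + r
    -- The witnesses are (r⁵ - r)/5.
    residues 0 _ = ℤ∣.divides 0ℤ refl
    residues 1 _ = ℤ∣.divides 0ℤ refl
    residues 2 _ = ℤ∣.divides (+ 6) refl
    residues 3 _ = ℤ∣.divides (+ 48) refl
    residues 4 _ = ℤ∣.divides (+ 204) refl
    residues (suc (suc (suc (suc (suc _))))) (s≤s (s≤s (s≤s (s≤s (s≤s ())))))

power⁵-split : ∀ f → f ⁵ ≈ₛ const (f 0) +ₛ q^ 5 *ₛ tail f ⁵
power⁵-split f = begin
  f ⁵                                      ≈⟨ ⁵-cong (decompose f) ⟩
  (const (f 0) +ₛ q^ 1 *ₛ tail f) ⁵        ≈⟨ binomial (const (f 0)) (q^ 1) (tail f) ⟩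
  const (f 0) ⁵ +ₛ q^ 1 ⁵ *ₛ tail f ⁵      ≈⟨ +ₛ-cong (const⁵ (f 0)) (*ₛ-cong q⁵ ≈ₛ-refl) ⟩
  const (f 0) +ₛ q^ 5 *ₛ tail f ⁵          ∎
  where
  open SetoidReasoning seriesSetoid
  ⁵-cong : ∀ {f g} → f ≈ₛ g → f ⁵ ≈ₛ g ⁵
  ⁵-cong p = *ₛ-cong p (*ₛ-cong p (*ₛ-cong p (*ₛ-cong p p)))
  q⁵ : q^ 1 ⁵ ≈ₛ q^ 5
  q⁵ = ≈ₛ-sym (≈ₛ-trans (q^-+ 1 4) (*ₛ-cong ≈ₛ-refl (≈ₛ-trans (q^-+ 1 3) (*ₛ-cong ≈ₛ-refl
    (≈ₛ-trans (q^-+ 1 2) (*ₛ-cong ≈ₛ-refl (q^-+ 1 1)))))))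
  binomial : ∀ a q t → (a +ₛ q *ₛ t) ⁵ ≈ₛ a ⁵ +ₛ q ⁵ *ₛ t ⁵
  binomial = solve 3 (λ a q t →
    let _:⁵ = λ x → x :* (x :* (x :* (x :* x)))
    in (a :+ q :* t) :⁵ := a :⁵ :+ q :⁵ :* t :⁵) ≈ₛ-refl

-- Splitting off the constant term gives f⁵ ≡ f(0) + q⁵ (tail f)⁵ modulo 5, which is the recursion
-- defining `spread`. The induction therefore advances by 5 in `n` and by one tail in `f`.
freshman : ∀ n f → (f ⁵) n ≡₅ spread f n
freshman n f = ≡₅-trans {(f ⁵) n} {(const (f 0) +ₛ q^ 5 *ₛ tail f ⁵) n} (coefficient (power⁵-split f) n)
  (subst (_≡₅ spread f n) (sym (+ₛ-coefficient (const (f 0)) (q^ 5 *ₛ tail f ⁵) n)) (go n))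
  where
  below : ∀ n → n < 5 → const (f 0) n ≡ spread f n → const (f 0) n ℤ.+ (q^ 5 *ₛ tail f ⁵) n ≡₅ spread f n
  below n n<5 eq = ≡⇒≡₅ (trans (cong₂ ℤ._+_ eq (q^-low 5 (tail f ⁵) n<5)) (ℤ.+-identityʳ (spread f n)))
  go : ∀ n → const (f 0) n ℤ.+ (q^ 5 *ₛ tail f ⁵) n ≡₅ spread f n
  go 0 = below 0 (s≤s z≤n) refl
  go 1 = below 1 (s≤s (s≤s z≤n)) refl
  go 2 = below 2 (s≤s (s≤s (s≤s z≤n))) refl
  go 3 = below 3 (s≤s (s≤s (s≤s (s≤s z≤n)))) refl
  go 4 = below 4 (s≤s (s≤s (s≤s (s≤s (s≤s z≤n))))) refl
  go (suc (suc (suc (suc (suc n))))) = subst (_≡₅ spread (tail f) n)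
    (sym (trans (ℤ.+-identityˡ _) (q^-shift 5 (tail f ⁵) n))) (freshman n (tail f))

-- Overpartitions of multiples of 5 and three squares

≡+5*⇒≡₅ : ∀ {a b} k → a ≡ b ℕ.+ 5 ℕ.* k → + a ≡₅ + b
≡+5*⇒≡₅ {b = b} k refl = ℤ∣.divides (+ k) (trans (cong (λ z → + b + z - + b) (ℤ.pos-* 5 k)) (lem (+ b) (+ k)))
  where
  open ℤ-ops using (_+_; _*_; _-_)
  lem : ∀ r k → r + + 5 * k - r ≡ k * + 5
  lem = solve-∀

prime-5 : Prime 5
prime-5 = toWitness {a? = prime? 5} _

r₄-*5 : ∀ n → + r₄ (n ℕ.* 5) ≡₅ + r₄ n
r₄-*5 n = let k , eq = FourSquares.r₄-multiple prime-5 (λ ()) n in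
  ≡+5*⇒≡₅ {r₄ (n ℕ.* 5)} {r₄ n} k (trans (cong r₄ (ℕ.*-comm n 5)) eq)

-- Extraction yields F U ≈ F F³ for F = `twist θ` and U = `every5th Pₛ`. The factor F is invertible
-- by `gauss`, its inverse being `Pₛ` itself, so it cancels.
p̄-*5-series : every5th Pₛ ≈ₛ twist (λ n → + r₃ n)
p̄-*5-series = begin
  U                                        ≈⟨ pointwise (λ n → sym (*ₛ-identityˡ U n)) ⟩
  1ₛ *ₛ U                                  ≈⟨ *ₛ-cong (≈ₛ-sym gauss) ≈ₛ-refl ⟩
  (Pₛ *ₛ F) *ₛ U                           ≈⟨ pointwise (*ₛ-assoc Pₛ F U) ⟩
  Pₛ *ₛ (F *ₛ U)                           ≈⟨ *ₛ-cong ≈ₛ-refl FU≈F⁴ ⟩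
  Pₛ *ₛ (F *ₛ F³)                          ≈⟨ pointwise (*ₛ-assoc Pₛ F F³) ⟨
  (Pₛ *ₛ F) *ₛ F³                          ≈⟨ *ₛ-cong gauss ≈ₛ-refl ⟩
  1ₛ *ₛ F³                                 ≈⟨ pointwise (*ₛ-identityˡ F³) ⟩
  F³                                       ≈⟨ twist³ ⟨
  twist (θ *ₛ (θ *ₛ θ))                    ≈⟨ twist-cong θ³ ⟩
  twist (λ n → + r₃ n)                     ∎
  where
  open SetoidReasoning seriesSetoid
  F F³ U : Series
  F  = twist θ
  F³ = F *ₛ (F *ₛ F)
  U  = every5th Pₛ
  twist³ : twist (θ *ₛ (θ *ₛ θ)) ≈ₛ F³
  twist³ = ≈ₛ-trans (pointwise (twist-*ₛ θ (θ *ₛ θ))) (*ₛ-cong ≈ₛ-refl (pointwise (twist-*ₛ θ θ)))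
  F⁴ : F *ₛ F³ ≈ₛ twist (λ n → + r₄ n)
  F⁴ = ≈ₛ-trans (≈ₛ-sym (≈ₛ-trans (pointwise (twist-*ₛ θ (θ *ₛ (θ *ₛ θ)))) (*ₛ-cong ≈ₛ-refl twist³))) (twist-cong θ⁴)
  spread-P : spread F *ₛ Pₛ ≈ₛ F *ₛ F³
  spread-P = begin
    spread F *ₛ Pₛ                         ≈⟨ *ₛ-cong (≈ₛ-sym (coefficientwise λ n → freshman n F)) ≈ₛ-refl ⟩
    F ⁵ *ₛ Pₛ                              ≈⟨ lem F Pₛ ⟩
    (Pₛ *ₛ F) *ₛ (F *ₛ F³)                 ≈⟨ *ₛ-cong gauss ≈ₛ-refl ⟩
    1ₛ *ₛ (F *ₛ F³)                        ≈⟨ pointwise (*ₛ-identityˡ (F *ₛ F³)) ⟩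
    F *ₛ F³                                ∎
    where
    lem : ∀ f p → f ⁵ *ₛ p ≈ₛ (p *ₛ f) *ₛ (f *ₛ (f *ₛ (f *ₛ f)))
    lem = solve 2 (λ f p → (f :* (f :* (f :* (f :* f)))) :* p := (p :* f) :* (f :* (f :* (f :* f)))) ≈ₛ-refl
  every5th-cong : ∀ {f g} → f ≈ₛ g → every5th f ≈ₛ every5th g
  every5th-cong (coefficientwise p) = coefficientwise λ n → p (n ℕ.* 5)
  FU≈F⁴ : F *ₛ U ≈ₛ F *ₛ F³
  FU≈F⁴ = begin
    F *ₛ U                                 ≈⟨ pointwise (every5th-spread F Pₛ) ⟨
    every5th (spread F *ₛ Pₛ)              ≈⟨ every5th-cong (≈ₛ-trans spread-P F⁴) ⟩
    -- The twist survives the extraction because 5 is odd: `n * 5` and `n` have the same parity.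
    every5th (twist (λ n → + r₄ n))        ≈⟨ coefficientwise (λ n → *-cong₅ (sgn (n ℕ.* 5)) (sgn n) (+ r₄ (n ℕ.* 5)) (+ r₄ n)
                                                (≡⇒≡₅ (sgn-*5 n)) (r₄-*5 n)) ⟩
    twist (λ n → + r₄ n)                   ≈⟨ F⁴ ⟨
    F *ₛ F³                                ∎

5∣r₃⇒5∣p̄ : ∀ n → 5 ℕ∣.∣ r₃ n → 5 ℕ∣.∣ p̄ (n ℕ.* 5)
5∣r₃⇒5∣p̄ n 5∣r₃ = ℤ∣.∣⇒∣ᵤ (subst (+ 5 ∣ℤ_) (lem (+ p̄ (n ℕ.* 5)) (sgn n ℤ.* + r₃ n))
  (ℤ∣.∣m∣n⇒∣m+n (coefficient p̄-*5-series n) (ℤ∣.∣n⇒∣m*n (sgn n) (ℤ∣.∣ᵤ⇒∣ 5∣r₃))))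
  where
  open ℤ-ops using (_+_; _-_)
  lem : ∀ a b → a - b + b ≡ a
  lem = solve-∀

-- Assembling the congruence

open import Data.Nat using (ℕ; _*_; _^_; _%_)
open import Data.Nat.Divisibility using (_∣_)
open import Data.Nat.Primality using (Prime)
open import Data.Integer using (+_; -_; -1ℤ)

r₃-*4^ : ∀ k m → r₃ (4 ^ k * m) ≡ r₃ m
r₃-*4^ zero    m = cong r₃ (ℕ.*-identityˡ m)
r₃-*4^ (suc k) m = trans (cong r₃ (ℕ.*-assoc 4 (4 ^ k) m)) (trans (r₃-quadruple (4 ^ k * m)) (r₃-*4^ k m))

theorem1p4 : (k ℓ : ℕ) → Prime ℓ → ℓ % 5 ≡ 3 →
    (n : ℕ) → legendre (- (+ n)) ℓ ≡ -1ℤ →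
    5 ∣ p̄ (4 ^ k * 5 * ℓ ^ 2 * n)
theorem1p4 k ℓ ℓ-prime ℓ%5≡3 n legendre≡-1 =
  subst (λ m → 5 ∣ p̄ m) (rearrange (4 ^ k) ℓ n) (5∣r₃⇒5∣p̄ m 5∣r₃)
  where
  m : ℕ
  m = 4 ^ k * (ℓ * ℓ * n)
  odd : ℓ ≢ 2
  odd ℓ≡2 = contradiction (trans (sym (cong (_% 5) ℓ≡2)) ℓ%5≡3) λ ()
  nonresidue : ∀ u → ¬ + ℓ ∣ℤ u ℤ.* u ℤ.+ + n
  nonresidue = nonsquare⇒nonresidue ℓ {{prime⇒nonZero ℓ-prime}} n
    (legendre≡-1⇒nonsquare (- (+ n)) ℓ legendre≡-1)
  r₃-m : r₃ m ≡ (2 ℕ.+ ℓ) * r₃ n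
  r₃-m = trans (r₃-*4^ k (ℓ * ℓ * n)) (ThreeSquares.r₃-multiple ℓ-prime odd n nonresidue)
  5∣2+ℓ : 5 ∣ 2 ℕ.+ ℓ
  5∣2+ℓ = ℕ∣.m%n≡0⇒n∣m (2 ℕ.+ ℓ) 5 (trans (%-distribˡ-+ 2 ℓ 5) (cong (λ r → (2 ℕ.+ r) % 5) ℓ%5≡3))
  5∣r₃ : 5 ∣ r₃ m
  5∣r₃ = subst (5 ∣_) (sym r₃-m) (ℕ∣.∣m⇒∣m*n (r₃ n) 5∣2+ℓ)
  rearrange : ∀ a ℓ n → a * (ℓ * ℓ * n) * 5 ≡ a * 5 * ℓ ^ 2 * n
  rearrange = lem
    where
    lem : ∀ a ℓ n → a * (ℓ * ℓ * n) * 5 ≡ a * 5 * (ℓ * (ℓ * 1)) * n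
    lem = ℕ-solver.solve-∀
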